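{- There exists $\bar n_1$ such that for every $n\ge \bar n_1$ and every integer $m$ with $\binom{\lfloor n/2\rfloor}{2}-\frac n5\le m\le \binom{\lfloor n/2\rfloor}{2}$, each $4$-graph in $\mathcal F(n,m)$ is a subgraph of a thick clique on $n$ vertices. Moreover, there exists $\tilde n_1$ such that for every $n\ge \tilde n_1$ and all $m\ge \binom{\lfloor n/2\rfloor}{2}+1$, each $4$-graph in $\mathcal F(n,m)$ has maximum degree at least $n^2/32-n$, and one can delete from it at most $470$ edges to obtain a union of at most four $2$-stars and some number of isolated vertices.
   Context: A $4$-graph $H=(V,E)$ is a family of distinct $4$-element subsets (edges) of a finite vertex set $V$; $\Delta(H)$ denotes its maximum degree (degree = number of edges containing a vertex). $P^4_2$ denotes the loose path of length two: two edges sharing exactly one vertex; $H$ is $P^4_2$-free if it contains no copy of it. Define $f(n,m)=\min\{\Delta(H): H$ is a $P^4_2$-free $4$-graph with $n$ vertices and $m$ edges$\}$ and let $\mathcal F(n,m)$ be the family of $P^4_2$-free $4$-graphs on $n$ vertices with $m$ edges and $\Delta(H)=f(n,m)$. The thick clique on $n$ vertices is the $4$-graph whose vertex set is partitioned into $\lfloor n/2\rfloor$ disjoint pairs (plus one extra vertex if $n$ is odd) and whose edges are all unions of two distinct such pairs. A $2$-star is a $4$-graph in which all edges contain two fixed vertices (its center). -}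

module Defs where

open import Data.Nat using (ℕ; _+_; _*_; _∸_; _≤_; _⊔_; _/_)
open import Data.Nat.Combinatorics using (_C_)
open import Data.Fin using (Fin)
open import Data.Fin.Subset using (Subset; _∈_; _∩_; ∣_∣)
open import Data.Fin.Subset.Properties using (_∈?_)
open import Data.List using (List; length; filter; map; foldr; allFin)
open import Data.List.Membership.Propositional using () renaming (_∈_ to _∈ₗ_)
open import Data.List.Relation.Unary.Unique.Propositional using (Unique)
open import Data.List.Relation.Binary.Sublist.Propositional using () renaming (_⊆_ to _⊑_)
open import Data.Product using (Σ; _×_; ∃)
open import Relation.Binary.PropositionalEquality using (_≡_; _≢_)
open import Relation.Nullary using (¬_)

record Graph4 (n : ℕ) : Set where
  constructor mkGraph4
  field
    edges    : List (Subset n)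
    size4    : ∀ {e} → e ∈ₗ edges → ∣ e ∣ ≡ 4
    distinct : Unique edges
open Graph4 public

#E : ∀ {n} → Graph4 n → ℕ
#E H = length (edges H)

deg : ∀ {n} → Graph4 n → Fin n → ℕ
deg H v = length (filter (v ∈?_) (edges H))

Δ : ∀ {n} → Graph4 n → ℕ
Δ {n} H = foldr _⊔_ 0 (map (deg H) (allFin n))

P42-free : ∀ {n} → Graph4 n → Set
P42-free H = ∀ {e f} → e ∈ₗ edges H → f ∈ₗ edges H → ∣ e ∩ f ∣ ≢ 1

InF : (n m : ℕ) → Graph4 n → Set
InF n m H = P42-free H × #E H ≡ m
          × (∀ (H' : Graph4 n) → P42-free H' → #E H' ≡ m → Δ H ≤ Δ H')

-- A pairing of Fin n for a thick clique: an involution with at most one fixed point;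
-- its pairs {v, σ v} (σ v ≢ v) are the ⌊n/2⌋ pairs, the fixed point (if any) the extra vertex.
record Pairing (n : ℕ) : Set where
  field
    σ      : Fin n → Fin n
    invol  : ∀ v → σ (σ v) ≡ v
    fixed≤1 : ∀ u v → σ u ≡ u → σ v ≡ v → u ≡ v
open Pairing public

-- a 4-set is an edge of the thick clique given by the pairing P
-- (i.e. the union of two distinct pairs): it has 4 elements, and is closed
-- under σ and contains no fixed point of σ.
ThickEdge : ∀ {n} → Pairing n → Subset n → Set
ThickEdge P e = ∣ e ∣ ≡ 4 × (∀ v → v ∈ e → (σ P v ∈ e) × (σ P v ≢ v))

SubThick : ∀ {n} → Graph4 n → Set
SubThick {n} H = Σ (Pairing n) λ P → ∀ {e} → e ∈ₗ edges H → ThickEdge P e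

-- H is, after deleting some edges, a vertex-disjoint union of k 2-stars
-- and isolated vertices: every remaining edge lies in one colour class i
-- and contains both centre vertices a i ≢ b i of the i-th star.
UnionOf2Stars : ∀ {n} → ℕ → List (Subset n) → Set
UnionOf2Stars {n} k E =
  Σ (Fin k → Fin n) λ a → Σ (Fin k → Fin n) λ b → Σ (Fin n → Fin k) λ c →
    (∀ i → a i ≢ b i) ×
    (∀ {e} → e ∈ₗ E → ∃ λ i → a i ∈ e × b i ∈ e × (∀ v → v ∈ e → c v ≡ i))

DeleteToStars : ∀ {n} → ℕ → Graph4 n → Set
DeleteToStars d H = Σ (List _) λ E' → E' ⊑ edges H × length (edges H) ∸ length E' ≤ d
                    × Σ ℕ λ k → k ≤ 4 × UnionOf2Stars k E'

half2 : ℕ → ℕ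
half2 n = (n / 2) C 2

{-# OPTIONS --safe #-}
-- Four edges through a, b pairwise meeting only in {a, b} force every edge meeting {a, b} to contain both
-- (a set of size 4 cannot hit four disjoint petals as well). If moreover some triple a, b, c lies in at least
-- four edges, then {a, b} is the centre of a 2-star, and all edges touching its spokes belong to that star.
-- After removing all spokes, repeatedly delete a triple of maximal degree ≥ 4 with its neighbours; this costs at
-- most 7 edges per vertex. In what remains every triple lies in at most three edges, and a vertex of degree
-- above 45 has a twin: the links of these vertices are matchings, so this part is close to a thick clique.
--
-- If m is near half2 n, comparison with the thick clique gives Δ = O(n), which leaves room for no star and
-- for at most two vertices of small degree. If m > half2 n, let Δ = c + 1. Any disjoint union of stars of
-- maximum degree at most c has fewer than m edges, since Δ is minimal. With τ maximal such that a full star with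
-- τ spokes has degree at most c, this yields n < 4 τ, so that at most three stars are saturated; regrouping the
-- remaining vertices into one larger star would gain edges unless all but four stars carry at most 470 edges.
module Submission where

open import Defs
open import Data.Bool using (true)
open import Data.Empty using (⊥; ⊥-elim)
open import Data.Fin as Fin using (Fin; zero; suc; toℕ; fromℕ<)
open import Data.Fin.Properties using (any?; all?; toℕ-fromℕ<; toℕ-injective) renaming (_≟_ to _≟F_)
open import Data.Fin.Subset using (Subset; _∈_; _∉_; _∩_; ∣_∣; inside; outside)
open import Data.Fin.Subset.Properties using (_∈?_; ⊆-antisym; x∈p∩q⁺; x∈p∩q⁻)
open import Data.List using (List; []; _∷_; _++_; length; filter; map; allFin; foldr; take; upTo; replicate; lookup; cartesianProduct)
open import Data.List.Membership.Propositional using (find; lose) renaming (_∈_ to _∈ₗ_)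
open import Data.List.Membership.Propositional.Properties using (∈-filter⁺; ∈-filter⁻; ∈-allFin; ∈-cartesianProduct⁺; ∈-map⁻; ∈-++⁻; ∈-++⁺ˡ; ∈-upTo⁻; ∈-lookup)
open import Data.List.Properties using (length-filter; filter-all; map-tabulate; length-tabulate; length-map; length-++; length-take; length-upTo)
open import Data.List.Relation.Binary.Disjoint.Propositional using (Disjoint)
open import Data.List.Relation.Binary.Permutation.Propositional as ↭ using (_↭_; refl; prep; swap; ↭-sym)
open import Data.List.Relation.Binary.Permutation.Propositional.Properties using (∈-resp-↭; All-resp-↭; ↭-length; ++-identityʳ)
open import Data.List.Relation.Binary.Sublist.Propositional.Properties using (filter-⊆)
open import Data.List.Relation.Unary.All as All using (All; []; _∷_)
open import Data.List.Relation.Unary.All.Properties using (replicate⁺) renaming (++⁺ to All-++⁺)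
open import Data.List.Relation.Unary.AllPairs using ([]; _∷_)
open import Data.List.Relation.Unary.Any as Any using (Any; here; there)
open import Data.List.Relation.Unary.Any.Properties using (lookup-index)
open import Data.List.Relation.Unary.Unique.Propositional using (Unique)
import Data.List.Relation.Unary.Unique.Propositional.Properties as Uniq
open import Data.Nat using (ℕ; zero; suc; _+_; _*_; _∸_; _≤_; _<_;  _⊓_; _⊔_; ⌊_/2⌋; z≤n; s≤s)
open import Data.Nat.Combinatorics using (nCk+nC[k+1]≡[n+1]C[k+1]; nC1≡n) renaming (_C_ to _choose_)
open import Data.Nat.DivMod using (_/_; _%_; m≡m%n+[m/n]*n; m%n<n; m/n*n≤m)
open import Data.Nat.ListAction using (sum)
open import Data.Nat.Properties
open import Data.Nat.Tactic.RingSolver using (solve-∀)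
open import Data.Product using (Σ; _×_; _,_; proj₁; proj₂; ∃)
open import Data.Sum using (_⊎_; inj₁; inj₂)
open import Data.Unit using (⊤; tt)
open import Data.Vec using ([]; _∷_; here; there) renaming (tabulate to tabulateᵛ)
open import Data.Vec.Properties using ([]=⇒lookup; lookup⇒[]=; lookup∘tabulate)
open import Function using (_∘_)
open import Relation.Binary.Definitions using (Tri; tri<; tri≈; tri>)
open import Relation.Binary.PropositionalEquality as ≡ using (_≡_; _≢_; refl; cong; cong₂; sym; trans; subst)
open import Relation.Nullary using (¬_; Dec; yes; no; contradiction; does)
open import Relation.Unary using (Decidable)
open import Relation.Nullary.Decidable using (_×-dec_; _⊎-dec_; _→-dec_; ¬?; dec-true)

-- For m above `half2 n` the extremal value is never computed. Minimality enters only as follows: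
-- with c one less than the maximum degree, no union of stars with at most c edges each reaches m. A
-- star of the given graph may have c + 1 edges, so a comparison loses at most one edge per kept
-- star; this explains the small additive constants in the numerical part. Only spokes are split
-- off; centres stay with the remainder. Hence k stars occupy 2k of the w outside vertices, and a
-- bound on w bounds the number of stars. The remainder has ℓ low and H high vertices, ℓ + H = w,
-- and needs two size estimates. `Bound₁` has the smaller linear coefficient, which keeps the final
-- residue below 471, but contains the product 3ℓH. `Bound₂` is coarse in ℓ, but its leading term
-- H²/8 is that of a thick clique, as comparisons of quadratic terms require. Stripped vertices may
-- be counted as low, because 8 · 7 ≤ 90 ≤ 360.

-- Counting in lists, sums and double counting

opaque
  # : ∀ {A : Set} {P : A → Set} → Decidable P → List A → ℕ
  # P? xs = length (filter P? xs)

  #-length : ∀ {A : Set} {P : A → Set} (P? : Decidable P) (xs : List A) → # P? xs ≡ length (filter P? xs)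
  #-length P? xs = refl

  #-[] : ∀ {A : Set} {P : A → Set} (P? : Decidable P) → # P? [] ≡ 0
  #-[] P? = refl

Σ[_] : ∀ {A : Set} → (A → ℕ) → List A → ℕ
Σ[ f ] xs = sum (map f xs)

ind : ∀ {P : Set} → Dec P → ℕ
ind (yes _) = 1
ind (no _)  = 0

ind-yes : ∀ {P : Set} (d : Dec P) → P → ind d ≡ 1
ind-yes (yes _) _ = refl
ind-yes (no ¬p) p = contradiction p ¬p

ind-no : ∀ {P : Set} (d : Dec P) → ¬ P → ind d ≡ 0
ind-no (yes p) ¬p = contradiction p ¬p
ind-no (no _)  _ = refl

private variable
  A B : Set
  P Q : A → Set

opaque
  unfolding #
  #-∷ : (P? : Decidable P) → ∀ x (xs : List A) → # P? (x ∷ xs) ≡ ind (P? x) + # P? xs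
  #-∷ P? x xs with P? x
  ... | yes _ = refl
  ... | no _  = refl

opaque
  unfolding #
  #-ind : (P? : Decidable P) → ∀ (xs : List A) → # P? xs ≡ Σ[ (λ x → ind (P? x)) ] xs
  #-ind P? [] = refl
  #-ind P? (x ∷ xs) = trans (#-∷ P? x xs) (cong (ind (P? x) +_) (#-ind P? xs))

Σ-mono : ∀ {f g : A → ℕ} (xs : List A) → (∀ {x} → x ∈ₗ xs → f x ≤ g x) → Σ[ f ] xs ≤ Σ[ g ] xs
Σ-mono [] h = z≤n
Σ-mono (x ∷ xs) h = +-mono-≤ (h (here refl)) (Σ-mono xs (h ∘ there))

Σ-cong : ∀ {f g : A → ℕ} (xs : List A) → (∀ {x} → x ∈ₗ xs → f x ≡ g x) → Σ[ f ] xs ≡ Σ[ g ] xs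
Σ-cong [] h = refl
Σ-cong (x ∷ xs) h = cong₂ _+_ (h (here refl)) (Σ-cong xs (h ∘ there))

Σ-+ : ∀ (f g : A → ℕ) (xs : List A) → Σ[ (λ x → f x + g x) ] xs ≡ Σ[ f ] xs + Σ[ g ] xs
Σ-+ f g [] = refl
Σ-+ f g (x ∷ xs) = trans (cong (f x + g x +_) (Σ-+ f g xs)) (eq (f x) (g x) _ _)
  where eq : ∀ a b c d → a + b + (c + d) ≡ a + c + (b + d)
        eq = solve-∀

Σ-* : ∀ k (f : A → ℕ) (xs : List A) → Σ[ (λ x → k * f x) ] xs ≡ k * Σ[ f ] xs
Σ-* k f [] = sym (*-zeroʳ k)
Σ-* k f (x ∷ xs) = trans (cong (k * f x +_) (Σ-* k f xs)) (sym (*-distribˡ-+ k (f x) _))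

Σ-0 : ∀ (xs : List A) → Σ[ (λ _ → 0) ] xs ≡ 0
Σ-0 [] = refl
Σ-0 (x ∷ xs) = Σ-0 xs

opaque
  Σ-swap : ∀ (f : A → B → ℕ) (xs : List A) (ys : List B) →
    Σ[ (λ x → Σ[ f x ] ys) ] xs ≡ Σ[ (λ y → Σ[ (λ x → f x y) ] xs) ] ys
  Σ-swap f [] ys = sym (Σ-0 ys)
  Σ-swap f (x ∷ xs) ys = trans (cong (Σ[ f x ] ys +_) (Σ-swap f xs ys))
    (sym (Σ-+ (f x) (λ y → Σ[ (λ x → f x y) ] xs) ys))

Σ-↭ : ∀ (f : A → ℕ) {xs ys : List A} → xs ↭ ys → Σ[ f ] xs ≡ Σ[ f ] ys
Σ-↭ f refl = refl
Σ-↭ f (prep x p) = cong (f x +_) (Σ-↭ f p)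
Σ-↭ f (swap x y p) = trans (cong (λ z → f x + (f y + z)) (Σ-↭ f p)) (eq (f x) (f y) _)
  where eq : ∀ a b c → a + (b + c) ≡ b + (a + c)
        eq = solve-∀
Σ-↭ f (↭.trans p q) = trans (Σ-↭ f p) (Σ-↭ f q)

opaque
  double-count : {R : A → B → Set} (R? : ∀ x y → Dec (R x y)) (xs : List A) (ys : List B) →
    Σ[ (λ x → # (R? x) ys) ] xs ≡ Σ[ (λ y → # (λ x → R? x y) xs) ] ys
  double-count R? xs ys = trans (Σ-cong xs (λ {x} _ → #-ind (R? x) ys))
    (trans (Σ-swap (λ x y → ind (R? x y)) xs ys) (Σ-cong ys (λ {y} _ → sym (#-ind (λ x → R? x y) xs))))

opaque
  unfolding #
  #-mono : (P? : Decidable P) (Q? : Decidable Q) (xs : List A) →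
    (∀ {x} → x ∈ₗ xs → P x → Q x) → # P? xs ≤ # Q? xs
  #-mono P? Q? [] h = z≤n
  #-mono P? Q? (x ∷ xs) h with P? x | Q? x
  ... | yes p | yes q = s≤s (#-mono P? Q? xs (h ∘ there))
  ... | yes p | no ¬q = contradiction (h (here refl) p) ¬q
  ... | no ¬p | yes q = m≤n⇒m≤1+n (#-mono P? Q? xs (h ∘ there))
  ... | no ¬p | no ¬q = #-mono P? Q? xs (h ∘ there)

#-≐ : (P? : Decidable P) (Q? : Decidable Q) (xs : List A) →
  (∀ {x} → x ∈ₗ xs → P x → Q x) → (∀ {x} → x ∈ₗ xs → Q x → P x) → # P? xs ≡ # Q? xs
#-≐ P? Q? xs h g = ≤-antisym (#-mono P? Q? xs h) (#-mono Q? P? xs g)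

opaque
  unfolding #
  #-∪∩ : (P? : Decidable P) (Q? : Decidable Q) (xs : List A) →
    # (λ x → P? x ⊎-dec Q? x) xs + # (λ x → P? x ×-dec Q? x) xs ≡ # P? xs + # Q? xs
  #-∪∩ P? Q? [] = refl
  #-∪∩ P? Q? (x ∷ xs) with P? x | Q? x
  ... | yes p | yes q = cong suc (trans (+-suc _ _) (trans (cong suc (#-∪∩ P? Q? xs)) (sym (+-suc _ _))))
  ... | yes p | no ¬q = cong suc (#-∪∩ P? Q? xs)
  ... | no ¬p | yes q = trans (cong suc (#-∪∩ P? Q? xs)) (sym (+-suc _ _))
  ... | no ¬p | no ¬q = #-∪∩ P? Q? xs

#-∪ : (P? : Decidable P) (Q? : Decidable Q) (xs : List A) →
  # (λ x → P? x ⊎-dec Q? x) xs ≤ # P? xs + # Q? xs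
#-∪ P? Q? xs = ≤-trans (m≤m+n _ _) (≤-reflexive (#-∪∩ P? Q? xs))

opaque
  unfolding #
  #-split : (P? : Decidable P) (Q? : Decidable Q) (xs : List A) →
    # P? xs ≡ # (λ x → P? x ×-dec Q? x) xs + # (λ x → P? x ×-dec ¬? (Q? x)) xs
  #-split P? Q? [] = refl
  #-split P? Q? (x ∷ xs) with P? x | Q? x
  ... | yes p | yes q = cong suc (#-split P? Q? xs)
  ... | yes p | no ¬q = trans (cong suc (#-split P? Q? xs)) (sym (+-suc _ _))
  ... | no ¬p | yes q = #-split P? Q? xs
  ... | no ¬p | no ¬q = #-split P? Q? xs

opaque
  unfolding #
  #-compl : (P? : Decidable P) (xs : List A) → # P? xs + # (λ x → ¬? (P? x)) xs ≡ length xs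
  #-compl P? [] = refl
  #-compl P? (x ∷ xs) with P? x
  ... | yes p = cong suc (#-compl P? xs)
  ... | no ¬p = trans (+-suc _ _) (cong suc (#-compl P? xs))

opaque
  unfolding #
  #-filter : (P? : Decidable P) (Q? : Decidable Q) (xs : List A) →
    # Q? (filter P? xs) ≡ # (λ x → P? x ×-dec Q? x) xs
  #-filter P? Q? [] = refl
  #-filter P? Q? (x ∷ xs) with P? x
  ... | no _ = #-filter P? Q? xs
  ... | yes _ with Q? x
  ...   | yes _ = cong suc (#-filter P? Q? xs)
  ...   | no _  = #-filter P? Q? xs

opaque
  unfolding #
  #-≤-length : (P? : Decidable P) (xs : List A) → # P? xs ≤ length xs
  #-≤-length P? xs = length-filter P? xs

opaque
  unfolding #
  #-∃ : (P? : Decidable P) (xs : List A) → 1 ≤ # P? xs → ∃ λ x → x ∈ₗ xs × P x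
  #-∃ P? (x ∷ xs) h with P? x
  ... | yes p = x , here refl , p
  ... | no ¬p with y , m , q ← #-∃ P? xs h = y , there m , q

opaque
  unfolding #
  #-∄ : (P? : Decidable P) (xs : List A) → # P? xs ≡ 0 → ∀ {x} → x ∈ₗ xs → ¬ P x
  #-∄ P? (y ∷ xs) h (here refl) p with P? y
  ... | no ¬p = ¬p p
  #-∄ P? (y ∷ xs) h (there m) p with P? y
  ... | no _ = #-∄ P? xs h m p

opaque
  unfolding #
  #-none : (P? : Decidable P) (xs : List A) → (∀ {x} → x ∈ₗ xs → ¬ P x) → # P? xs ≡ 0
  #-none P? [] h = refl
  #-none P? (x ∷ xs) h with P? x
  ... | yes p = contradiction p (h (here refl))
  ... | no _ = #-none P? xs (h ∘ there)

#-pos : (P? : Decidable P) (xs : List A) → ∀ {x} → x ∈ₗ xs → P x → 1 ≤ # P? xs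
#-pos P? xs m p with # P? xs in eq
... | zero  = contradiction p (#-∄ P? xs eq m)
... | suc _ = s≤s z≤n

opaque
  unfolding #
  #-only : (P? : Decidable P) {xs : List A} → Unique xs →
    (∀ {x y} → x ∈ₗ xs → y ∈ₗ xs → P x → P y → x ≡ y) → # P? xs ≤ 1
  #-only P? [] h = z≤n
  #-only P? {x ∷ xs} (x∉ ∷ u) h with P? x
  ... | no _ = #-only P? u (λ m m' → h (there m) (there m'))
  ... | yes p = s≤s (≤-reflexive (#-none P? xs λ m q → All.lookup x∉ m (h (here refl) (there m) p q)))

module _ (_≟_ : (x y : A) → Dec (x ≡ y)) where
  #-remove : (P? : Decidable P) {xs : List A} → Unique xs → ∀ {a} → a ∈ₗ xs → P a →
    # P? xs ≡ suc (# (λ x → P? x ×-dec ¬? (x ≟ a)) xs)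
  #-remove P? {xs} u {a} m p = trans (#-split P? (_≟ a) xs)
    (cong (_+ # (λ x → P? x ×-dec ¬? (x ≟ a)) xs)
      (≤-antisym (#-only (λ x → P? x ×-dec (x ≟ a)) u λ _ _ q r → trans (proj₂ q) (sym (proj₂ r)))
                 (#-pos (λ x → P? x ×-dec (x ≟ a)) xs m (p , refl))))

-- Made for degree sums: k and l become the degree bounds of high and of low vertices. The classes
-- may overlap, as only an upper bound is claimed.
Σ-two-classes : (P? : Decidable P) (Q? : Decidable Q) (f : A → ℕ) (k l : ℕ) (xs : List A) →
  (∀ {x} → x ∈ₗ xs → f x ≡ 0 ⊎ (P x × f x ≤ k) ⊎ (Q x × f x ≤ l)) →
  Σ[ f ] xs ≤ k * # P? xs + l * # Q? xs
Σ-two-classes {P = P} {Q = Q} P? Q? f k l xs h = ≤-trans (Σ-mono xs λ {x} m → aux x (h m))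
  (≤-reflexive (trans (Σ-+ (λ x → k * ind (P? x)) (λ x → l * ind (Q? x)) xs)
    (cong₂ _+_ (trans (Σ-* k (ind ∘ P?) xs) (cong (k *_) (sym (#-ind P? xs))))
               (trans (Σ-* l (ind ∘ Q?) xs) (cong (l *_) (sym (#-ind Q? xs)))))))
  where
  aux : ∀ x → f x ≡ 0 ⊎ (P x × f x ≤ k) ⊎ (Q x × f x ≤ l) → f x ≤ k * ind (P? x) + l * ind (Q? x)
  aux x (inj₁ e) rewrite e = z≤n
  aux x (inj₂ (inj₁ (p , q))) rewrite ind-yes (P? x) p = ≤-trans q (≤-trans (≤-reflexive (sym (*-identityʳ k))) (m≤m+n _ _))
  aux x (inj₂ (inj₂ (p , q))) rewrite ind-yes (Q? x) p = ≤-trans q (≤-trans (≤-reflexive (sym (*-identityʳ l))) (m≤n+m _ _))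

Σ-one-class : (P? : Decidable P) (f : A → ℕ) (k : ℕ) (xs : List A) →
  (∀ {x} → x ∈ₗ xs → f x ≡ 0 ⊎ (P x × f x ≤ k)) → Σ[ f ] xs ≤ k * # P? xs
Σ-one-class P? f k xs h = ≤-trans (Σ-two-classes P? P? f k 0 xs (λ m → aux (h m))) (≤-reflexive (+-identityʳ _))
  where
  aux : ∀ {x} → f x ≡ 0 ⊎ (_ × f x ≤ k) → f x ≡ 0 ⊎ (_ × f x ≤ k) ⊎ (_ × f x ≤ 0)
  aux (inj₁ e) = inj₁ e
  aux (inj₂ q) = inj₂ (inj₁ q)

Σ-# : (P? : Decidable P) (f : A → ℕ) (k : ℕ) (xs : List A) →
  (∀ {x} → x ∈ₗ xs → P x → f x ≡ k) → (∀ {x} → x ∈ₗ xs → ¬ P x → f x ≡ 0) → Σ[ f ] xs ≡ k * # P? xs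
Σ-# P? f k xs h g = trans (Σ-cong xs λ {x} m → aux x m)
  (trans (Σ-* k (ind ∘ P?) xs) (cong (k *_) (sym (#-ind P? xs))))
  where
  aux : ∀ x → x ∈ₗ xs → f x ≡ k * ind (P? x)
  aux x m with P? x
  ... | yes p = trans (h m p) (sym (*-identityʳ k))
  ... | no ¬p = trans (g m ¬p) (sym (*-zeroʳ k))

opaque
  unfolding #
  #-two : (P? : Decidable P) {xs : List A} → Unique xs → 2 ≤ # P? xs →
    ∃ λ x → ∃ λ y → x ≢ y × (x ∈ₗ xs × P x) × (y ∈ₗ xs × P y)
  #-two P? {x ∷ xs} (x∉ ∷ u) h with P? x
  ... | no _ with y , z , n , (m , p) , (m' , p') ← #-two P? u h = y , z , n , (there m , p) , (there m' , p')
  ... | yes p with y , m , q ← #-∃ P? xs (≤-pred h) = x , y , All.lookup x∉ m , (here refl , p) , (there m , q)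

opaque
  unfolding #
  #-four : (P? : Decidable P) {xs : List A} → Unique xs → 4 ≤ # P? xs →
    ∃ λ a → ∃ λ b → ∃ λ c → ∃ λ d → Unique (a ∷ b ∷ c ∷ d ∷ []) × All (λ x → x ∈ₗ xs × P x) (a ∷ b ∷ c ∷ d ∷ [])
  #-four {P = P} P? {xs} u h = go (filter P? xs) (Uniq.filter⁺ P? u) h (All.tabulate (∈-filter⁻ P?))
    where
    go : ∀ ys → Unique ys → 4 ≤ length ys → All (λ x → x ∈ₗ xs × P x) ys →
      ∃ λ a → ∃ λ b → ∃ λ c → ∃ λ d → Unique (a ∷ b ∷ c ∷ d ∷ []) × All (λ x → x ∈ₗ xs × P x) (a ∷ b ∷ c ∷ d ∷ [])
    go (a ∷ b ∷ c ∷ d ∷ _) ((ab ∷ ac ∷ ad ∷ _) ∷ (bc ∷ bd ∷ _) ∷ (cd ∷ _) ∷ _) _ (p ∷ q ∷ r ∷ s ∷ _) =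
      a , b , c , d , (ab ∷ ac ∷ ad ∷ []) ∷ (bc ∷ bd ∷ []) ∷ (cd ∷ []) ∷ [] ∷ [] , p ∷ q ∷ r ∷ s ∷ []
    go (_ ∷ _ ∷ _ ∷ []) _ (s≤s (s≤s (s≤s ()))) _
    go (_ ∷ _ ∷ []) _ (s≤s (s≤s ())) _
    go (_ ∷ []) _ (s≤s ()) _

opaque
  filtered : (P? : Decidable P) (xs : List A) → ∀ {x} → x ∈ₗ filter P? xs → x ∈ₗ xs × P x
  filtered P? xs m = ∈-filter⁻ P? m

Σ-#-any : ∀ {A B : Set} {P : A → B → Set} (P? : ∀ x y → Dec (P x y)) {xs : List A} → Unique xs → (ys : List B) →
  (∀ {x x' y} → x ∈ₗ xs → x' ∈ₗ xs → y ∈ₗ ys → P x y → P x' y → x ≡ x') →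
  Σ[ (λ x → # (P? x) ys) ] xs ≡ # (λ y → Any.any? (λ x → P? x y) xs) ys
Σ-#-any P? {xs} u ys h = trans (double-count P? xs ys)
  (trans (Σ-# (λ y → Any.any? (λ x → P? x y) xs) _ 1 ys
    (λ {y} m p → ≤-antisym (#-only (λ x → P? x y) u λ mx my → h mx my m)
      (let x , mx , px = find p in #-pos (λ x → P? x y) xs mx px))
    (λ {y} m ¬p → #-none _ xs λ mx px → ¬p (lose mx px)))
  (*-identityˡ _))

-- Four-element sets of vertices

module _ {n : ℕ} where

  V : List (Fin n)
  V = allFin n

  V-unique : Unique V
  V-unique = Uniq.allFin⁺ n

  v∈V : ∀ {v} → v ∈ₗ V
  v∈V = ∈-allFin _

opaque
  card : ∀ {n} (e : Subset n) → ∣ e ∣ ≡ # (_∈? e) V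
  card {zero} [] = sym (#-[] _)
  card {suc n} (s ∷ e) = trans (head s) (cong (λ zs → # (_∈? (s ∷ e)) (zero ∷ zs)) (map-tabulate (λ i → i) suc))
    where
    shift : ∀ s' xs → # (_∈? (s' ∷ e)) (map suc xs) ≡ # (_∈? e) xs
    shift s' [] = trans (#-[] _) (sym (#-[] _))
    shift s' (x ∷ xs) = trans (#-∷ _ (suc x) (map suc xs)) (trans (cong₂ _+_ (eq (x ∈? e)) (shift s' xs)) (sym (#-∷ _ x xs)))
      where
      eq : (d : Dec (x ∈ e)) → ind (suc x ∈? (s' ∷ e)) ≡ ind d
      eq (yes p) = ind-yes (suc x ∈? (s' ∷ e)) (there p)
      eq (no ¬p) = ind-no (suc x ∈? (s' ∷ e)) λ { (there p) → ¬p p }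
    head : ∀ s' → ∣ s' ∷ e ∣ ≡ # (_∈? (s' ∷ e)) (zero ∷ map suc V)
    head inside = trans (cong suc (trans (card e) (sym (shift inside V)))) (sym (#-∷ (_∈? (inside ∷ e)) zero (map suc V)))
    head outside = trans (trans (card e) (sym (shift outside V))) (sym (#-∷ (_∈? (outside ∷ e)) zero (map suc V)))

module _ {n : ℕ} where

  record Quad (e : Subset n) (a b x y : Fin n) : Set where
    constructor quad
    field
      a∈ : a ∈ e
      b∈ : b ∈ e
      x∈ : x ∈ e
      y∈ : y ∈ e
      a≢b : a ≢ b
      a≢x : a ≢ x
      a≢y : a ≢ y
      b≢x : b ≢ x
      b≢y : b ≢ y
      x≢y : x ≢ y
      only : ∀ {v} → v ∈ e → v ≡ a ⊎ v ≡ b ⊎ v ≡ x ⊎ v ≡ y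
  open Quad public

  4-set : Subset n → Set
  4-set e = # (_∈? e) V ≡ 4

  module _ {e : Subset n} (c : 4-set e) where

    private
      rem : {P : Fin n → Set} (P? : Decidable P) → ∀ {k a} → # P? V ≡ suc k → P a →
            # (λ x → P? x ×-dec ¬? (x ≟F a)) V ≡ k
      rem P? eq p = suc-injective (trans (sym (#-remove _≟F_ P? V-unique v∈V p)) eq)

      ext : {P : Fin n → Set} (P? : Decidable P) → ∀ {k} → # P? V ≡ suc k → ∃ P
      ext P? eq with v , _ , p ← #-∃ P? V (subst (1 ≤_) (sym eq) (s≤s z≤n)) = v , p

    opaque
      quad₃ : ∀ {a b x} → a ∈ e → b ∈ e → x ∈ e → a ≢ b → a ≢ x → b ≢ x → ∃ λ y → Quad e a b x y
      quad₃ {a} {b} {x} ae be xe ab ax bx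
        with y , ((ye , y≢a) , y≢b) , y≢x ← ext _ (rem _ (rem _ (rem _ c ae) (be , ab ∘ sym)) ((xe , ax ∘ sym) , bx ∘ sym))
        = y , quad ae be xe ye ab ax (y≢a ∘ sym) bx (y≢b ∘ sym) (y≢x ∘ sym) λ {v} ve → exh v ve
        where
        r4 : # (λ v → ((((v ∈? e) ×-dec ¬? (v ≟F a)) ×-dec ¬? (v ≟F b)) ×-dec ¬? (v ≟F x)) ×-dec ¬? (v ≟F y)) V ≡ 0
        r4 = rem _ (rem _ (rem _ (rem _ c ae) (be , ab ∘ sym)) ((xe , ax ∘ sym) , bx ∘ sym)) (((ye , y≢a) , y≢b) , y≢x)
        exh : ∀ v → v ∈ e → v ≡ a ⊎ v ≡ b ⊎ v ≡ x ⊎ v ≡ y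
        exh v ve with v ≟F a | v ≟F b | v ≟F x | v ≟F y
        ... | yes p | _ | _ | _ = inj₁ p
        ... | no _ | yes p | _ | _ = inj₂ (inj₁ p)
        ... | no _ | no _ | yes p | _ = inj₂ (inj₂ (inj₁ p))
        ... | no _ | no _ | no _ | yes p = inj₂ (inj₂ (inj₂ p))
        ... | no p | no q | no r | no s = ⊥-elim (#-∄ _ V r4 v∈V ((((ve , p) , q) , r) , s))

    opaque
      quad₂ : ∀ {a b} → a ∈ e → b ∈ e → a ≢ b → ∃ λ x → ∃ λ y → Quad e a b x y
      quad₂ ae be ab with x , (xe , x≢a) , x≢b ← ext _ (rem _ (rem _ c ae) (be , ab ∘ sym))
        = x , quad₃ ae be xe ab (x≢a ∘ sym) (x≢b ∘ sym)

    opaque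
      quad₁ : ∀ {a} → a ∈ e → ∃ λ b → ∃ λ x → ∃ λ y → Quad e a b x y
      quad₁ ae with b , be , b≢a ← ext _ (rem _ c ae) = b , quad₂ ae be (b≢a ∘ sym)

    opaque
      two-others : ∀ {a b} → a ∈ e → b ∈ e → a ≢ b → {P : Fin n → Set} (P? : Decidable P) →
        (∀ {v} → P v → (v ∈ e × v ≢ a) × v ≢ b) → (∀ {v} → (v ∈ e × v ≢ a) × v ≢ b → P v) → # P? V ≡ 2
      two-others ae be ab P? h g = trans (#-≐ P? _ V (λ _ → h) (λ _ → g)) (rem _ (rem _ c ae) (be , ab ∘ sym))

    no-fifth : ∀ {a b x y v} → a ∈ e → b ∈ e → x ∈ e → y ∈ e → v ∈ e →
      a ≢ b → a ≢ x → a ≢ y → a ≢ v → b ≢ x → b ≢ y → b ≢ v → x ≢ y → x ≢ v → y ≢ v → ⊥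
    no-fifth ae be xe ye ve ab ax ay av bx by bv xy xv yv with z , q ← quad₃ ae be xe ab ax bx
      with only q ye | only q ve
    ... | inj₁ p | _ = ay (sym p)
    ... | inj₂ (inj₁ p) | _ = by (sym p)
    ... | inj₂ (inj₂ (inj₁ p)) | _ = xy (sym p)
    ... | inj₂ (inj₂ (inj₂ p)) | inj₁ r = av (sym r)
    ... | inj₂ (inj₂ (inj₂ p)) | inj₂ (inj₁ r) = bv (sym r)
    ... | inj₂ (inj₂ (inj₂ p)) | inj₂ (inj₂ (inj₁ r)) = xv (sym r)
    ... | inj₂ (inj₂ (inj₂ p)) | inj₂ (inj₂ (inj₂ r)) = yv (trans p (sym r))

  quad-determines : ∀ {e f a b x y} → 4-set f → Quad e a b x y → a ∈ f → b ∈ f → x ∈ f → y ∈ f → e ≡ f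
  quad-determines {e} {f} cf q af bf xf yf with z , q' ← quad₃ cf af bf xf (a≢b q) (a≢x q) (b≢x q)
    = ⊆-antisym (λ {v} ve → to (only q ve)) (λ {v} vf → from (only q' vf))
    where
    to : ∀ {v} → v ≡ _ ⊎ v ≡ _ ⊎ v ≡ _ ⊎ v ≡ _ → v ∈ f
    to (inj₁ refl) = af
    to (inj₂ (inj₁ refl)) = bf
    to (inj₂ (inj₂ (inj₁ refl))) = xf
    to (inj₂ (inj₂ (inj₂ refl))) = yf
    yz : _ ≡ z
    yz with only q' yf
    ... | inj₁ p = contradiction (sym p) (a≢y q)
    ... | inj₂ (inj₁ p) = contradiction (sym p) (b≢y q)
    ... | inj₂ (inj₂ (inj₁ p)) = contradiction (sym p) (x≢y q)
    ... | inj₂ (inj₂ (inj₂ p)) = p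
    from : ∀ {v} → v ≡ _ ⊎ v ≡ _ ⊎ v ≡ _ ⊎ v ≡ z → v ∈ e
    from (inj₁ refl) = a∈ q
    from (inj₂ (inj₁ refl)) = b∈ q
    from (inj₂ (inj₂ (inj₁ refl))) = x∈ q
    from (inj₂ (inj₂ (inj₂ refl))) = subst (_∈ e) yz (y∈ q)

  -- Families of edges, sunflowers and twins

  record Family (E : List (Subset n)) : Set where
    field
      four : ∀ {e} → e ∈ₗ E → 4-set e
      uniq : Unique E
      -- This is freeness from `P42` in positive form: an intersection of size exactly one is
      -- excluded.
      meet : ∀ {e f v} → e ∈ₗ E → f ∈ₗ E → v ∈ e → v ∈ f → ∃ λ u → u ≢ v × u ∈ e × u ∈ f
  open Family public

  subfamily : ∀ {E} {P : Subset n → Set} (P? : Decidable P) → Family E → Family (filter P? E)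
  subfamily P? F = record
    { four = λ m → four F (proj₁ (∈-filter⁻ P? m))
    ; uniq = Uniq.filter⁺ P? (uniq F)
    ; meet = λ m m' → meet F (proj₁ (∈-filter⁻ P? m)) (proj₁ (∈-filter⁻ P? m')) }

  deg₁ : Fin n → List (Subset n) → ℕ
  deg₁ a = # (a ∈?_)

  has₂? : ∀ (a b : Fin n) e → Dec (a ∈ e × b ∈ e)
  has₂? a b e = (a ∈? e) ×-dec (b ∈? e)

  has₃? : ∀ (a b c : Fin n) e → Dec (a ∈ e × b ∈ e × c ∈ e)
  has₃? a b c e = (a ∈? e) ×-dec ((b ∈? e) ×-dec (c ∈? e))

  deg₂ : Fin n → Fin n → List (Subset n) → ℕ
  deg₂ a b = # (has₂? a b)

  deg₃ : Fin n → Fin n → Fin n → List (Subset n) → ℕ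
  deg₃ a b c = # (has₃? a b c)

  opaque
    deg-sum : ∀ {E} → Family E → Σ[ (λ v → deg₁ v E) ] V ≡ 4 * length E
    deg-sum {E} F = trans (double-count (λ v e → v ∈? e) V E) (go E (four F))
      where
      go : ∀ E' → (∀ {e} → e ∈ₗ E' → 4-set e) → Σ[ (λ e → # (_∈? e) V) ] E' ≡ 4 * length E'
      go [] h = refl
      go (e ∷ E') h = trans (cong₂ _+_ (h (here refl)) (go E' (h ∘ there))) (sym (*-suc 4 (length E')))

  -- The core is a predicate, so that pairs and triples share one lemma. Distinctness of the edges
  -- follows when the core is smaller than an edge, since equal edges would lie inside it.
  record Sunflower (E : List (Subset n)) (C : Fin n → Set) : Set where
    field
      e₁ e₂ e₃ e₄ : Subset n
      m₁ : e₁ ∈ₗ E × (∀ {u} → C u → u ∈ e₁)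
      m₂ : e₂ ∈ₗ E × (∀ {u} → C u → u ∈ e₂)
      m₃ : e₃ ∈ₗ E × (∀ {u} → C u → u ∈ e₃)
      m₄ : e₄ ∈ₗ E × (∀ {u} → C u → u ∈ e₄)
      c₁₂ : ∀ {u} → u ∈ e₁ → u ∈ e₂ → C u
      c₁₃ : ∀ {u} → u ∈ e₁ → u ∈ e₃ → C u
      c₁₄ : ∀ {u} → u ∈ e₁ → u ∈ e₄ → C u
      c₂₃ : ∀ {u} → u ∈ e₂ → u ∈ e₃ → C u
      c₂₄ : ∀ {u} → u ∈ e₂ → u ∈ e₄ → C u
      c₃₄ : ∀ {u} → u ∈ e₃ → u ∈ e₄ → C u

  opaque
    -- A set meeting the core in one point only would contain that point and a point of each petal.
    core-meets : ∀ {E C} → Family E → Decidable C → Sunflower E C → ∀ {f v} → f ∈ₗ E → v ∈ f → C v →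
      ∃ λ u → u ≢ v × u ∈ f × C u
    core-meets F C? S mf vf cv
      with p₁ , n₁ , q₁ , f₁ ← meet F (proj₁ (Sunflower.m₁ S)) mf (proj₂ (Sunflower.m₁ S) cv) vf
      with p₂ , n₂ , q₂ , f₂ ← meet F (proj₁ (Sunflower.m₂ S)) mf (proj₂ (Sunflower.m₂ S) cv) vf
      with p₃ , n₃ , q₃ , f₃ ← meet F (proj₁ (Sunflower.m₃ S)) mf (proj₂ (Sunflower.m₃ S) cv) vf
      with p₄ , n₄ , q₄ , f₄ ← meet F (proj₁ (Sunflower.m₄ S)) mf (proj₂ (Sunflower.m₄ S) cv) vf
      with C? p₁ | C? p₂ | C? p₃ | C? p₄
    ... | yes c | _ | _ | _ = p₁ , n₁ , f₁ , c
    ... | no _ | yes c | _ | _ = p₂ , n₂ , f₂ , c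
    ... | no _ | no _ | yes c | _ = p₃ , n₃ , f₃ , c
    ... | no _ | no _ | no _ | yes c = p₄ , n₄ , f₄ , c
    ... | no ¬1 | no ¬2 | no ¬3 | no ¬4 = ⊥-elim (no-fifth (four F mf) f₁ f₂ f₃ f₄ vf
      (λ { refl → ¬1 (c₁₂ q₁ q₂) }) (λ { refl → ¬1 (c₁₃ q₁ q₃) }) (λ { refl → ¬1 (c₁₄ q₁ q₄) }) n₁
      (λ { refl → ¬2 (c₂₃ q₂ q₃) }) (λ { refl → ¬2 (c₂₄ q₂ q₄) }) n₂
      (λ { refl → ¬3 (c₃₄ q₃ q₄) }) n₃ n₄)
      where open Sunflower S

  Sun : List (Subset n) → Fin n → Fin n → Set
  Sun E a b = Sunflower E (λ v → v ≡ a ⊎ v ≡ b)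

  Twins : List (Subset n) → Fin n → Fin n → Set
  Twins E a b = All (λ e → (a ∈ e → b ∈ e) × (b ∈ e → a ∈ e)) E

  opaque
    sun⇒twins : ∀ {E a b} → Family E → a ≢ b → Sun E a b → Twins E a b
    sun⇒twins {E} {a} {b} F ab S = All.tabulate λ m → (λ ae → fwd (core m ae (inj₁ refl))) , (λ be → bwd (core m be (inj₂ refl)))
      where
      core : ∀ {f v} → f ∈ₗ E → v ∈ f → v ≡ a ⊎ v ≡ b → ∃ λ u → u ≢ v × u ∈ f × (u ≡ a ⊎ u ≡ b)
      core = core-meets F (λ v → (v ≟F a) ⊎-dec (v ≟F b)) S
      fwd : ∀ {e} → (∃ λ u → u ≢ a × u ∈ e × (u ≡ a ⊎ u ≡ b)) → b ∈ e
      fwd (u , n , ue , inj₁ p) = contradiction p n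
      fwd (u , n , ue , inj₂ refl) = ue
      bwd : ∀ {e} → (∃ λ u → u ≢ b × u ∈ e × (u ≡ a ⊎ u ≡ b)) → a ∈ e
      bwd (u , n , ue , inj₂ p) = contradiction p n
      bwd (u , n , ue , inj₁ refl) = ue

  Conflict : Fin n → Fin n → Subset n → Subset n → Set
  Conflict a b e f = ∃ λ v → (v ∈ e × v ∈ f) × (v ≢ a × v ≢ b)

  conflict? : ∀ a b e f → Dec (Conflict a b e f)
  conflict? a b e f = any? λ v → ((v ∈? e) ×-dec (v ∈? f)) ×-dec (¬? (v ≟F a) ×-dec ¬? (v ≟F b))

  opaque
    -- Greedy choice of edges through a and b, each without conflict with the earlier ones. If it
    -- stops after at most three picks, every edge through a and b conflicts with a picked one (a
    -- picked edge with itself), and each pick accounts for at most B edges.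
    sun-or-few : ∀ {E} → Family E → ∀ a b B →
      (∀ {e} → e ∈ₗ E → a ∈ e → b ∈ e → # (λ f → has₂? a b f ×-dec conflict? a b e f) E ≤ B) →
      Sun E a b ⊎ deg₂ a b E ≤ B + (B + B)
    sun-or-few {E} F a b B h = go₁
      where
      ¬conflict : ∀ {e f} → ¬ Conflict a b e f → ∀ {u} → u ∈ e → u ∈ f → u ≡ a ⊎ u ≡ b
      ¬conflict {e} {f} ¬c {u} ue uf with u ≟F a | u ≟F b
      ... | yes p | _ = inj₁ p
      ... | no _ | yes p = inj₂ p
      ... | no p | no q = contradiction (u , (ue , uf) , (p , q)) ¬c
      step : ∀ {P : Subset n → Set} (P? : Decidable P) → (∀ {f} → P f → a ∈ f × b ∈ f) →
        ∀ {e k} → e ∈ₗ E → a ∈ e → b ∈ e → # (λ f → P? f ×-dec ¬? (conflict? a b e f)) E ≤ k → # P? E ≤ B + k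
      step P? imp {e} m ae be le = ≤-trans (≤-reflexive (#-split P? (conflict? a b e) E))
        (+-mono-≤ (≤-trans (#-mono _ _ E λ _ q → imp (proj₁ q) , proj₂ q) (h m ae be)) le)
      choose : ∀ {P : Subset n → Set} (P? : Decidable P) → # P? E ≤ 0 ⊎ ∃ λ f → f ∈ₗ E × P f
      choose P? with # P? E in eq
      ... | zero = inj₁ z≤n
      ... | suc k = inj₂ (#-∃ P? E (subst (1 ≤_) (sym eq) (s≤s z≤n)))
      at : ∀ {e v} → a ∈ e → b ∈ e → v ≡ a ⊎ v ≡ b → v ∈ e
      at ae be (inj₁ refl) = ae
      at ae be (inj₂ refl) = be
      go₁ : Sun E a b ⊎ deg₂ a b E ≤ B + (B + B)
      go₁ with choose (has₂? a b)
      ... | inj₁ le = inj₂ (≤-trans le z≤n)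
      ... | inj₂ (e₁ , m₁ , a₁ , b₁)
        with choose (λ f → has₂? a b f ×-dec ¬? (conflict? a b e₁ f))
      ... | inj₁ le = inj₂ (step (has₂? a b) (λ p → p) m₁ a₁ b₁ (≤-trans le z≤n))
      ... | inj₂ (e₂ , m₂ , (a₂ , b₂) , n₁₂)
        with choose (λ f → (has₂? a b f ×-dec ¬? (conflict? a b e₁ f)) ×-dec ¬? (conflict? a b e₂ f))
      ... | inj₁ le = inj₂ (step (has₂? a b) (λ p → p) m₁ a₁ b₁ (≤-trans (step _ proj₁ m₂ a₂ b₂ le) (+-monoʳ-≤ B z≤n)))
      ... | inj₂ (e₃ , m₃ , ((a₃ , b₃) , n₁₃) , n₂₃)
        with choose (λ f → ((has₂? a b f ×-dec ¬? (conflict? a b e₁ f)) ×-dec ¬? (conflict? a b e₂ f)) ×-dec ¬? (conflict? a b e₃ f))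
      ... | inj₁ le = inj₂ (step (has₂? a b) (λ p → p) m₁ a₁ b₁ (step _ proj₁ m₂ a₂ b₂
                        (≤-trans (step _ (proj₁ ∘ proj₁) m₃ a₃ b₃ le) (≤-reflexive (+-identityʳ B)))))
      ... | inj₂ (e₄ , m₄ , (((a₄ , b₄) , n₁₄) , n₂₄) , n₃₄) = inj₁ record
        { e₁ = e₁ ; e₂ = e₂ ; e₃ = e₃ ; e₄ = e₄
        ; m₁ = m₁ , at a₁ b₁ ; m₂ = m₂ , at a₂ b₂ ; m₃ = m₃ , at a₃ b₃ ; m₄ = m₄ , at a₄ b₄
        ; c₁₂ = ¬conflict n₁₂ ; c₁₃ = ¬conflict n₁₃ ; c₁₄ = ¬conflict n₁₄
        ; c₂₃ = ¬conflict n₂₃ ; c₂₄ = ¬conflict n₂₄ ; c₃₄ = ¬conflict n₃₄ }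

  -- conflicts with e = {a, b, p, q} happen at p or at q
  conflicts-≤ : ∀ {E e a b p q} → Quad e a b p q → 
    # (λ f → has₂? a b f ×-dec conflict? a b e f) E + # (λ f → has₃? a b p f ×-dec has₃? a b q f) E ≤ deg₃ a b p E + deg₃ a b q E
  conflicts-≤ {E} {e} {a} {b} {p} {q} Q = ≤-trans (+-monoˡ-≤ _ (#-mono _ (λ f → has₃? a b p f ⊎-dec has₃? a b q f) E λ {f} _ → hit))
    (≤-reflexive (#-∪∩ (has₃? a b p) (has₃? a b q) E))
    where
    hit : ∀ {f} → (a ∈ f × b ∈ f) × Conflict a b e f → (a ∈ f × b ∈ f × p ∈ f) ⊎ (a ∈ f × b ∈ f × q ∈ f)
    hit ((af , bf) , v , (ve , vf) , v≢a , v≢b) with only Q ve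
    ... | inj₁ r = contradiction r v≢a
    ... | inj₂ (inj₁ r) = contradiction r v≢b
    ... | inj₂ (inj₂ (inj₁ refl)) = inj₁ (af , bf , vf)
    ... | inj₂ (inj₂ (inj₂ refl)) = inj₂ (af , bf , vf)

  -- four edges through {a, b, c} form a sunflower with core {a, b, c}
  module _ {E} (F : Family E) {a b c : Fin n} (ab : a ≢ b) (ac : a ≢ c) (bc : b ≢ c) (le : 4 ≤ deg₃ a b c E) where

    opaque
      triple-core : ∀ {f v} → f ∈ₗ E → v ∈ f → v ≡ a ⊎ v ≡ b ⊎ v ≡ c →
        ∃ λ u → u ≢ v × u ∈ f × (u ≡ a ⊎ u ≡ b ⊎ u ≡ c)
      triple-core with _ , _ , _ , _ , (d₁₂ ∷ d₁₃ ∷ d₁₄ ∷ []) ∷ (d₂₃ ∷ d₂₄ ∷ []) ∷ (d₃₄ ∷ []) ∷ [] ∷ [] , m₁ ∷ m₂ ∷ m₃ ∷ m₄ ∷ [] ← #-four (has₃? a b c) (uniq F) le =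
        core-meets F (λ v → (v ≟F a) ⊎-dec ((v ≟F b) ⊎-dec (v ≟F c))) record
        { m₁ = proj₁ m₁ , at m₁ ; m₂ = proj₁ m₂ , at m₂ ; m₃ = proj₁ m₃ , at m₃ ; m₄ = proj₁ m₄ , at m₄
        ; c₁₂ = cross m₁ m₂ d₁₂ ; c₁₃ = cross m₁ m₃ d₁₃ ; c₁₄ = cross m₁ m₄ d₁₄
        ; c₂₃ = cross m₂ m₃ d₂₃ ; c₂₄ = cross m₂ m₄ d₂₄ ; c₃₄ = cross m₃ m₄ d₃₄ }
        where
        In : Subset n → Set
        In e = e ∈ₗ E × a ∈ e × b ∈ e × c ∈ e
        at : ∀ {e v} → In e → v ≡ a ⊎ v ≡ b ⊎ v ≡ c → v ∈ e
        at (_ , ae , be , ce) (inj₁ refl) = ae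
        at (_ , ae , be , ce) (inj₂ (inj₁ refl)) = be
        at (_ , ae , be , ce) (inj₂ (inj₂ refl)) = ce
        cross : ∀ {e e'} → In e → In e' → e ≢ e' → ∀ {u} → u ∈ e → u ∈ e' → u ≡ a ⊎ u ≡ b ⊎ u ≡ c
        cross {e} {e'} (m , ae , be , ce) (m' , ae' , be' , ce') ne {u} ue ue'
          with y , Q ← quad₃ (four F m) ae be ce ab ac bc with only Q ue
        ... | inj₁ p = inj₁ p
        ... | inj₂ (inj₁ p) = inj₂ (inj₁ p)
        ... | inj₂ (inj₂ (inj₁ p)) = inj₂ (inj₂ p)
        ... | inj₂ (inj₂ (inj₂ refl)) = contradiction (quad-determines (four F m') Q ae' be' ce' ue') ne

  -- each edge through a, b, c is determined by its fourth vertex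
  opaque
    deg₃-≤ : ∀ {E a b c} → Family E → a ≢ b → a ≢ c → b ≢ c → {P : Fin n → Set} (P? : Decidable P) →
      (∀ {e y} → e ∈ₗ E → Quad e a b c y → P y) → deg₃ a b c E ≤ # P? V
    deg₃-≤ {E} {a} {b} {c} F ab ac bc {P} P? h = begin
      deg₃ a b c E                              ≡⟨ #-length (has₃? a b c) E ⟩
      length G                                   ≡⟨ len G (λ {e} m → one (G∈ m)) ⟨
      Σ[ (λ e → # (λ y → R? y e) V) ] G           ≡⟨ double-count (λ e y → R? y e) G V ⟩
      Σ[ (λ y → # (λ e → R? y e) G) ] V           ≤⟨ Σ-one-class P? _ 1 V (λ {y} _ → col y) ⟩
      1 * # P? V                                ≡⟨ *-identityˡ _ ⟩
      # P? V                                    ∎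
      where
      open ≤-Reasoning
      G : List (Subset n)
      G = filter (has₃? a b c) E
      G∈ : ∀ {e} → e ∈ₗ G → e ∈ₗ E × (a ∈ e × b ∈ e × c ∈ e)
      G∈ = ∈-filter⁻ (has₃? a b c)
      R? : ∀ y e → Dec ((y ∈ e × y ≢ a) × (y ≢ b × y ≢ c))
      R? y e = ((y ∈? e) ×-dec ¬? (y ≟F a)) ×-dec (¬? (y ≟F b) ×-dec ¬? (y ≟F c))
      toQuad : ∀ {e y} → e ∈ₗ E × (a ∈ e × b ∈ e × c ∈ e) → (y ∈ e × y ≢ a) × (y ≢ b × y ≢ c) → Quad e a b c y
      toQuad (m , ae , be , ce) ((ye , ya) , (yb , yc)) with z , Q ← quad₃ (four F m) ae be ce ab ac bc with only Q ye
      ... | inj₁ p = contradiction p ya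
      ... | inj₂ (inj₁ p) = contradiction p yb
      ... | inj₂ (inj₂ (inj₁ p)) = contradiction p yc
      ... | inj₂ (inj₂ (inj₂ refl)) = Q
      one : ∀ {e} → e ∈ₗ E × (a ∈ e × b ∈ e × c ∈ e) → # (λ y → R? y e) V ≡ 1
      one {e} i@(m , ae , be , ce) with z , Q ← quad₃ (four F m) ae be ce ab ac bc = ≤-antisym
        (#-only (λ y → R? y e) V-unique λ {x} {y} _ _ p q → same (toQuad i p) (toQuad i q))
        (#-pos (λ y → R? y e) V v∈V ((y∈ Q , a≢y Q ∘ sym) , (b≢y Q ∘ sym , x≢y Q ∘ sym)))
        where
        same : ∀ {x y} → Quad e a b c x → Quad e a b c y → x ≡ y
        same Q₁ Q₂ with only Q₂ (y∈ Q₁)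
        ... | inj₁ p = contradiction (sym p) (a≢y Q₁)
        ... | inj₂ (inj₁ p) = contradiction (sym p) (b≢y Q₁)
        ... | inj₂ (inj₂ (inj₁ p)) = contradiction (sym p) (x≢y Q₁)
        ... | inj₂ (inj₂ (inj₂ p)) = p
      len : ∀ G' → (∀ {e} → e ∈ₗ G' → # (λ y → R? y e) V ≡ 1) → Σ[ (λ e → # (λ y → R? y e) V) ] G' ≡ length G'
      len [] h = refl
      len (e ∷ G') h = cong₂ _+_ (h (here refl)) (len G' (h ∘ there))
      col : ∀ y → # (λ e → R? y e) G ≡ 0 ⊎ (P y × # (λ e → R? y e) G ≤ 1)
      col y with # (λ e → R? y e) G in eq
      ... | zero = inj₁ refl
      ... | suc k with e , m , r ← #-∃ (R? y) G (subst (1 ≤_) (sym eq) (s≤s z≤n)) =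
        inj₂ (h (proj₁ (G∈ m)) (toQuad (G∈ m) r) , subst (_≤ 1) eq
          (#-only (R? y) (Uniq.filter⁺ (has₃? a b c) (uniq F)) λ {e} {f} m m' p q →
            quad-determines (four F (proj₁ (G∈ m'))) (toQuad (G∈ m) p)
              (proj₁ (proj₂ (G∈ m'))) (proj₁ (proj₂ (proj₂ (G∈ m')))) (proj₂ (proj₂ (proj₂ (G∈ m')))) (proj₁ (proj₁ q))))

opaque
  -- The threshold decides whether stripping goes on; maximality then bounds the degrees of all
  -- other triples by that of the chosen one.
  argmax : ∀ {A : Set} (f : A → ℕ) (xs : List A) k →
    (∀ {x} → x ∈ₗ xs → f x ≤ k) ⊎ ∃ λ x → x ∈ₗ xs × suc k ≤ f x × (∀ {y} → y ∈ₗ xs → f y ≤ f x)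
  argmax f [] k = inj₁ λ ()
  argmax f (x ∷ xs) k with f x ≤? k
  ... | yes p with argmax f xs k
  ...   | inj₁ h = inj₁ λ { (here refl) → p ; (there m) → h m }
  ...   | inj₂ (y , m , le , h) = inj₂ (y , there m , le , λ { (here refl) → ≤-trans p (≤-trans (n≤1+n _) le) ; (there m) → h m })
  argmax f (x ∷ xs) k | no ¬p with argmax f xs (f x)
  ...   | inj₁ h = inj₂ (x , here refl , ≰⇒> ¬p , λ { (here refl) → ≤-refl ; (there m) → h m })
  ...   | inj₂ (y , m , le , h) = inj₂ (y , there m , ≤-trans (≰⇒> ¬p) (<⇒≤ le) , λ { (here refl) → <⇒≤ le ; (there m) → h m })

-- Stripping triples of large degree

module _ {n : ℕ} where

  Distinct₃ : Fin n → Fin n → Fin n → Set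
  Distinct₃ a b c = a ≢ b × a ≢ c × b ≢ c

  -- By sun⇒center below, this excludes the centres of 2-stars.
  Light : List (Subset n) → Set
  Light E = ∀ {a b c} → Distinct₃ a b c → 4 ≤ deg₃ a b c E → ¬ Sun E a b

  Deg₃≤ : ℕ → List (Subset n) → Set
  Deg₃≤ k E = ∀ {a b c} → Distinct₃ a b c → deg₃ a b c E ≤ k

  sub-mono : ∀ {P Q : Subset n → Set} (P? : Decidable P) (Q? : Decidable Q) E →
    # Q? (filter P? E) ≤ # Q? E
  sub-mono P? Q? E = ≤-trans (≤-reflexive (#-filter P? Q? E)) (#-mono _ _ E λ _ → proj₂)

  sub-sun : ∀ {E E' : List (Subset n)} {a b} → (∀ {e} → e ∈ₗ E' → e ∈ₗ E) → Sun E' a b → Sun E a b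
  sub-sun h S = record { m₁ = up m₁ ; m₂ = up m₂ ; m₃ = up m₃ ; m₄ = up m₄
    ; c₁₂ = c₁₂ ; c₁₃ = c₁₃ ; c₁₄ = c₁₄ ; c₂₃ = c₂₃ ; c₂₄ = c₂₄ ; c₃₄ = c₃₄ }
    where
    open Sunflower S
    up : ∀ {e} {P : Set} → e ∈ₗ _ × P → e ∈ₗ _ × P
    up (m , p) = h m , p

  sub-light : ∀ {E} {P : Subset n → Set} (P? : Decidable P) → Light E → Light (filter P? E)
  sub-light {E} P? L d le S = L d (≤-trans le (sub-mono P? _ E)) (sub-sun (proj₁ ∘ ∈-filter⁻ P?) S)

  Meets : (Fin n → Set) → Subset n → Set
  Meets S e = ∃ λ v → v ∈ e × S v

  meets? : {S : Fin n → Set} → Decidable S → ∀ e → Dec (Meets S e)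
  meets? S? e = any? λ v → (v ∈? e) ×-dec S? v

  -- Deleting the vertices in S costs at most 7 edges each: see touching≤ and deg₃≤#S.
  module MaxTriple {E : List (Subset n)} (F : Family E) (L : Light E) (a b c : Fin n) (D : Distinct₃ a b c)
                   (y≥4 : 4 ≤ deg₃ a b c E) (max : Deg₃≤ (deg₃ a b c E) E) where

    private
      y = deg₃ a b c E
      ab = proj₁ D
      ac = proj₁ (proj₂ D)
      bc = proj₂ (proj₂ D)

    S : Fin n → Set
    S v = Any (λ e → (a ∈ e × b ∈ e × c ∈ e) × v ∈ e) E

    S? : Decidable S
    S? v = Any.any? (λ e → has₃? a b c e ×-dec (v ∈? e)) E

    deg₃≤#S : y ≤ # S? V
    deg₃≤#S = deg₃-≤ F ab ac bc S? λ m Q → lose m ((a∈ Q , b∈ Q , x∈ Q) , y∈ Q)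

    Two : Subset n → Set
    Two e = (a ∈ e × b ∈ e) ⊎ (a ∈ e × c ∈ e) ⊎ (b ∈ e × c ∈ e)

    core-two : ∀ {e u} → e ∈ₗ E → u ∈ e → u ≡ a ⊎ u ≡ b ⊎ u ≡ c → Two e
    core-two m ue h with triple-core F ab ac bc y≥4 m ue h
    core-two m ue (inj₁ refl) | w , ne , we , inj₁ p = contradiction p ne
    core-two m ue (inj₁ refl) | w , ne , we , inj₂ (inj₁ refl) = inj₁ (ue , we)
    core-two m ue (inj₁ refl) | w , ne , we , inj₂ (inj₂ refl) = inj₂ (inj₁ (ue , we))
    core-two m ue (inj₂ (inj₁ refl)) | w , ne , we , inj₁ refl = inj₁ (we , ue)
    core-two m ue (inj₂ (inj₁ refl)) | w , ne , we , inj₂ (inj₁ p) = contradiction p ne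
    core-two m ue (inj₂ (inj₁ refl)) | w , ne , we , inj₂ (inj₂ refl) = inj₂ (inj₂ (ue , we))
    core-two m ue (inj₂ (inj₂ refl)) | w , ne , we , inj₁ refl = inj₂ (inj₁ (we , ue))
    core-two m ue (inj₂ (inj₂ refl)) | w , ne , we , inj₂ (inj₁ refl) = inj₂ (inj₂ (we , ue))
    core-two m ue (inj₂ (inj₂ refl)) | w , ne , we , inj₂ (inj₂ p) = contradiction p ne

    -- An edge that meets S only in the fourth vertex of some edge g through a, b, c shares a second
    -- vertex with g, and this one lies in the core; the sunflower around the triple then yields a
    -- second core vertex.
    meets⇒two : ∀ {e} → e ∈ₗ E → Meets S e → Two e
    meets⇒two {e} m (v , ve , s) with find s
    ... | g , mg , (ag , bg , cg) , vg with quad₃ (four F mg) ag bg cg ab ac bc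
    ...   | z , Q with only Q vg
    ...     | inj₁ p = core-two m ve (inj₁ p)
    ...     | inj₂ (inj₁ p) = core-two m ve (inj₂ (inj₁ p))
    ...     | inj₂ (inj₂ (inj₁ p)) = core-two m ve (inj₂ (inj₂ p))
    ...     | inj₂ (inj₂ (inj₂ refl)) with meet F m mg ve vg
    ...       | u , u≢v , ue , ug with only Q ug
    ...         | inj₁ p = core-two m ue (inj₁ p)
    ...         | inj₂ (inj₁ p) = core-two m ue (inj₂ (inj₁ p))
    ...         | inj₂ (inj₂ (inj₁ p)) = core-two m ue (inj₂ (inj₂ p))
    ...         | inj₂ (inj₂ (inj₂ p)) = contradiction p u≢v

    N? : ∀ (a b c : Fin n) e → Dec ((a ∈ e × b ∈ e) × c ∉ e)
    N? a b c e = has₂? a b e ×-dec ¬? (c ∈? e)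

    N : Fin n → Fin n → Fin n → ℕ
    N a b c = # (N? a b c) E

    -- With g = {a, c, p, q}, an edge through a and b that misses c has to meet g again, at p or at
    -- q. The triples abp and abq have degree at most y.
    N-side : ∀ {a b c g} → a ≢ b → a ≢ c → g ∈ₗ E → (a ∈ g × c ∈ g) × b ∉ g → N a b c ≤ y + y
    N-side {a} {b} {c} {g} ab ac mg ((ag , cg) , b∉g) with p , q , Q ← quad₂ (four F mg) ag cg ac =
      ≤-trans (#-mono (N? a b c) (λ f → has₃? a b p f ⊎-dec has₃? a b q f) E hit)
        (≤-trans (#-∪ (has₃? a b p) (has₃? a b q) E) (+-mono-≤ (max {a} {b} {p} (ab , a≢x Q , λ { refl → b∉g (x∈ Q) })) (max {a} {b} {q} (ab , a≢y Q , λ { refl → b∉g (y∈ Q) }))))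
      where
      hit : ∀ {f} → f ∈ₗ E → (a ∈ f × b ∈ f) × c ∉ f → (a ∈ f × b ∈ f × p ∈ f) ⊎ (a ∈ f × b ∈ f × q ∈ f)
      hit m ((af , bf) , c∉f) with u , ne , ug , uf ← meet F mg m ag af with only Q ug
      ... | inj₁ p = contradiction p ne
      ... | inj₂ (inj₁ refl) = contradiction uf c∉f
      ... | inj₂ (inj₂ (inj₁ refl)) = inj₁ (af , bf , uf)
      ... | inj₂ (inj₂ (inj₂ refl)) = inj₂ (af , bf , uf)

    N-swap : ∀ {a b c} → N a b c ≤ N b a c
    N-swap {a} {b} {c} = #-mono (N? a b c) (N? b a c) E λ { _ ((p , q) , r) → (q , p) , r }

    N-side′ : ∀ {a b c} → a ≢ b → a ≢ c → 1 ≤ N a c b → N a b c ≤ y + y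
    N-side′ {a} {b} {c} ab ac pos with g , m , h ← #-∃ (N? a c b) E pos = N-side ab ac m h

    -- Lightness excludes a sunflower with core {a, b}, so the greedy bound applies with 2y
    -- conflicts per edge.
    cover : ∀ {a b c} → Distinct₃ a b c → 4 ≤ deg₃ a b c E → deg₂ a b E ≤ (y + y) + ((y + y) + (y + y))
    cover {a} {b} {c} d le with sun-or-few F a b (y + y) bound
      where
      bound : ∀ {e} → e ∈ₗ E → a ∈ e → b ∈ e → # (λ f → has₂? a b f ×-dec conflict? a b e f) E ≤ y + y
      bound m ae be with p , q , Q ← quad₂ (four F m) ae be (proj₁ d) =
        ≤-trans (m≤m+n _ _) (≤-trans (conflicts-≤ Q) (+-mono-≤ (max (a≢b Q , a≢x Q , b≢x Q)) (max (a≢b Q , a≢y Q , b≢y Q))))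
    ... | inj₁ s = contradiction s (L d le)
    ... | inj₂ h = h

    deg₂-split : ∀ a b c → deg₃ a b c E + N a b c ≤ deg₂ a b E
    deg₂-split a b c = ≤-trans (+-monoˡ-≤ _ (#-mono _ (λ e → has₂? a b e ×-dec (c ∈? e)) E λ { _ (p , q , r) → (p , q) , r }))
      (≤-reflexive (sym (#-split (has₂? a b) (c ∈?_) E)))

    -- Split the edges by which of a, b, c they contain. If two of the three classes with exactly
    -- two core vertices are nonempty, `N-side` bounds every class by 2y, in total y + 6y. Otherwise
    -- all these edges contain one common pair, and `cover` gives 6y.
    touching≤ : # (meets? S?) E ≤ 7 * y
    touching≤ = ≤-trans split cases
      where
      split : # (meets? S?) E ≤ y + (N a b c + (N a c b + N b c a))
      split = ≤-trans (#-mono _ (λ e → has₃? a b c e ⊎-dec (N? a b c e ⊎-dec (N? a c b e ⊎-dec N? b c a e))) E (λ {e} m t → cl (meets⇒two m t)))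
        (≤-trans (#-∪ _ _ E) (+-monoʳ-≤ y (≤-trans (#-∪ _ _ E) (+-monoʳ-≤ (N a b c) (#-∪ _ _ E)))))
        where
        cl : ∀ {e} → Two e → (a ∈ e × b ∈ e × c ∈ e) ⊎ ((a ∈ e × b ∈ e) × c ∉ e) ⊎ ((a ∈ e × c ∈ e) × b ∉ e) ⊎ ((b ∈ e × c ∈ e) × a ∉ e)
        cl {e} t with a ∈? e | b ∈? e | c ∈? e
        ... | yes p | yes q | yes r = inj₁ (p , q , r)
        ... | yes p | yes q | no r = inj₂ (inj₁ ((p , q) , r))
        ... | yes p | no q | yes r = inj₂ (inj₂ (inj₁ ((p , r) , q)))
        ... | no p | yes q | yes r = inj₂ (inj₂ (inj₂ ((q , r) , p)))
        cl (inj₁ (p , q)) | no ¬p | _ | _ = contradiction p ¬p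
        cl (inj₁ (p , q)) | yes _ | no ¬q | no _ = contradiction q ¬q
        cl (inj₂ (inj₁ (p , q))) | no ¬p | _ | _ = contradiction p ¬p
        cl (inj₂ (inj₁ (p , q))) | yes _ | no _ | no ¬q = contradiction q ¬q
        cl (inj₂ (inj₂ (p , q))) | _ | no ¬p | _ = contradiction p ¬p
        cl (inj₂ (inj₂ (p , q))) | _ | yes _ | no ¬q = contradiction q ¬q
      six : ∀ {k} → k ≤ (y + y) + ((y + y) + (y + y)) → k ≤ 7 * y
      six h = ≤-trans h (≤-trans (≤-reflexive (eq y)) (*-monoˡ-≤ y (n≤1+n 6)))
        where eq : ∀ y → (y + y) + ((y + y) + (y + y)) ≡ 6 * y
              eq = solve-∀
      deg₃-acb : y ≤ deg₃ a c b E
      deg₃-acb = #-mono _ _ E λ { _ (p , q , r) → p , r , q }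
      deg₃-bca : y ≤ deg₃ b c a E
      deg₃-bca = #-mono _ _ E λ { _ (p , q , r) → q , r , p }
      all7 : N a b c ≤ y + y → N a c b ≤ y + y → N b c a ≤ y + y → y + (N a b c + (N a c b + N b c a)) ≤ 7 * y
      all7 p q r = ≤-trans (+-monoʳ-≤ y (+-mono-≤ p (+-mono-≤ q r))) (≤-reflexive (eq y))
        where eq : ∀ y → y + ((y + y) + ((y + y) + (y + y))) ≡ 7 * y
              eq = solve-∀
      zero? : ∀ k → k ≡ 0 ⊎ 1 ≤ k
      zero? zero = inj₁ refl
      zero? (suc k) = inj₂ (s≤s z≤n)
      z≤ : ∀ {k} → k ≡ 0 → k ≤ y + y
      z≤ refl = z≤n
      cases : y + (N a b c + (N a c b + N b c a)) ≤ 7 * y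
      cases with zero? (N a b c) | zero? (N a c b) | zero? (N b c a)
      ... | _ | inj₁ e₂ | inj₁ e₃ rewrite e₂ | e₃ | +-identityʳ (N a b c) = six (≤-trans (deg₂-split a b c) (cover D y≥4))
      ... | inj₁ e₁ | inj₂ _ | inj₁ e₃ rewrite e₁ | e₃ | +-identityʳ (N a c b) =
        six (≤-trans (≤-trans (+-monoˡ-≤ _ deg₃-acb) (deg₂-split a c b)) (cover (ac , ab , bc ∘ sym) (≤-trans y≥4 deg₃-acb)))
      ... | inj₁ e₁ | inj₁ e₂ | inj₂ _ rewrite e₁ | e₂ =
        six (≤-trans (≤-trans (+-monoˡ-≤ _ deg₃-bca) (deg₂-split b c a)) (cover (bc , ab ∘ sym , ac ∘ sym) (≤-trans y≥4 deg₃-bca)))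
      ... | inj₁ e₁ | inj₂ p₂ | inj₂ p₃ = all7 (z≤ e₁)
        (≤-trans N-swap (N-side′ (ac ∘ sym) (bc ∘ sym) (≤-trans p₃ N-swap)))
        (≤-trans N-swap (N-side′ (bc ∘ sym) (ac ∘ sym) (≤-trans p₂ N-swap)))
      ... | inj₂ p₁ | inj₁ e₂ | inj₂ p₃ = all7
        (≤-trans N-swap (N-side′ (ab ∘ sym) bc p₃)) (z≤ e₂) (N-side′ bc (ab ∘ sym) (≤-trans p₁ N-swap))
      ... | inj₂ p₁ | inj₂ p₂ | inj₁ e₃ = all7 (N-side′ ab ac p₂) (N-side′ ac ab p₁) (z≤ e₃)
      ... | inj₂ p₁ | inj₂ p₂ | inj₂ p₃ = all7 (N-side′ ab ac p₂) (N-side′ ac ab p₁) (N-side′ bc (ab ∘ sym) (≤-trans p₁ N-swap))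

  -- R collects the deleted vertices. That they lie on edges makes the sets deleted in different
  -- rounds disjoint; the alternative in `size` later shows that nothing was deleted when there are
  -- at most three low vertices.
  record Stripped (E : List (Subset n)) : Set₁ where
    field
      {R}  : Fin n → Set
      R?   : Decidable R
      E'   : List (Subset n)
      fam  : Family E'
      deg₃≤3 : Deg₃≤ 3 E'
      sub  : ∀ {e} → e ∈ₗ E' → e ∈ₗ E
      avoid : ∀ {e v} → e ∈ₗ E' → v ∈ e → ¬ R v
      removed-supp : ∀ {v} → R v → Any (v ∈_) E
      few  : length E ≤ length E' + 7 * # R? V
      size : (# R? V ≡ 0 × E' ≡ E) ⊎ 4 ≤ # R? V

  distinct₃? : (t : Fin n × Fin n × Fin n) → Dec (Distinct₃ (proj₁ t) (proj₁ (proj₂ t)) (proj₂ (proj₂ t)))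
  distinct₃? (a , b , c) = ¬? (a ≟F b) ×-dec (¬? (a ≟F c) ×-dec ¬? (b ≟F c))

  triples : List (Fin n × Fin n × Fin n)
  triples = filter distinct₃? (cartesianProduct V (cartesianProduct V V))

  opaque
    ∈-triples : ∀ {a b c} → Distinct₃ a b c → (a , b , c) ∈ₗ triples
    ∈-triples = ∈-filter⁺ distinct₃? (∈-cartesianProduct⁺ v∈V (∈-cartesianProduct⁺ v∈V v∈V))

    triples-distinct : ∀ {a b c} → (a , b , c) ∈ₗ triples → Distinct₃ a b c
    triples-distinct m = proj₂ (∈-filter⁻ distinct₃? {xs = cartesianProduct V (cartesianProduct V V)} m)

  deg₃′ : List (Subset n) → Fin n × Fin n × Fin n → ℕ
  deg₃′ E (a , b , c) = deg₃ a b c E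

  -- The recursion is on the bound k for the number of edges: a maximal triple lies in an edge, so
  -- each round deletes at least one.
  strip : ∀ k E → length E ≤ k → Family E → Light E → Stripped E
  strip k E le F L with argmax (deg₃′ E) triples 3
  ... | inj₁ h = record
    { R = λ _ → ⊥ ; R? = λ _ → no (λ ()) ; E' = E ; fam = F ; deg₃≤3 = λ d → h (∈-triples d)
    ; sub = λ m → m ; avoid = λ _ _ () ; removed-supp = λ ()
    ; few = m≤m+n _ _ ; size = inj₁ (#-none _ V (λ _ ()) , refl) }
  ... | inj₂ ((a , b , c) , t , y≥4 , mx) = go k le
    where
    D = triples-distinct t
    open MaxTriple F L a b c D y≥4 (λ d → mx (∈-triples d))
    S¬? = λ e → ¬? (meets? S? e)
    E₁ = filter S¬? E
    total : # (meets? S?) E + length E₁ ≡ length E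
    total = trans (cong (# (meets? S?) E +_) (sym (#-length S¬? E))) (#-compl (meets? S?) E)
    4≤#S = ≤-trans y≥4 deg₃≤#S
    some : 1 ≤ # (meets? S?) E
    some with e , m , h@(ae , _) ← #-∃ (has₃? a b c) E (≤-trans (s≤s z≤n) y≥4) = #-pos (meets? S?) E m (a , ae , lose m (h , ae))
    go : ∀ k → length E ≤ k → Stripped E
    go zero le with () ← ≤-trans some (≤-trans (m≤m+n _ _) (≤-trans (≤-reflexive total) le))
    go (suc k) le = record
      { R? = λ v → S? v ⊎-dec R? v
      ; E' = E' ; fam = fam ; deg₃≤3 = deg₃≤3
      ; sub = λ m → proj₁ (filtered S¬? E (sub m))
      ; avoid = λ { m ve (inj₁ s) → proj₂ (filtered S¬? E (sub m)) (_ , ve , s) ; m ve (inj₂ r) → avoid m ve r }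
      ; removed-supp = λ { (inj₁ s) → Any.map proj₂ s ; (inj₂ r) → supp₁ (removed-supp r) }
      ; few = few'
      ; size = inj₂ (≤-trans 4≤#S (#-mono _ _ V λ _ → inj₁)) }
      where
      open Stripped (strip k E₁ (≤-pred (≤-trans (≤-trans (+-monoˡ-≤ _ some) (≤-reflexive total)) le)) (subfamily S¬? F) (sub-light S¬? L))
      supp₁ : ∀ {v} → Any (v ∈_) E₁ → Any (v ∈_) E
      supp₁ s with e , m , ve ← find s = lose (proj₁ (filtered S¬? E m)) ve
      -- Later rounds delete vertices on edges of `E₁`, and these edges avoid S; no vertex is
      -- charged twice.
      disj : # S? V + # R? V ≤ # (λ v → S? v ⊎-dec R? v) V
      disj = ≤-reflexive (sym (trans (sym (+-identityʳ U)) (trans (cong (U +_) (sym none)) (#-∪∩ S? R? V))))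
        where
        U = # (λ v → S? v ⊎-dec R? v) V
        none : # (λ v → S? v ×-dec R? v) V ≡ 0
        none = #-none _ V λ { _ (s , r) → no-S (removed-supp r) s }
          where
          no-S : ∀ {v} → Any (v ∈_) E₁ → ¬ S v
          no-S a s with e , m , ve ← find a = proj₂ (filtered S¬? E m) (_ , ve , s)
      few' : length E ≤ length E' + 7 * # (λ v → S? v ⊎-dec R? v) V
      few' = begin
        length E                                              ≡⟨ sym total ⟩
        # (meets? S?) E + length E₁                          ≤⟨ +-mono-≤ (≤-trans touching≤ (*-monoʳ-≤ 7 deg₃≤#S)) few ⟩
        7 * # S? V + (length E' + 7 * # R? V)                 ≡⟨ eq (# S? V) (length E') (# R? V) ⟩
        length E' + 7 * (# S? V + # R? V)                     ≤⟨ +-monoʳ-≤ (length E') (*-monoʳ-≤ 7 disj) ⟩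
        length E' + 7 * # (λ v → S? v ⊎-dec R? v) V           ∎
        where
        open ≤-Reasoning
        eq : ∀ a b c → 7 * a + (b + 7 * c) ≡ b + 7 * (a + c)
        eq = solve-∀

-- Families in which every triple lies in at most three edges

module _ {n : ℕ} where

  High : List (Subset n) → Fin n → Set
  High E v = 46 ≤ deg₁ v E

  high? : ∀ E v → Dec (High E v)
  high? E v = 46 ≤? deg₁ v E

  twins-sym : ∀ {E : List (Subset n)} {a b} → Twins E a b → Twins E b a
  twins-sym = All.map λ { (f , g) → g , f }

  -- 45 = 3 · 3 · 5: an edge {a, b, x, y} meets every edge at a in one of the pairs ab, ax, ay, and a pair that is
  -- not the core of a sunflower lies in at most 3 · 5 edges.
  module Triples≤3 {E : List (Subset n)} (F : Family E) (T : Deg₃≤ 3 E) where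

    opaque
      -- An edge {a, b, p, q} has at most 3 + 3 - 1 = 5 conflicts: it lies itself on both triples
      -- abp and abq and is counted twice in the sum.
      sun-or-15 : ∀ {a b} → a ≢ b → Sun E a b ⊎ deg₂ a b E ≤ 15
      sun-or-15 {a} {b} ab = sun-or-few F a b 5 bound
        where
        bound : ∀ {e} → e ∈ₗ E → a ∈ e → b ∈ e → # (λ f → has₂? a b f ×-dec conflict? a b e f) E ≤ 5
        bound {e} m ae be with p , q , Q ← quad₂ (four F m) ae be ab =
          +-cancelʳ-≤ 1 _ 5 (≤-trans (+-monoʳ-≤ _ (#-pos (λ f → has₃? a b p f ×-dec has₃? a b q f) E m ((ae , be , x∈ Q) , (ae , be , y∈ Q))))
            (≤-trans (conflicts-≤ Q) (+-mono-≤ (T (ab , a≢x Q , b≢x Q)) (T (ab , a≢y Q , b≢y Q)))))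

      high⇒sun : ∀ {a} → High E a → ∃ λ b → a ≢ b × Sun E a b
      high⇒sun {a} h with e , m , ae ← #-∃ (a ∈?_) E (≤-trans (s≤s z≤n) h) with b , x , y , Q ← quad₁ (four F m) ae
        with sun-or-15 (a≢b Q) | sun-or-15 (a≢x Q) | sun-or-15 (a≢y Q)
      ... | inj₁ s | _ | _ = b , a≢b Q , s
      ... | inj₂ _ | inj₁ s | _ = x , a≢x Q , s
      ... | inj₂ _ | inj₂ _ | inj₁ s = y , a≢y Q , s
      ... | inj₂ p | inj₂ q | inj₂ r = contradiction (≤-trans h (≤-trans three (+-mono-≤ p (+-mono-≤ q r)))) (<⇒≱ (n<1+n 45))
        where
        three : deg₁ a E ≤ deg₂ a b E + (deg₂ a x E + deg₂ a y E)
        three = ≤-trans (#-mono (a ∈?_) (λ f → has₂? a b f ⊎-dec (has₂? a x f ⊎-dec has₂? a y f)) E cl)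
          (≤-trans (#-∪ (has₂? a b) _ E) (+-monoʳ-≤ _ (#-∪ (has₂? a x) (has₂? a y) E)))
          where
          cl : ∀ {f} → f ∈ₗ E → a ∈ f → (a ∈ f × b ∈ f) ⊎ (a ∈ f × x ∈ f) ⊎ (a ∈ f × y ∈ f)
          cl mf af with u , ne , ue , uf ← meet F m mf ae af with only Q ue
          ... | inj₁ p = contradiction p ne
          ... | inj₂ (inj₁ refl) = inj₁ (af , uf)
          ... | inj₂ (inj₂ (inj₁ refl)) = inj₂ (inj₁ (af , uf))
          ... | inj₂ (inj₂ (inj₂ refl)) = inj₂ (inj₂ (af , uf))

      -- A twin of a lies in two petals, which share nothing but the core.
      twin-unique : ∀ {a b c} → Sun E a b → a ≢ c → Twins E a c → c ≡ b
      twin-unique {a} {b} {c} S ac t with Sunflower.c₁₂ S (at (Sunflower.m₁ S)) (at (Sunflower.m₂ S))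
        where
        at : ∀ {e} → e ∈ₗ E × (∀ {u} → u ≡ a ⊎ u ≡ b → u ∈ e) → c ∈ e
        at (m , core) = proj₁ (All.lookup t m) (core (inj₁ refl))
      ... | inj₁ p = contradiction (sym p) ac
      ... | inj₂ p = p

      twin-high : ∀ {a b} → Twins E a b → High E a → High E b
      twin-high {a} {b} t h = ≤-trans h (#-mono (a ∈?_) (b ∈?_) E λ m → proj₁ (All.lookup t m))

      -- Suppose {a, b, x, y} and {a, b, x, z} are edges. An edge at x either contains a, hence the
      -- triple abx, or it avoids the twins and must meet both edges again, hence contains xyz. So x
      -- has degree at most 3 + 3 and is not high.
      single : ∀ {a b x} → Twins E a b → Distinct₃ a b x → High E x → deg₃ a b x E ≤ 1
      single {a} {b} {x} t d@(ab , ax , bx) hx with deg₃ a b x E ≤? 1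
      ... | yes p = p
      ... | no ¬p with e , f , e≢f , (me , ae , be , xe) , (mf , af , bf , xf) ← #-two (has₃? a b x) (uniq F) (≰⇒> ¬p)
        with y , Q ← quad₃ (four F me) ae be xe ab ax bx with z , Q' ← quad₃ (four F mf) af bf xf ab ax bx =
        contradiction (≤-trans hx (≤-trans (≤-trans (#-mono (x ∈?_) (λ g → has₃? a b x g ⊎-dec has₃? x y z g) E cl)
          (#-∪ (has₃? a b x) (has₃? x y z) E)) (+-mono-≤ (T d) (T (x≢y Q , x≢y Q' , y≢z))))) (<⇒≱ (s≤s (s≤s (s≤s (s≤s (s≤s (s≤s (s≤s z≤n))))))))
        where
        y≢z : y ≢ z
        y≢z refl = e≢f (quad-determines (four F mf) Q af bf xf (y∈ Q'))
        other : ∀ {e w} → e ∈ₗ E → Quad e a b x w → ∀ {g} → g ∈ₗ E → x ∈ g → a ∉ g → w ∈ g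
        other me Q mg xg a∉g with u , ne , ue , ug ← meet F me mg (x∈ Q) xg with only Q ue
        ... | inj₁ refl = contradiction ug a∉g
        ... | inj₂ (inj₁ refl) = contradiction (proj₂ (All.lookup t mg) ug) a∉g
        ... | inj₂ (inj₂ (inj₁ p)) = contradiction p ne
        ... | inj₂ (inj₂ (inj₂ refl)) = ug
        cl : ∀ {g} → g ∈ₗ E → x ∈ g → (a ∈ g × b ∈ g × x ∈ g) ⊎ (x ∈ g × y ∈ g × z ∈ g)
        cl {g} mg xg with a ∈? g
        ... | yes ag = inj₁ (ag , proj₁ (All.lookup t mg) ag , xg)
        ... | no a∉g = inj₂ (xg , other me Q mg xg a∉g , other mf Q' mg xg a∉g)

      -- The high vertices of an edge are closed under the fixed-point-free twin involution, so their number is even.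
      low-not-alone : ∀ {e v} → e ∈ₗ E → v ∈ e → ¬ High E v → ∃ λ u → u ≢ v × u ∈ e × ¬ High E u
      low-not-alone {e} {v} m ve low with p , q , r , Q ← quad₁ (four F m) ve with high? E p | high? E q | high? E r
      ... | no ¬h | _ | _ = p , a≢b Q ∘ sym , b∈ Q , ¬h
      ... | yes _ | no ¬h | _ = q , a≢x Q ∘ sym , x∈ Q , ¬h
      ... | yes _ | yes _ | no ¬h = r , a≢y Q ∘ sym , y∈ Q , ¬h
      ... | yes hp | yes hq | yes hr = ⊥-elim (go (partner hp (b∈ Q) ) (partner hq (x∈ Q)) (partner hr (y∈ Q)))
        where
        Partner : Fin n → Fin n → Set
        Partner a b = a ≢ b × Sun E a b
        partner : ∀ {a} → High E a → a ∈ e → ∃ λ b → Partner a b × (b ≡ p ⊎ b ≡ q ⊎ b ≡ r)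
        partner ha ae with b , ne , s ← high⇒sun ha with t ← sun⇒twins F ne s with only Q (proj₁ (All.lookup t m) ae)
        ... | inj₁ refl = contradiction (twin-high t ha) low
        ... | inj₂ w = b , (ne , s) , w
        back : ∀ {a b c} → Partner a b → Partner c a → c ≡ b
        back (_ , s) (ne , s') = twin-unique s (ne ∘ sym) (twins-sym (sun⇒twins F ne s'))
        go : (∃ λ b → Partner p b × (b ≡ p ⊎ b ≡ q ⊎ b ≡ r)) → (∃ λ b → Partner q b × (b ≡ p ⊎ b ≡ q ⊎ b ≡ r)) →
             (∃ λ b → Partner r b × (b ≡ p ⊎ b ≡ q ⊎ b ≡ r)) → ⊥
        go (_ , (ne , _) , inj₁ w) _ _ = ne (sym w)
        go _ (_ , (ne , _) , inj₂ (inj₁ w)) _ = ne (sym w)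
        go _ _ (_ , (ne , _) , inj₂ (inj₂ w)) = ne (sym w)
        go (_ , s , inj₂ (inj₁ refl)) _ (_ , s' , inj₁ refl) = x≢y Q (sym (back s s'))
        go (_ , s , inj₂ (inj₁ refl)) (_ , s'' , inj₁ refl) (_ , s' , inj₂ (inj₁ refl)) = b≢y Q (sym (back s'' s'))
        go (_ , s , inj₂ (inj₁ refl)) (_ , s'' , inj₂ (inj₂ refl)) _ = b≢y Q (back s'' s)
        go (_ , s , inj₂ (inj₂ refl)) (_ , s' , inj₁ refl) _ = x≢y Q (back s s')
        go (_ , s , inj₂ (inj₂ refl)) (_ , s' , inj₂ (inj₂ refl)) (_ , s'' , inj₁ refl) = b≢x Q (sym (back s'' s'))
        go (_ , s , inj₂ (inj₂ refl)) (_ , s' , inj₂ (inj₂ refl)) (_ , s'' , inj₂ (inj₁ refl)) = b≢x Q (back s'' s)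

    -- High vertices are defined by degrees in E, while the edges counted are those of G. This is
    -- applied to G = E and to the edges without low vertices; in the second case ℓ = 0.
    module _ {G : List (Subset n)} (FG : Family G) (G⊆E : ∀ {e} → e ∈ₗ G → e ∈ₗ E)
             (G≤E : ∀ {P : Subset n → Set} (P? : Decidable P) → # P? G ≤ # P? E)
             {W : Fin n → Set} (W? : Decidable W) (supp : ∀ {e v} → e ∈ₗ G → v ∈ e → W v) where

      ℓ H : ℕ
      ℓ = # (λ v → W? v ×-dec ¬? (high? E v)) V
      H = # (high? E) V

      opaque
        -- Each edge at a contains its twin b and two further vertices. Such a vertex occurs at most
        -- once if it is high, by `single`, and at most three times otherwise. The summand 2 stands
        -- for a and b, which belong to the H high vertices.
        high-deg : ∀ {a} → High E a → 2 * deg₁ a G + 2 ≤ H + 3 * ℓ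
        high-deg {a} ha with b , ab , s ← high⇒sun ha with t ← sun⇒twins F ab s = begin
          2 * deg₁ a G + 2                                             ≡⟨ cong (_+ 2) (sym cols) ⟩
          Σ[ (λ v → # (R? v) G) ] V + 2                       ≤⟨ +-monoˡ-≤ 2 (Σ-two-classes H'? L? _ 1 3 V λ {v} _ → col v (v ≟F a) (v ≟F b) (W? v) (high? E v)) ⟩
          1 * # H'? V + 3 * ℓ + 2                                    ≡⟨ eq (# H'? V) (3 * ℓ) ⟩
          suc (suc (# H'? V)) + 3 * ℓ                                ≡⟨ cong (_+ 3 * ℓ) (sym two) ⟩
          H + 3 * ℓ                                                  ∎
          where
          open ≤-Reasoning
          eq : ∀ x y → 1 * x + y + 2 ≡ suc (suc x) + y
          eq = solve-∀
          L? : ∀ v → Dec (W v × ¬ High E v)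
          L? = λ v → W? v ×-dec ¬? (high? E v)
          H'? : ∀ v → Dec ((High E v × v ≢ a) × v ≢ b)
          H'? v = (high? E v ×-dec ¬? (v ≟F a)) ×-dec ¬? (v ≟F b)
          two : H ≡ suc (suc (# H'? V))
          two = trans (#-remove _≟F_ (high? E) V-unique v∈V ha)
            (cong suc (#-remove _≟F_ (λ v → high? E v ×-dec ¬? (v ≟F a)) V-unique v∈V (twin-high t ha , ab ∘ sym)))
          R? : ∀ v e → Dec ((a ∈ e × v ∈ e) × (v ≢ a × v ≢ b))
          R? v e = ((a ∈? e) ×-dec (v ∈? e)) ×-dec (¬? (v ≟F a) ×-dec ¬? (v ≟F b))
          cols : Σ[ (λ v → # (R? v) G) ] V ≡ 2 * deg₁ a G
          cols = trans (double-count R? V G) (Σ-# (a ∈?_) _ 2 G row (λ {e} m a∉e → #-none _ V λ _ r → a∉e (proj₁ (proj₁ r))))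
            where
            row : ∀ {e} → e ∈ₗ G → a ∈ e → # (λ v → R? v e) V ≡ 2
            row {e} m ae = two-others (four FG m) ae (proj₁ (All.lookup t (G⊆E m)) ae) ab (λ v → R? v e)
              (λ ((_ , ve) , (va , vb)) → (ve , va) , vb) (λ ((ve , va) , vb) → (ae , ve) , (va , vb))
          to₃ : ∀ v → # (R? v) G ≤ deg₃ a b v E
          to₃ v = ≤-trans (#-mono (R? v) (has₃? a b v) G λ { m ((ae , ve) , _) → ae , proj₁ (All.lookup t (G⊆E m)) ae , ve }) (G≤E (has₃? a b v))
          col : ∀ v → Dec (v ≡ a) → Dec (v ≡ b) → Dec (W v) → Dec (High E v) →
            # (R? v) G ≡ 0 ⊎ (((High E v × v ≢ a) × v ≢ b) × # (R? v) G ≤ 1) ⊎ ((W v × ¬ High E v) × # (R? v) G ≤ 3)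
          col v (yes p) _ _ _ = inj₁ (#-none _ G λ _ r → proj₁ (proj₂ r) p)
          col v _ (yes p) _ _ = inj₁ (#-none _ G λ _ r → proj₂ (proj₂ r) p)
          col v _ _ (no ¬w) _ = inj₁ (#-none _ G λ m r → ¬w (supp m (proj₂ (proj₁ r))))
          col v (no va) (no vb) (yes w) (yes h) = inj₂ (inj₁ (((h , va) , vb) , ≤-trans (to₃ v) (single t (ab , va ∘ sym , vb ∘ sym) h)))
          col v (no va) (no vb) (yes w) (no ¬h) = inj₂ (inj₂ ((w , ¬h) , ≤-trans (to₃ v) (T (ab , va ∘ sym , vb ∘ sym))))

      opaque
        -- Doubled degree sum: high vertices contribute at most K each, low ones 2 · 45. The case H
        -- = 0 is separate because K is a truncated difference; a high vertex guarantees that H + 3ℓ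
        -- is at least 2.
        size-bound : 8 * length G + 2 * H ≤ 90 * ℓ + H * (H + 3 * ℓ)
        size-bound = go H refl
          where
          K : ℕ
          K = (H + 3 * ℓ) ∸ 2
          main : 8 * length G ≤ K * H + 90 * ℓ
          main = begin
            8 * length G                           ≡⟨ *-assoc 2 4 (length G) ⟩
            2 * (4 * length G)                     ≡⟨ cong (2 *_) (sym (deg-sum FG)) ⟩
            2 * Σ[ (λ v → deg₁ v G) ] V             ≡⟨ sym (Σ-* 2 (λ v → deg₁ v G) V) ⟩
            Σ[ (λ v → 2 * deg₁ v G) ] V             ≤⟨ Σ-two-classes (high? E) (λ v → W? v ×-dec ¬? (high? E v)) _ K 90 V (λ {v} _ → cl v) ⟩
            K * H + 90 * ℓ                         ∎
            where
            open ≤-Reasoning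
            cl : ∀ v → 2 * deg₁ v G ≡ 0 ⊎ (High E v × 2 * deg₁ v G ≤ K) ⊎ ((W v × ¬ High E v) × 2 * deg₁ v G ≤ 90)
            cl v with W? v | high? E v
            ... | no ¬w | _ = inj₁ (cong (2 *_) (#-none (v ∈?_) G λ m ve → ¬w (supp m ve)))
            ... | yes w | yes h = inj₂ (inj₁ (h , m+n≤o⇒m≤o∸n (2 * deg₁ v G) (high-deg h)))
            ... | yes w | no ¬h = inj₂ (inj₂ ((w , ¬h) , *-monoʳ-≤ 2 (≤-trans (G≤E (v ∈?_)) (≤-pred (≰⇒> ¬h)))))
          go : ∀ h → H ≡ h → 8 * length G + 2 * H ≤ 90 * ℓ + H * (H + 3 * ℓ)
          go zero eq = ≤-trans (≤-reflexive (trans (cong (λ z → 8 * length G + 2 * z) eq) (+-identityʳ _)))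
            (≤-trans main (≤-reflexive (trans (cong (λ z → K * z + 90 * ℓ) eq)
              (trans (cong (_+ 90 * ℓ) (*-zeroʳ K)) (sym (trans (cong (λ z → 90 * ℓ + z * (z + 3 * ℓ)) eq) (+-identityʳ _)))))))
          go (suc h) eq with a , _ , ha ← #-∃ (high? E) V (subst (1 ≤_) (sym eq) (s≤s z≤n)) =
            ≤-trans (+-monoˡ-≤ (2 * H) main) (≤-reflexive (trans (arr K H ℓ) (cong (λ z → 90 * ℓ + H * z) (m∸n+n≡m (≤-trans (m≤n+m 2 (2 * deg₁ a G)) (high-deg ha))))))
            where
            arr : ∀ K H ℓ → K * H + 90 * ℓ + 2 * H ≡ 90 * ℓ + H * (K + 2)
            arr = solve-∀

  module _ {E : List (Subset n)} (F : Family E) (T : Deg₃≤ 3 E) {W : Fin n → Set} (W? : Decidable W)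
           (supp : ∀ {e v} → e ∈ₗ E → v ∈ e → W v) where
    open Triples≤3 F T

    AllHigh : Subset n → Set
    AllHigh e = ¬ (∃ λ v → v ∈ e × ¬ High E v)

    allHigh? : ∀ e → Dec (AllHigh e)
    allHigh? e = ¬? (any? λ v → (v ∈? e) ×-dec ¬? (high? E v))

    private
      low? : ∀ v → Dec (W v × ¬ High E v)
      low? v = W? v ×-dec ¬? (high? E v)
      lows = # low? V
      highs = # (high? E) V

    opaque
      size-bound₁ : 8 * length E + 2 * highs ≤ 90 * lows + highs * (highs + 3 * lows)
      size-bound₁ = size-bound F (λ m → m) (λ P? → ≤-refl) W? supp

      -- Without low vertices the estimate is H(H - 2)/8, for even H the exact size of a thick
      -- clique on H vertices.
      highs-bound : 8 * # allHigh? E + 2 * highs ≤ highs * highs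
      highs-bound = ≤-trans (≤-reflexive (cong (λ z → 8 * z + 2 * highs) (#-length allHigh? E)))
        (≤-trans (size-bound {G = filter allHigh? E} (subfamily allHigh? F) (proj₁ ∘ filtered allHigh? E) (λ P? → sub-mono allHigh? P? E) (high? E) supp-high)
        (≤-reflexive (trans (cong (λ z → 90 * z + highs * (highs + 3 * z)) (#-none _ V λ _ (h , ¬h) → ¬h h))
          (cong (highs *_) (+-identityʳ highs)))))
        where
        supp-high : ∀ {e v} → e ∈ₗ filter allHigh? E → v ∈ e → High E v
        supp-high {e} {v} m ve with high? E v
        ... | yes h = h
        ... | no ¬h = contradiction (v , ve , ¬h) (proj₂ (filtered allHigh? E m))

      low-edges : # (λ e → ¬? (allHigh? e)) E ≤ 45 * lows
      low-edges = ≤-trans (≤-trans (≤-reflexive (#-ind _ E)) (Σ-mono E λ {e} m → one e m))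
        (≤-trans (≤-reflexive (sym (double-count (λ v e → (v ∈? e) ×-dec low? v) V E)))
          (Σ-one-class low? _ 45 V λ {v} _ → cl v))
        where
        one : ∀ e → e ∈ₗ E → ind (¬? (allHigh? e)) ≤ # (λ v → (v ∈? e) ×-dec low? v) V
        one e m with any? (λ v → (v ∈? e) ×-dec ¬? (high? E v))
        ... | no _ = z≤n
        ... | yes (v , ve , ¬h) = #-pos _ V v∈V (ve , supp m ve , ¬h)
        cl : ∀ v → # (λ e → (v ∈? e) ×-dec low? v) E ≡ 0 ⊎
                   ((W v × ¬ High E v) × # (λ e → (v ∈? e) ×-dec low? v) E ≤ 45)
        cl v with W? v | high? E v
        ... | no ¬w | _ = inj₁ (#-none _ E λ _ (_ , w , _) → ¬w w)
        ... | yes _ | yes h = inj₁ (#-none _ E λ _ (_ , _ , ¬h) → ¬h h)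
        ... | yes w | no ¬h = inj₂ ((w , ¬h) , ≤-trans (#-mono _ (v ∈?_) E λ _ → proj₁) (≤-pred (≰⇒> ¬h)))

      -- The product of ℓ and H disappears when edges with a low vertex are counted apart, 45 for
      -- each such vertex: 360 = 8 · 45.
      size-bound₂ : 8 * length E + 2 * highs ≤ 360 * lows + highs * highs
      size-bound₂ = begin
        8 * length E + 2 * highs                                          ≡⟨ cong (λ z → 8 * z + 2 * highs) (sym (#-compl allHigh? E)) ⟩
        8 * (# allHigh? E + # (λ e → ¬? (allHigh? e)) E) + 2 * highs      ≡⟨ eq (# allHigh? E) _ highs ⟩
        8 * # (λ e → ¬? (allHigh? e)) E + (8 * # allHigh? E + 2 * highs)  ≤⟨ +-mono-≤ (*-monoʳ-≤ 8 low-edges) highs-bound ⟩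
        8 * (45 * lows) + highs * highs                                   ≡⟨ cong (_+ highs * highs) (sym (*-assoc 8 45 lows)) ⟩
        360 * lows + highs * highs                                        ∎
        where
        open ≤-Reasoning
        eq : ∀ a b h → 8 * (a + b) + 2 * h ≡ 8 * b + (8 * a + 2 * h)
        eq = solve-∀

  record Rest (E : List (Subset n)) {W : Fin n → Set} (W? : Decidable W) : Set where
    field
      ℓ H : ℕ
      total : ℓ + H ≡ # W? V
      bound₁ : 8 * length E + 2 * H ≤ 90 * ℓ + H * (H + 3 * ℓ)
      bound₂ : 8 * length E + 2 * H ≤ 360 * ℓ + H * H
      -- A round of stripping deletes at least four vertices, all of them low afterwards. With ℓ ≤ 3
      -- the family is therefore unchanged.
      few-low : ℓ ≤ 3 → Deg₃≤ 3 E × H ≡ # (high? E) V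

  rest-bounds : ∀ {E} → Family E → Light E → {W : Fin n → Set} (W? : Decidable W) →
    (∀ {e v} → e ∈ₗ E → v ∈ e → W v) → Rest E W?
  rest-bounds {E} F L {W} W? supp = record
    { ℓ = ℓ₁ ; H = H₁
    ; total = total'
    ; bound₁ = b₁
    ; bound₂ = b₂
    ; few-low = λ le → fl size le }
    where
    open Stripped (strip (length E) E ≤-refl F L)
    W'? : ∀ v → Dec (W v × ¬ R v)
    W'? v = W? v ×-dec ¬? (R? v)
    H₁ = # (high? E') V
    ℓ₁ = # (λ v → W? v ×-dec ¬? (high? E' v)) V
    ℓ' = # (λ v → W'? v ×-dec ¬? (high? E' v)) V
    high-supp : ∀ {v} → High E' v → W v × ¬ R v
    high-supp {v} h with e , m , ve ← #-∃ (v ∈?_) E' (≤-trans (s≤s z≤n) h) = supp (sub m) ve , avoid m ve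
    total' : ℓ₁ + H₁ ≡ # W? V
    total' = trans (+-comm ℓ₁ H₁) (sym (trans (#-split W? (high? E') V)
      (cong (_+ ℓ₁) (#-≐ _ (high? E') V (λ _ → proj₂) (λ _ h → proj₁ (high-supp h) , h)))))
    RW : ∀ {v} → R v → W v × ¬ High E' v
    RW {v} r with e , m , ve ← find (removed-supp r) = supp m ve , λ h → proj₂ (high-supp h) r
    lows : ℓ' + # R? V ≤ ℓ₁
    lows = ≤-trans (≤-reflexive (sym (#-∪∩ (λ v → W'? v ×-dec ¬? (high? E' v)) R? V)))
      (≤-trans (+-mono-≤ (#-mono _ (λ v → W? v ×-dec ¬? (high? E' v)) V λ { _ (inj₁ ((w , _) , ¬h)) → w , ¬h ; _ (inj₂ r) → RW r })
                         (≤-reflexive (#-none _ V λ { _ (((_ , ¬r) , _) , r) → ¬r r })))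
               (≤-reflexive (+-identityʳ _)))
    supp'' : ∀ {e v} → e ∈ₗ E' → v ∈ e → W v × ¬ R v
    supp'' m ve = supp (sub m) ve , avoid m ve
    r = # R? V
    lift : ∀ {X} → 8 * length E' + 2 * H₁ ≤ X → 8 * length E + 2 * H₁ ≤ X + 56 * r
    lift {X} h = ≤-trans (+-monoˡ-≤ (2 * H₁) (*-monoʳ-≤ 8 few)) (≤-trans (≤-reflexive (eq (length E') r H₁)) (+-monoˡ-≤ (56 * r) h))
      where
      eq : ∀ e r h → 8 * (e + 7 * r) + 2 * h ≡ 8 * e + 2 * h + 56 * r
      eq = solve-∀
    b₁ : 8 * length E + 2 * H₁ ≤ 90 * ℓ₁ + H₁ * (H₁ + 3 * ℓ₁)
    b₁ = begin
      8 * length E + 2 * H₁                            ≤⟨ lift (size-bound₁ fam deg₃≤3 W'? supp'') ⟩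
      -- A stripped vertex costs 56 = 8 · 7, which leaves 34 of the 90 granted to a low vertex.
      90 * ℓ' + H₁ * (H₁ + 3 * ℓ') + 56 * r            ≤⟨ m≤m+n _ (34 * r) ⟩
      90 * ℓ' + H₁ * (H₁ + 3 * ℓ') + 56 * r + 34 * r   ≡⟨ eq ℓ' r _ ⟩
      90 * (ℓ' + r) + H₁ * (H₁ + 3 * ℓ')               ≤⟨ +-mono-≤ (*-monoʳ-≤ 90 lows) (*-monoʳ-≤ H₁ (+-monoʳ-≤ H₁ (*-monoʳ-≤ 3 (m+n≤o⇒m≤o ℓ' lows)))) ⟩
      90 * ℓ₁ + H₁ * (H₁ + 3 * ℓ₁)                     ∎
      where
      open ≤-Reasoning
      eq : ∀ l r x → 90 * l + x + 56 * r + 34 * r ≡ 90 * (l + r) + x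
      eq = solve-∀
    b₂ : 8 * length E + 2 * H₁ ≤ 360 * ℓ₁ + H₁ * H₁
    b₂ = begin
      8 * length E + 2 * H₁                   ≤⟨ lift (size-bound₂ fam deg₃≤3 W'? supp'') ⟩
      360 * ℓ' + H₁ * H₁ + 56 * r             ≤⟨ m≤m+n _ (304 * r) ⟩
      360 * ℓ' + H₁ * H₁ + 56 * r + 304 * r   ≡⟨ eq ℓ' r _ ⟩
      360 * (ℓ' + r) + H₁ * H₁                ≤⟨ +-monoˡ-≤ (H₁ * H₁) (*-monoʳ-≤ 360 lows) ⟩
      360 * ℓ₁ + H₁ * H₁                      ∎
      where
      open ≤-Reasoning
      eq : ∀ l r x → 360 * l + x + 56 * r + 304 * r ≡ 360 * (l + r) + x
      eq = solve-∀
    fl : (# R? V ≡ 0 × E' ≡ E) ⊎ 4 ≤ # R? V → ℓ₁ ≤ 3 → Deg₃≤ 3 E × H₁ ≡ # (high? E) V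
    fl (inj₁ (_ , e)) le = subst (Deg₃≤ 3) e deg₃≤3 , cong (λ z → # (high? z) V) e
    fl (inj₂ h) le = contradiction (≤-trans (m≤n+m r ℓ') lows) (<⇒≱ (≤-trans (s≤s le) h))

-- Centres and spokes of 2-stars

module Stars {n : ℕ} {E : List (Subset n)} (F : Family E) where

  Hub : Fin n → Fin n → Fin n → Set
  Hub a b c = (c ≢ a × c ≢ b) × 4 ≤ deg₃ a b c E

  -- The last condition says that a and b are the only vertices common to all edges at a.
  Center : Fin n → Fin n → Set
  Center a b = a ≢ b × Twins E a b × (∃ λ c → Hub a b c) ×
    (∀ p → p ≢ a × p ≢ b → Any (λ e → a ∈ e × p ∉ e) E)

  opaque
    center? : ∀ a b → Dec (Center a b)
    center? a b = ¬? (a ≟F b) ×-dec (All.all? (λ e → ((a ∈? e) →-dec (b ∈? e)) ×-dec ((b ∈? e) →-dec (a ∈? e))) E ×-dec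
      (any? (λ c → (¬? (c ≟F a) ×-dec ¬? (c ≟F b)) ×-dec (4 ≤? deg₃ a b c E)) ×-dec
      all? (λ p → (¬? (p ≟F a) ×-dec ¬? (p ≟F b)) →-dec Any.any? (λ e → (a ∈? e) ×-dec ¬? (p ∈? e)) E)))

    center-sym : ∀ {a b} → Center a b → Center b a
    center-sym {a} {b} (ab , t , (c , (ca , cb) , le) , o) = ab ∘ sym , twins-sym t ,
      (c , (cb , ca) , ≤-trans le (#-mono (has₃? a b c) (has₃? b a c) E λ _ (p , q , r) → q , p , r)) ,
      λ p (pb , pa) → let e , m , ae , p∉e = find (o p (pa , pb)) in lose m (proj₁ (All.lookup t m) ae , p∉e)

    center-unique : ∀ {a b b'} → Center a b → Center a b' → b ≡ b'
    center-unique {a} {b} {b'} (_ , _ , _ , o) (ab' , t , _) with b' ≟F b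
    ... | yes p = sym p
    ... | no ¬p with e , m , ae , b'∉e ← find (o b' (ab' ∘ sym , ¬p)) = contradiction (proj₁ (All.lookup t m) ae) b'∉e

    -- Two petals meet only in the core, so any further vertex is missing from one of them; this
    -- gives the last condition on a centre.
    sun⇒center : ∀ {a b c} → Distinct₃ a b c → 4 ≤ deg₃ a b c E → Sun E a b → Center a b
    sun⇒center {a} {b} (ab , ac , bc) le s = ab , sun⇒twins F ab s , (_ , (ac ∘ sym , bc ∘ sym) , le) , o
      where
      open Sunflower s
      o : ∀ p → p ≢ a × p ≢ b → Any (λ e → a ∈ e × p ∉ e) E
      o p (pa , pb) with p ∈? e₁ | p ∈? e₂
      ... | no p∉ | _ = lose (proj₁ m₁) (proj₂ m₁ (inj₁ refl) , p∉)
      ... | yes _ | no p∉ = lose (proj₁ m₂) (proj₂ m₂ (inj₁ refl) , p∉)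
      ... | yes p∈ | yes p∈' with c₁₂ p∈ p∈'
      ...   | inj₁ q = contradiction q pa
      ...   | inj₂ q = contradiction q pb

  -- A spoke has to lie on an edge, since otherwise an isolated vertex would be a spoke of every
  -- star. Asking for a alone in the last clause suffices: a and b are twins.
  Spoke : Fin n × Fin n → Fin n → Set
  Spoke (a , b) x = (x ≢ a × x ≢ b) × Any (x ∈_) E × All (λ e → x ∈ e → a ∈ e) E

  spoke? : ∀ i x → Dec (Spoke i x)
  spoke? (a , b) x = (¬? (x ≟F a) ×-dec ¬? (x ≟F b)) ×-dec (Any.any? (x ∈?_) E ×-dec All.all? (λ e → (x ∈? e) →-dec (a ∈? e)) E)

  Touch : Fin n × Fin n → Subset n → Set
  Touch i = Meets (Spoke i)

  touch? : ∀ i e → Dec (Touch i e)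
  touch? i = meets? (spoke? i)

  X ed : Fin n × Fin n → ℕ
  X i = # (spoke? i) V
  ed i = # (touch? i) E

  module _ {a b : Fin n} (C : Center a b) where

    private
      ab = proj₁ C
      tw = proj₁ (proj₂ C)

    opaque
      touch⇒center : ∀ {e} → e ∈ₗ E → Touch (a , b) e → a ∈ e × b ∈ e
      touch⇒center m (x , xe , _ , _ , al) = let ae = All.lookup al m xe in ae , proj₁ (All.lookup tw m) ae

      -- Let e = {a, b, x, y} with spoke x. An edge through y meets e again in a, in its twin b or
      -- in the spoke x, and in each case it contains a. So y is a spoke as well, and a star is
      -- closed under the edges touching it.
      touch⇒inside : ∀ {e v} → e ∈ₗ E → Touch (a , b) e → v ∈ e → v ≡ a ⊎ v ≡ b ⊎ Spoke (a , b) v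
      touch⇒inside {e} {v} m t@(x , xe , s@((xa , xb) , _ , al)) ve with ae , be ← touch⇒center m t
        with y , Q ← quad₃ (four F m) ae be xe ab (xa ∘ sym) (xb ∘ sym) with only Q ve
      ... | inj₁ p = inj₁ p
      ... | inj₂ (inj₁ p) = inj₂ (inj₁ p)
      ... | inj₂ (inj₂ (inj₁ refl)) = inj₂ (inj₂ s)
      ... | inj₂ (inj₂ (inj₂ refl)) = inj₂ (inj₂ ((a≢y Q ∘ sym , b≢y Q ∘ sym) , lose m ve , All.tabulate al'))
        where
        al' : ∀ {f} → f ∈ₗ E → v ∈ f → a ∈ f
        al' mf vf with u , ne , ue , uf ← meet F m mf ve vf with only Q ue
        ... | inj₁ refl = uf
        ... | inj₂ (inj₁ refl) = proj₂ (All.lookup tw mf) uf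
        ... | inj₂ (inj₂ (inj₁ refl)) = All.lookup al mf uf
        ... | inj₂ (inj₂ (inj₂ p)) = contradiction p ne

      hub-spoke : ∀ {c} → Hub a b c → Spoke (a , b) c
      hub-spoke {c} ((ca , cb) , le) = (ca , cb) , any-c , All.tabulate al
        where
        any-c : Any (c ∈_) E
        any-c with e , m , _ , _ , ce ← #-∃ (has₃? a b c) E (≤-trans (s≤s z≤n) le) = lose m ce
        al : ∀ {f} → f ∈ₗ E → c ∈ f → a ∈ f
        al m cf with triple-core F ab (ca ∘ sym) (cb ∘ sym) le m cf (inj₂ (inj₂ refl))
        ... | u , ne , uf , inj₁ refl = uf
        ... | u , ne , uf , inj₂ (inj₁ refl) = proj₂ (All.lookup tw m) uf
        ... | u , ne , uf , inj₂ (inj₂ p) = contradiction p ne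

      -- The hub is one spoke; the fourth vertices of the edges through a, b and the hub are four
      -- more.
      5≤X : 5 ≤ X (a , b)
      5≤X with c , h@((ca , cb) , le) ← proj₁ (proj₂ (proj₂ C)) = ≤-trans (s≤s (≤-trans le four-spokes))
        (≤-reflexive (sym (#-remove _≟F_ (spoke? (a , b)) V-unique v∈V (hub-spoke h))))
        where
        four-spokes : deg₃ a b c E ≤ # (λ v → spoke? (a , b) v ×-dec ¬? (v ≟F c)) V
        four-spokes = deg₃-≤ F ab (ca ∘ sym) (cb ∘ sym) _ λ m Q → sp Q (touch⇒inside m (c , x∈ Q , hub-spoke h) (y∈ Q)) , x≢y Q ∘ sym
          where
          sp : ∀ {e y} → Quad e a b c y → y ≡ a ⊎ y ≡ b ⊎ Spoke (a , b) y → Spoke (a , b) y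
          sp Q (inj₁ p) = contradiction (sym p) (a≢y Q)
          sp Q (inj₂ (inj₁ p)) = contradiction (sym p) (b≢y Q)
          sp Q (inj₂ (inj₂ s)) = s

      ed≤deg : ed (a , b) ≤ deg₁ a E
      ed≤deg = #-mono (touch? (a , b)) (a ∈?_) E λ m t → proj₁ (touch⇒center m t)

      -- the edges of a star are edges of a graph on its spokes
      ed≤pairs : 2 * ed (a , b) ≤ (X (a , b) ∸ 1) * X (a , b)
      ed≤pairs = ≤-trans (≤-reflexive (sym rows)) (Σ-one-class (spoke? i) _ (X i ∸ 1) V λ {v} _ → col v (spoke? i v))
        where
        i : Fin n × Fin n
        i = a , b
        R? : ∀ v e → Dec (v ∈ e × Spoke i v)
        R? v e = (v ∈? e) ×-dec spoke? i v
        rows : Σ[ (λ v → # (R? v) E) ] V ≡ 2 * ed i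
        rows = trans (double-count R? V E) (Σ-# (touch? i) _ 2 E row λ {e} m ¬t → #-none _ V λ {v} _ r → ¬t (v , r))
          where
          row : ∀ {e} → e ∈ₗ E → Touch i e → # (λ v → R? v e) V ≡ 2
          row {e} m t with ae , be ← touch⇒center m t = two-others (four F m) ae be ab (λ v → R? v e)
            (λ { (ve , (va , vb) , _) → (ve , va) , vb }) (λ { ((ve , va) , vb) → ve , sp va vb (touch⇒inside m t ve) })
            where
            sp : ∀ {v} → v ≢ a → v ≢ b → v ≡ a ⊎ v ≡ b ⊎ Spoke i v → Spoke i v
            sp va vb (inj₁ p) = contradiction p va
            sp va vb (inj₂ (inj₁ p)) = contradiction p vb
            sp va vb (inj₂ (inj₂ s)) = s
        col : ∀ v → Dec (Spoke i v) → # (R? v) E ≡ 0 ⊎ (Spoke i v × # (R? v) E ≤ X i ∸ 1)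
        col v (no ¬s) = inj₁ (#-none (R? v) E λ _ r → ¬s (proj₂ r))
        col v (yes s@((va , vb) , _)) = inj₂ (s , ≤-trans
            (#-mono (R? v) (has₃? a b v) E λ m r → let ae , be = touch⇒center m (v , r) in ae , be , proj₁ r)
            (≤-trans (deg₃-≤ F ab (va ∘ sym) (vb ∘ sym) (λ u → spoke? i u ×-dec ¬? (u ≟F v)) λ m Q → sp m Q (touch⇒inside m (v , x∈ Q , s) (y∈ Q)) , x≢y Q ∘ sym)
              (≤-reflexive (cong (_∸ 1) (sym (#-remove _≟F_ (spoke? i) V-unique v∈V s))))))
            where
            sp : ∀ {e y} → e ∈ₗ E → Quad e a b v y → y ≡ a ⊎ y ≡ b ⊎ Spoke i y → Spoke i y
            sp m Q (inj₁ p) = contradiction (sym p) (a≢y Q)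
            sp m Q (inj₂ (inj₁ p)) = contradiction (sym p) (b≢y Q)
            sp m Q (inj₂ (inj₂ s)) = s

  opaque
    -- If a' were a spoke of {a, b}, both a and b would lie in all edges at a'. Only b' can do so,
    -- which forces a = b.
    center-not-spoke : ∀ {a b a' b'} → Center a b → Center a' b' → ¬ Spoke (a , b) a'
    center-not-spoke {a} {b} {a'} {b'} (ab , t , _) (_ , _ , _ , o) ((a'a , a'b) , _ , al) = ab (trans (is-b' (a'a ∘ sym) (λ _ h → h)) (sym (is-b' (a'b ∘ sym) (λ m → proj₁ (All.lookup t m)))))
      where
      is-b' : ∀ {p} → p ≢ a' → (∀ {e} → e ∈ₗ E → a ∈ e → p ∈ e) → p ≡ b'
      is-b' {p} pa' imp with p ≟F b'
      ... | yes q = q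
      ... | no q with e , m , a'e , p∉e ← find (o p (pa' , q)) = contradiction (imp m (All.lookup al m a'e)) p∉e

  -- Being a centre is symmetric; the order selects one of the two pairs, so that every star is
  -- counted once.
  ordered? : ∀ (i : Fin n × Fin n) → Dec (proj₁ i Fin.< proj₂ i × Center (proj₁ i) (proj₂ i))
  ordered? (a , b) = (a Fin.<? b) ×-dec center? a b

  centers : List (Fin n × Fin n)
  centers = filter ordered? (cartesianProduct V V)

  opaque
    centers-unique : Unique centers
    centers-unique = Uniq.filter⁺ _ (Uniq.cartesianProduct⁺ V-unique V-unique)

    ∈-centers⁻ : ∀ {a b} → (a , b) ∈ₗ centers → a Fin.< b × Center a b
    ∈-centers⁻ m = proj₂ (filtered ordered? (cartesianProduct V V) m)

    ∈-centers⁺ : ∀ {a b} → a Fin.< b → Center a b → (a , b) ∈ₗ centers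
    ∈-centers⁺ lt c = ∈-filter⁺ ordered? (∈-cartesianProduct⁺ v∈V v∈V) (lt , c)

    same-center : ∀ {a b a' b'} → (a , b) ∈ₗ centers → (a' , b') ∈ₗ centers → a' ≡ a ⊎ a' ≡ b → (a , b) ≡ (a' , b')
    same-center m m' (inj₁ refl) = cong (_ ,_) (center-unique (proj₂ (∈-centers⁻ m)) (proj₂ (∈-centers⁻ m')))
    same-center m m' (inj₂ refl) with lt , c ← ∈-centers⁻ m | lt' , c' ← ∈-centers⁻ m' with center-unique (center-sym c) c'
    ... | refl = contradiction (<-trans lt lt') (<-irrefl refl)

    same-hub : ∀ {i j v} → i ∈ₗ centers → j ∈ₗ centers → v ≡ proj₁ i ⊎ v ≡ proj₂ i → v ≡ proj₁ j ⊎ v ≡ proj₂ j → i ≡ j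
    same-hub m m' p (inj₁ refl) = same-center m m' p
    same-hub m m' (inj₁ refl) (inj₂ q) = sym (same-center m' m (inj₂ q))
    same-hub m m' (inj₂ refl) (inj₂ refl) with lt , c ← ∈-centers⁻ m | lt' , c' ← ∈-centers⁻ m' with center-unique (center-sym c) (center-sym c')
    ... | refl = refl

    -- An edge at a common spoke contains a', so a' lies in the first star. It is not a spoke there,
    -- hence one of a, b, and the centres coincide.
    spokes-disjoint : ∀ {i j x} → i ∈ₗ centers → j ∈ₗ centers → Spoke i x → Spoke j x → i ≡ j
    spokes-disjoint {a , b} {a' , b'} {x} m m' s s'@((xa' , xb') , any-x , al') with e , me , xe ← find any-x
      with touch⇒inside (proj₂ (∈-centers⁻ m)) me (x , xe , s) (All.lookup al' me xe)
    ... | inj₁ p = same-center m m' (inj₁ p)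
    ... | inj₂ (inj₁ p) = same-center m m' (inj₂ p)
    ... | inj₂ (inj₂ s'') = contradiction s'' (center-not-spoke (proj₂ (∈-centers⁻ m)) (proj₂ (∈-centers⁻ m')))

    touch-disjoint : ∀ {i j e} → i ∈ₗ centers → j ∈ₗ centers → e ∈ₗ E → Touch i e → Touch j e → i ≡ j
    touch-disjoint {a , b} {a' , b'} m m' me t (x' , xe' , s') with touch⇒inside (proj₂ (∈-centers⁻ m)) me t xe'
    ... | inj₁ refl = contradiction s' (center-not-spoke (proj₂ (∈-centers⁻ m')) (proj₂ (∈-centers⁻ m)))
    ... | inj₂ (inj₁ refl) = contradiction s' (center-not-spoke (proj₂ (∈-centers⁻ m')) (center-sym (proj₂ (∈-centers⁻ m))))
    ... | inj₂ (inj₂ s) = spokes-disjoint m m' s s'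

  AnySpoke : Fin n → Set
  AnySpoke v = Any (λ i → Spoke i v) centers

  anySpoke? : ∀ v → Dec (AnySpoke v)
  anySpoke? v = Any.any? (λ i → spoke? i v) centers

  -- The outside vertices include the centres.
  W? : ∀ v → Dec (¬ AnySpoke v)
  W? v = ¬? (anySpoke? v)

  anyTouch? : ∀ e → Dec (Any (λ i → Touch i e) centers)
  anyTouch? e = Any.any? (λ i → touch? i e) centers

  RestE : List (Subset n)
  RestE = filter (λ e → ¬? (anyTouch? e)) E

  opaque
    vertex-count : Σ[ X ] centers + # W? V ≡ n
    vertex-count = trans (cong (_+ # W? V) (Σ-#-any spoke? centers-unique V λ m m' _ → spokes-disjoint m m'))
      (trans (#-compl anySpoke? V) (length-tabulate (λ i → i)))

    edge-count : Σ[ ed ] centers + length RestE ≡ length E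
    edge-count = trans (cong₂ _+_ (Σ-#-any touch? centers-unique E λ m m' me → touch-disjoint m m' me) (sym (#-length _ E)))
      (#-compl anyTouch? E)

    -- Different centres are disjoint pairs and no centre vertex is a spoke. Thus a bound on the
    -- outside bounds the number of stars.
    centers-outside : 2 * length centers ≤ # W? V
    centers-outside = ≤-trans (≤-reflexive (sym pairs)) (#-mono _ W? V λ { _ p (q) → bad (find p) (find q) })
      where
      P? : ∀ (i : Fin n × Fin n) v → Dec (v ≡ proj₁ i ⊎ v ≡ proj₂ i)
      P? i v = (v ≟F proj₁ i) ⊎-dec (v ≟F proj₂ i)
      two : ∀ {i} → i ∈ₗ centers → # (P? i) V ≡ 2
      two {a , b} m = trans (#-remove _≟F_ (P? (a , b)) V-unique v∈V (inj₁ refl))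
        (cong suc (trans (#-remove _≟F_ (λ v → P? (a , b) v ×-dec ¬? (v ≟F a)) V-unique v∈V (inj₂ refl , proj₁ (proj₂ (∈-centers⁻ m)) ∘ sym))
        (cong suc (#-none _ V λ { _ ((inj₁ p , q) , r) → q p ; _ ((inj₂ p , q) , r) → r p }))))
      const2 : ∀ (is : List (Fin n × Fin n)) → (∀ {i} → i ∈ₗ is → # (P? i) V ≡ 2) → Σ[ (λ i → # (P? i) V) ] is ≡ 2 * length is
      const2 [] h = refl
      const2 (i ∷ is) h = trans (cong₂ _+_ (h (here refl)) (const2 is (h ∘ there))) (sym (*-suc 2 (length is)))
      pairs : # (λ v → Any.any? (λ i → P? i v) centers) V ≡ 2 * length centers
      pairs = trans (sym (Σ-#-any P? centers-unique V λ m m' _ → same-hub m m')) (const2 centers two)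
      bad : ∀ {v} → (∃ λ i → i ∈ₗ centers × (v ≡ proj₁ i ⊎ v ≡ proj₂ i)) → (∃ λ i → i ∈ₗ centers × Spoke i v) → ⊥
      bad ((a , b) , m , inj₁ refl) ((a' , b') , m' , s) = center-not-spoke (proj₂ (∈-centers⁻ m')) (proj₂ (∈-centers⁻ m)) s
      bad ((a , b) , m , inj₂ refl) ((a' , b') , m' , s) = center-not-spoke (proj₂ (∈-centers⁻ m')) (center-sym (proj₂ (∈-centers⁻ m))) s

    rest-supp : ∀ {e v} → e ∈ₗ RestE → v ∈ e → ¬ AnySpoke v
    rest-supp {e} {v} m ve s with i , mi , si ← find s = proj₂ (filtered (λ e → ¬? (anyTouch? e)) E m) (lose mi (v , ve , si))

    -- A sunflower in the remainder over a triple of degree at least 4 would make {a, b} a centre of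
    -- the whole family with hub c. Then c is a spoke, but it lies on an edge of the remainder.
    rest-light : Light RestE
    rest-light {a} {b} {c} d@(ab , ac , bc) le s = go (<-cmp (Fin.toℕ a) (Fin.toℕ b))
      where
      C : Center a b
      C = sun⇒center d (≤-trans le (sub-mono _ _ E)) (sub-sun (proj₁ ∘ filtered (λ e → ¬? (anyTouch? e)) E) s)
      h : Hub a b c
      h = (ac ∘ sym , bc ∘ sym) , ≤-trans le (sub-mono _ _ E)
      h' : Hub b a c
      h' = (bc ∘ sym , ac ∘ sym) , ≤-trans (proj₂ h) (#-mono (has₃? a b c) (has₃? b a c) E λ _ (p , q , r) → q , p , r)
      spoke-⊥ : ¬ AnySpoke c
      spoke-⊥ with e , m , _ , _ , ce ← #-∃ (has₃? a b c) RestE (≤-trans (s≤s z≤n) le) = rest-supp m ce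
      go : Tri (Fin.toℕ a < Fin.toℕ b) (Fin.toℕ a ≡ Fin.toℕ b) (Fin.toℕ b < Fin.toℕ a) → ⊥
      go (tri< lt _ _) = spoke-⊥ (lose (∈-centers⁺ lt C) (hub-spoke C h))
      go (tri≈ _ eq _) = ab (toℕ-injective eq)
      go (tri> _ _ gt) = spoke-⊥ (lose (∈-centers⁺ gt (center-sym C)) (hub-spoke (center-sym C) h'))

    rest-family : Family RestE
    rest-family = subfamily _ F

  rest : Rest RestE W?
  rest = rest-bounds rest-family rest-light W? rest-supp

-- Numerical inequalities

infixl 6 _⊕_
infixl 7 _⊗_ _⊛_

_⊕_ : ∀ {a b c d} → a ≤ b → c ≤ d → a + c ≤ b + d
_⊕_ = +-mono-≤

_⊗_ : ∀ k {a b} → a ≤ b → k * a ≤ k * b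
k ⊗ h = *-monoʳ-≤ k h

_⊛_ : ∀ {a b} → a ≤ b → ∀ k → a * k ≤ b * k
h ⊛ k = *-monoˡ-≤ k h

-- An inequality follows from a nonnegative combination L ≤ R of hypotheses and a ring identity exhibiting the slack s.
refute : ∀ {L R s} → L ≤ R → L ≡ R + suc s → ⊥
refute {L} {R} h eq = m+1+n≰m R (≤-trans (≤-reflexive (sym eq)) h)

conclude : ∀ {x y L R s} → L ≤ R → x + R + s ≡ y + L → x ≤ y
conclude {x} {y} {L} {R} {s} h eq = +-cancelʳ-≤ R x y (≤-trans (m≤m+n (x + R) s) (≤-trans (≤-reflexive eq) (+-monoʳ-≤ y h)))

-- The inequality (b - a)(d - c) ≥ 0, written without subtraction.
cross : ∀ {a b c d} → a ≤ b → c ≤ d → a * d + b * c ≤ a * c + b * d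
cross {a} {b} {c} {d} ab cd with k , refl ← m≤n⇒∃[o]m+o≡n ab | l , refl ← m≤n⇒∃[o]m+o≡n cd =
  conclude (z≤n {k * l}) (eq a k c l)
  where
  eq : ∀ a k c l → a * (c + l) + (a + k) * c + k * l + 0 ≡ a * c + (a + k) * (c + l) + 0
  eq = solve-∀

2xy≤x²+y² : ∀ x y → 2 * (x * y) ≤ x * x + y * y
2xy≤x²+y² x y with ≤-total x y
... | inj₁ h = conclude (cross h h) (eq x y)
  where
  eq : ∀ x y → 2 * (x * y) + (x * x + y * y) + 0 ≡ x * x + y * y + (x * y + y * x)
  eq = solve-∀
... | inj₂ h = conclude (cross h h) (eq x y)
  where
  eq : ∀ x y → 2 * (x * y) + (y * y + x * x) + 0 ≡ x * x + y * y + (y * x + x * y)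
  eq = solve-∀

tri : ℕ → ℕ
tri zero = 0
tri (suc k) = k + tri k

tri-double : ∀ k → 2 * tri k + k ≡ k * k
tri-double zero = refl
tri-double (suc k) = trans (eq k (tri k)) (trans (cong (λ z → 1 + 2 * k + z) (tri-double k)) (eq′ k))
  where
  eq′ : ∀ k → 1 + 2 * k + k * k ≡ suc k * suc k
  eq′ = solve-∀
  eq : ∀ k t → 2 * (k + t) + suc k ≡ 1 + 2 * k + (2 * t + k)
  eq = solve-∀

tri-≥ : ∀ k → k * k ≤ 2 * tri k + k
tri-≥ k = ≤-reflexive (sym (tri-double k))

tri-mono : ∀ {j k} → j ≤ k → tri j ≤ tri k
tri-mono z≤n = z≤n
tri-mono (s≤s h) = +-mono-≤ h (tri-mono h)

Bound₁ Bound₂ : ℕ → ℕ → ℕ → Set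
Bound₁ ρ ℓ H = 8 * ρ + 2 * H ≤ 90 * ℓ + H * (H + 3 * ℓ)
Bound₂ ρ ℓ H = 8 * ρ + 2 * H ≤ 360 * ℓ + H * H

-- Up to lower-order terms this is w² - 4τw + τ² ≥ 0: w lies outside the interval from (2 - √3)τ to
-- (2 + √3)τ.
Packable : ℕ → ℕ → Set
Packable τ w = 4 * (τ * w) + 8 ≤ τ * τ + τ * 48 + w * 360 + w * w

opaque

  -- If 4τ ≤ n, the stars satisfy 8S ≤ ny. What remains of n² after removing ny and H² is y(ℓ + H) +
  -- ℓ² + 2ℓH, and only linear terms are left against it.
  mixed : ∀ y ℓ H τ S ρ → 2 * S ≤ τ * y → (y + (ℓ + H)) * (y + (ℓ + H)) + 11 ≤ 8 * (S + ρ) + 4 * (y + (ℓ + H)) → Bound₂ ρ ℓ H → 4 * τ ≤ (y + (ℓ + H)) →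
      y * (ℓ + H) + ℓ * ℓ + 2 * (ℓ * H) + 11 ≤ ℓ * 364 + 4 * y + 2 * H
  mixed y ℓ H τ S ρ hS hm hb h4 = conclude (hm ⊕ hb ⊕ hS ⊛ 4 ⊕ h4 ⊛ y) (eq y ℓ H τ S ρ)
    where
    eq : ∀ y ℓ H τ S ρ →
      y * (ℓ + H) + ℓ * ℓ + 2 * (ℓ * H) + 11 + ((8 * (S + ρ) + 4 * (y + (ℓ + H))) + (360 * ℓ + H * H) + τ * y * 4 + (y + (ℓ + H)) * y) + (0)
      ≡ ℓ * 364 + 4 * y + 2 * H + (((y + (ℓ + H)) * (y + (ℓ + H)) + 11) + (8 * ρ + 2 * H) + 2 * S * 4 + 4 * τ * y)
    eq = solve-∀

  outside≤4 : ∀ y ℓ H → 5 ≤ y → 200000 ≤ (y + (ℓ + H)) → y * (ℓ + H) + ℓ * ℓ + 2 * (ℓ * H) + 11 ≤ ℓ * 364 + 4 * y + 2 * H → ℓ + H ≤ 4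
  outside≤4 y ℓ H hy hN h with ℓ + H ≤? 4
  ... | yes p = p
  ... | no ¬p with 364 ≤? ℓ + H
  ...   | yes q = ⊥-elim (refute (h ⊛ 10 ⊕ (y ⊗ q) ⊕ ((ℓ + H) ⊗ hy) ⊛ 9 ⊕ (ℓ ⊗ q) ⊛ 10) (eq y ℓ H))
      where
      eq : ∀ y ℓ H →
        (y * (ℓ + H) + ℓ * ℓ + 2 * (ℓ * H) + 11) * 10 + y * 364 + (ℓ + H) * 5 * 9 + ℓ * 364 * 10
        ≡ (ℓ * 364 + 4 * y + 2 * H) * 10 + y * (ℓ + H) + (ℓ + H) * y * 9 + ℓ * (ℓ + H) * 10 + suc (H * ℓ * 10 + H * 25 + y * 324 + ℓ * 45 + 109)
      eq = solve-∀

  ...   | no q = ⊥-elim (refute (h ⊕ (y ⊗ ≰⇒> ¬p) ⊕ ≤-pred (≰⇒> q) ⊛ 367 ⊕ hN) (eq y ℓ H))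
      where
      eq : ∀ y ℓ H →
        (y * (ℓ + H) + ℓ * ℓ + 2 * (ℓ * H) + 11) + y * 5 + (ℓ + H) * 367 + 200000
        ≡ (ℓ * 364 + 4 * y + 2 * H) + y * (ℓ + H) + 363 * 367 + (y + (ℓ + H)) + suc (H * ℓ * 2 + ℓ * ℓ + H * 364 + ℓ * 2 + 66789)
      eq = solve-∀

  -- Four outside vertices leave room for two stars. With 4τ ≤ n these have about n²/16 edges at
  -- most, while about n²/8 are needed.
  few-stars : ∀ n ℓ H τ S ρ c → 200000 ≤ n → ℓ + H ≤ 4 → S ≤ 2 * suc c → 2 * suc c ≤ suc τ * τ → 4 * τ ≤ n → Bound₂ ρ ℓ H → n * n + 11 ≤ 8 * (S + ρ) + 4 * n → ⊥
  few-stars n ℓ H τ S ρ c hN hw hc h2 h4 hb hm = refute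
    (hm ⊛ 2 ⊕ hc ⊛ 16 ⊕ h2 ⊛ 16 ⊕ *-mono-≤ h4 h4 ⊕ h4 ⊛ 4 ⊕ hb ⊛ 2 ⊕ (H ⊗ hw) ⊛ 2 ⊕ (n ⊗ hN) ⊕ hw ⊛ 728 ⊕ hN) (eq n ℓ H τ S ρ c)
    where
    eq : ∀ n ℓ H τ S ρ c →
      (n * n + 11) * 2 + S * 16 + 2 * (1 + c) * 16 + (4 * τ) * (4 * τ) + 4 * τ * 4 + (8 * ρ + 2 * H) * 2 + H * (ℓ + H) * 2 + n * 200000 + (ℓ + H) * 728 + 200000
      ≡ (8 * (S + ρ) + 4 * n) * 2 + 2 * (1 + c) * 16 + (1 + τ) * τ * 16 + n * n + n * 4 + (360 * ℓ + H * H) * 2 + H * 4 * 2 + n * n + 4 * 728 + n + suc (H * ℓ * 2 + H * 724 + n * 199987 + ℓ * 8 + 197109)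
    eq = solve-∀

  -- The competitor uses all n vertices: k stars with τ spokes and one with r. Eliminating n leaves
  -- 4τr - 4r², which is at most τ².
  packing : ∀ k τ r y ℓ H S ρ → k ≤ 3 → r ≤ τ → y + (ℓ + H) ≡ k * (τ + 2) + (r + 2) → suc (k * tri τ + tri r) ≤ S + ρ → 2 * S ≤ τ * y → Bound₂ ρ ℓ H →
      Packable τ (ℓ + H)
  packing k τ r y ℓ H S ρ hk hr hn hs hS hb = conclude
    (hs ⊛ 8 ⊕ hS ⊛ 4 ⊕ hb ⊕ tri-≥ τ ⊛ (4 * k) ⊕ tri-≥ r ⊛ 4 ⊕ ≤-reflexive hn ⊛ (4 * τ) ⊕ hr ⊛ 4 ⊕ 2xy≤x²+y² τ (2 * r) ⊕ (τ * 12) ⊗ hk) (eq k τ r y ℓ H S ρ (tri τ) (tri r))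
    where
    eq : ∀ k τ r y ℓ H S ρ T t →
      4 * (τ * (ℓ + H)) + 8 + ((S + ρ) * 8 + τ * y * 4 + (360 * ℓ + H * H) + (2 * T + τ) * (4 * k) + (2 * t + r) * 4 + (k * (τ + 2) + (r + 2)) * (4 * τ) + τ * 4 + (τ * τ + (2 * r) * (2 * r)) + τ * 12 * 3) + (H * ℓ * 2 + ℓ * ℓ + H * 362)
      ≡ τ * τ + τ * 48 + (ℓ + H) * 360 + (ℓ + H) * (ℓ + H) + ((1 + (k * T + t)) * 8 + 2 * S * 4 + (8 * ρ + 2 * H) + τ * τ * (4 * k) + r * r * 4 + (y + (ℓ + H)) * (4 * τ) + r * 4 + 2 * (τ * (2 * r)) + τ * 12 * k)
    eq = solve-∀

  -- The case in which the division leaves at most one vertex, too few for a further centre.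
  packing′ : ∀ k τ r y ℓ H S ρ → k ≤ 3 → r ≤ 1 → y + (ℓ + H) ≡ k * (τ + 2) + r → suc (k * tri τ) ≤ S + ρ → 2 * S ≤ τ * y → Bound₂ ρ ℓ H →
      Packable τ (ℓ + H)
  packing′ k τ r y ℓ H S ρ hk hr hn hs hS hb = conclude
    (hs ⊛ 8 ⊕ hS ⊛ 4 ⊕ hb ⊕ tri-≥ τ ⊛ (4 * k) ⊕ ≤-reflexive hn ⊛ (4 * τ) ⊕ (τ * 12) ⊗ hk ⊕ (4 * τ) ⊗ hr) (eq k τ r y ℓ H S ρ (tri τ))
    where
    eq : ∀ k τ r y ℓ H S ρ T →
      4 * (τ * (ℓ + H)) + 8 + ((S + ρ) * 8 + τ * y * 4 + (360 * ℓ + H * H) + (2 * T + τ) * (4 * k) + (k * (τ + 2) + r) * (4 * τ) + τ * 12 * 3 + 4 * τ * 1) + (H * ℓ * 2 + τ * τ + ℓ * ℓ + H * 362 + τ * 8)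
      ≡ τ * τ + τ * 48 + (ℓ + H) * 360 + (ℓ + H) * (ℓ + H) + ((1 + k * T) * 8 + 2 * S * 4 + (8 * ρ + 2 * H) + τ * τ * (4 * k) + (y + (ℓ + H)) * (4 * τ) + τ * 12 * k + 4 * τ * r)
    eq = solve-∀

  -- The values 0.3 and 3.7 lie just inside the roots 2 - √3 and 2 + √3; at both the quadratic is
  -- -0.11 τ², which absorbs the linear terms for large τ.
  outside-dichotomy : ∀ τ ℓ H → 50001 ≤ τ → Packable τ (ℓ + H) → 10 * (ℓ + H) ≤ 3 * τ ⊎ 37 * τ ≤ 10 * (ℓ + H)
  outside-dichotomy τ ℓ H hτ h with 10 * (ℓ + H) ≤? 3 * τ | 37 * τ ≤? 10 * (ℓ + H)
  ... | yes p | _ = inj₁ p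
  ... | no _ | yes q = inj₂ q
  ... | no p | no q = ⊥-elim (refute (h ⊛ 100 ⊕ cross (≰⇒≥ p) (≰⇒≥ q) ⊕ ≰⇒≥ q ⊛ 3600 ⊕ (τ * 11) ⊗ hτ) (eq τ ℓ H))
    where
    eq : ∀ τ ℓ H →
      (4 * (τ * (ℓ + H)) + 8) * 100 + (3 * τ * (37 * τ) + 10 * (ℓ + H) * (10 * (ℓ + H))) + 10 * (ℓ + H) * 3600 + τ * 11 * 50001
      ≡ (τ * τ + τ * 48 + (ℓ + H) * 360 + (ℓ + H) * (ℓ + H)) * 100 + (3 * τ * (10 * (ℓ + H)) + 10 * (ℓ + H) * (37 * τ)) + 37 * τ * 3600 + τ * 11 * τ + suc (τ * 412011 + 799)
    eq = solve-∀

  -- The second alternative would give 8S ≤ 4τy ≤ (40/37)wy, whereas n² contains 2wy in addition to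
  -- y² and w².
  not-nearly-all : ∀ y ℓ H τ S ρ → 5 ≤ y → 50001 ≤ τ → 37 * τ ≤ 10 * (ℓ + H) → 2 * S ≤ τ * y → (y + (ℓ + H)) * (y + (ℓ + H)) + 11 ≤ 8 * (S + ρ) + 4 * (y + (ℓ + H)) → Bound₂ ρ ℓ H → ⊥
  not-nearly-all y ℓ H τ S ρ hy hτ hw hS hm hb = refute
    (hm ⊛ 37 ⊕ hb ⊛ 37 ⊕ hS ⊛ 148 ⊕ hw ⊛ (4 * y) ⊕ (y ⊗ hy) ⊛ 37 ⊕ ((ℓ + H) ⊗ hy) ⊛ 34 ⊕ (ℓ ⊗ big) ⊛ 37) (eq y ℓ H τ S ρ)
    where
    eq : ∀ y ℓ H τ S ρ →
      ((y + (ℓ + H)) * (y + (ℓ + H)) + 11) * 37 + (8 * ρ + 2 * H) * 37 + 2 * S * 148 + 37 * τ * (4 * y) + y * 5 * 37 + (ℓ + H) * 5 * 34 + ℓ * 364 * 37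
      ≡ (8 * (S + ρ) + 4 * (y + (ℓ + H))) * 37 + (360 * ℓ + H * H) * 37 + τ * y * 148 + 10 * (ℓ + H) * (4 * y) + y * y * 37 + (ℓ + H) * y * 34 + ℓ * (ℓ + H) * 37 + suc (H * ℓ * 37 + H * 96 + y * 37 + ℓ * 170 + 406)
    eq = solve-∀
    big : 364 ≤ ℓ + H
    big = *-cancelˡ-≤ 10 (≤-trans (≤-trans (m≤m+n 3640 1846397) (37 ⊗ hτ)) hw)

  residue-small : ∀ ℓ H ρ → ℓ + H ≤ 8 → Bound₁ ρ ℓ H → ¬ 471 ≤ ρ
  residue-small ℓ H ρ hw hb h = refute (hb ⊕ (H ⊗ hw) ⊛ 3 ⊕ h ⊛ 8 ⊕ hw ⊛ 90) (eq ℓ H ρ)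
    where
    eq : ∀ ℓ H ρ →
      (8 * ρ + 2 * H) + H * (ℓ + H) * 3 + 471 * 8 + (ℓ + H) * 90
      ≡ (90 * ℓ + H * (H + 3 * ℓ)) + H * 8 * 3 + ρ * 8 + 8 * 90 + suc (H * H * 2 + H * 68 + 3047)
    eq = solve-∀

  -- For fixed w the term H(H + 3ℓ) is at most 9w²/8, so `Bound₁` allows about 9w²/64 edges. A star
  -- on nearly the same vertices has about w²/2, which confines w and with it ρ.
  residue-large : ∀ ℓ H ρ k → ℓ + H ≡ k + 8 → Bound₁ ρ ℓ H → tri k ≤ ρ + 2 → ¬ 471 ≤ ρ
  residue-large ℓ H ρ k hw hb ht h = refute
    (hb ⊛ 2 ⊕ ht ⊛ 8 ⊕ tri-≥ k ⊛ 4 ⊕ ≤-reflexive (cong (λ z → z * z) hw) ⊛ 4 ⊕ ≤-reflexive (sym hw) ⊛ 68 ⊕ 2xy≤x²+y² ℓ 31 ⊛ 3 ⊕ 2xy≤x²+y² (ℓ + H) 31 ⊕ 2xy≤x²+y² H 1 ⊕ h ⊛ 8) (eq ℓ H ρ k (tri k))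
    where
    eq : ∀ ℓ H ρ k t →
      (8 * ρ + 2 * H) * 2 + t * 8 + k * k * 4 + (ℓ + H) * (ℓ + H) * 4 + (k + 8) * 68 + 2 * (ℓ * 31) * 3 + 2 * ((ℓ + H) * 31) + 2 * (H * 1) + 471 * 8
      ≡ (90 * ℓ + H * (H + 3 * ℓ)) * 2 + (ρ + 2) * 8 + (2 * t + k) * 4 + (k + 8) * (k + 8) * 4 + (ℓ + H) * 68 + (ℓ * ℓ + 31 * 31) * 3 + ((ℓ + H) * (ℓ + H) + 31 * 31) + (H * H + 1 * 1) + ρ * 8 + suc (194)
    eq = solve-∀

  -- For s ≥ 20 the product of s and g together with the joining term x(s + g), where x ≥ 5, exceeds
  -- what `Bound₁` grants to g + 8 outside vertices.
  residue-spokes : ∀ ℓ H ρ s g x D → ℓ + H ≡ g + 8 → 5 ≤ x → 2 * D + s ≤ s * s → Bound₁ ρ ℓ H → tri (s + g) + x * (s + g) ≤ D + ρ + 2 → s ≤ 19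
  residue-spokes ℓ H ρ s g x D hw hx hD hb hs = case
    where
    case : s ≤ 19
    case with s ≤? 19
    ... | yes p = p
    ... | no ¬p = ⊥-elim (refute
      (hs ⊛ 8 ⊕ tri-≥ (s + g) ⊛ 4 ⊕ hD ⊛ 4 ⊕ hb ⊕ (g ⊗ ≰⇒> ¬p) ⊛ 8 ⊕ ≤-reflexive (cong (λ z → z * z) hw) ⊛ 4 ⊕ ≤-reflexive hw ⊛ 132 ⊕ ≤-reflexive (sym hw) ⊛ 106 ⊕ 2xy≤x²+y² ℓ 8 ⊛ 4 ⊕ ((s + g) * 8) ⊗ hx ⊕ ≰⇒> ¬p ⊛ 40) (eq ℓ H ρ s g x D (tri (s + g))))
      where
      eq : ∀ ℓ H ρ s g x D t →
        (t + x * (s + g)) * 8 + (s + g) * (s + g) * 4 + (2 * D + s) * 4 + (8 * ρ + 2 * H) + g * 20 * 8 + (ℓ + H) * (ℓ + H) * 4 + (ℓ + H) * 132 + (g + 8) * 106 + 2 * (ℓ * 8) * 4 + (s + g) * 8 * 5 + 20 * 40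
        ≡ (D + ρ + 2) * 8 + (2 * t + (s + g)) * 4 + s * s * 4 + (90 * ℓ + H * (H + 3 * ℓ)) + g * s * 8 + (g + 8) * (g + 8) * 4 + (g + 8) * 132 + (ℓ + H) * 106 + (ℓ * ℓ + 8 * 8) * 4 + (s + g) * 8 * x + s * 40 + suc (H * H * 3 + H * ℓ * 5 + H * 28 + g * 106 + 63)
      eq = solve-∀

  -- The left side of the last hypothesis is the gain in edges when a full star with x spokes
  -- receives s + g more. The bound s ≤ 19 controls the quadratic term in s that D brings in.
  residue-merged : ∀ ℓ H ρ s g x D → ℓ + H ≡ g + 8 → 5 ≤ x → 2 * D + s ≤ s * s → Bound₁ ρ ℓ H → tri (s + g) + x * (s + g) ≤ D + ρ + 2 → ¬ 471 ≤ D + ρ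
  residue-merged ℓ H ρ s g x D hw hx hD hb hs h = refute
    (hs ⊛ 128 ⊕ tri-≥ (s + g) ⊛ 64 ⊕ hD ⊛ 96 ⊕ hb ⊛ 24 ⊕ ≤-reflexive (cong (λ z → z * z) hw) ⊛ 64 ⊕ ≤-reflexive (sym hw) ⊛ 448 ⊕ 2xy≤x²+y² (8 * ℓ) 163 ⊕ 2xy≤x²+y² H 5 ⊛ 40 ⊕ ((s + g) * 128) ⊗ hx ⊕ h ⊛ 64 ⊕ (s * 32) ⊗ residue-spokes ℓ H ρ s g x D hw hx hD hb hs) (eq ℓ H ρ s g x D (tri (s + g)))
    where
    eq : ∀ ℓ H ρ s g x D t →
      (t + x * (s + g)) * 128 + (s + g) * (s + g) * 64 + (2 * D + s) * 96 + (8 * ρ + 2 * H) * 24 + (ℓ + H) * (ℓ + H) * 64 + (g + 8) * 448 + 2 * (8 * ℓ * 163) + 2 * (H * 5) * 40 + (s + g) * 128 * 5 + 471 * 64 + s * 32 * s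
      ≡ (D + ρ + 2) * 128 + (2 * t + (s + g)) * 64 + s * s * 96 + (90 * ℓ + H * (H + 3 * ℓ)) * 24 + (g + 8) * (g + 8) * 64 + (ℓ + H) * 448 + (8 * ℓ * (8 * ℓ) + 163 * 163) + (H * H + 5 * 5) * 40 + (s + g) * 128 * x + (D + ρ) * 64 + s * 32 * 19 + suc (H * ℓ * 56 + g * s * 128 + s * 64 + 1806)
    eq = solve-∀

  -- Up to 1250 edges, the smaller stars and the residue together do no better than a complete graph
  -- on s + g vertices: the density 9/64 of `Bound₁` is below 1/2, and the constant covers small w.
  residue-turán : ∀ ℓ H ρ s g D → ℓ + H ≡ g + 10 → 2 * D + s ≤ s * s → Bound₁ ρ ℓ H → 2 * (D + ρ) + (s + g) ≤ (s + g) * (s + g) + 2500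
  residue-turán ℓ H ρ s g D hw hD hb = *-cancelˡ-≤ 4 (conclude
    (hD ⊛ 4 ⊕ hb ⊕ ≤-reflexive (cong (λ z → z * z) hw) ⊛ 4 ⊕ ≤-reflexive (sym hw) ⊛ 84 ⊕ 2xy≤x²+y² (2 * ℓ) 44 ⊕ 2xy≤x²+y² H 14 ⊛ 3) (eq ℓ H ρ s g D))
    where
    eq : ∀ ℓ H ρ s g D →
      4 * (2 * (D + ρ) + (s + g)) + (s * s * 4 + (90 * ℓ + H * (H + 3 * ℓ)) + (g + 10) * (g + 10) * 4 + (ℓ + H) * 84 + (2 * ℓ * (2 * ℓ) + 44 * 44) + (H * H + 14 * 14) * 3) + (H * ℓ * 5 + g * s * 8 + H * 2 + ℓ * 2 + 7916)
      ≡ 4 * ((s + g) * (s + g) + 2500) + ((2 * D + s) * 4 + (8 * ρ + 2 * H) + (ℓ + H) * (ℓ + H) * 4 + (g + 10) * 84 + 2 * (2 * ℓ * 44) + 2 * (H * 14) * 3)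
    eq = solve-∀

  -- A single star gains xp + x + p over two complete graphs on x and p vertices, far more than the
  -- 1252 edges of tolerance.
  exchange-exact : ∀ x p Y → 50001 ≤ x + p + 1 → 2 * Y + p ≤ p * p + 2500 → ¬ tri (x + p + 1) ≤ tri x + Y + 2
  exchange-exact x p Y hτ hY hs = refute (hs ⊛ 2 ⊕ tri-≥ (x + p + 1) ⊕ ≤-reflexive (tri-double x) ⊕ hY ⊕ hτ) (eq x p Y (tri (x + p + 1)) (tri x))
    where
    eq : ∀ x p Y T t →
      T * 2 + (x + p + 1) * (x + p + 1) + (2 * t + x) + (2 * Y + p) + 50001
      ≡ (t + Y + 2) * 2 + (2 * T + (x + p + 1)) + x * x + (p * p + 2500) + (x + p + 1) + suc (p * x * 2 + p + x + 47495)
    eq = solve-∀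

  -- 1252 = 2500 / 2 + 2, where 2500 is the additive constant of residue-turán.
  exchange : ∀ τ x p z Y → x + 1 ≤ τ → τ + z ≡ x + p → p + 1253 ≤ τ → 2 * Y + p ≤ p * p + 2500 → ¬ tri τ + tri z ≤ tri x + Y + 2
  exchange τ x p z Y hx hz hp hY hs = refute
    (hs ⊛ 2 ⊕ tri-≥ τ ⊕ tri-≥ z ⊕ ≤-reflexive (tri-double x) ⊕ hY ⊕ ≤-reflexive (cong (λ v → v * v) (sym hz)) ⊕ ≤-reflexive hz ⊛ (2 * τ) ⊕ ≤-reflexive hz ⊕ cross hx hp ⊛ 2 ⊕ hx ⊛ 2506 ⊕ hp ⊛ 2) (eq τ x p z Y (tri τ) (tri z) (tri x))
    where
    eq : ∀ τ x p z Y T u t →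
      (T + u) * 2 + τ * τ + z * z + (2 * t + x) + (2 * Y + p) + (x + p) * (x + p) + (τ + z) * (2 * τ) + (τ + z) + ((x + 1) * τ + τ * (p + 1253)) * 2 + (x + 1) * 2506 + (p + 1253) * 2
      ≡ (t + Y + 2) * 2 + (2 * T + τ) + (2 * u + z) + x * x + (p * p + 2500) + (τ + z) * (τ + z) + (x + p) * (2 * τ) + (x + p) + ((x + 1) * (p + 1253) + τ * τ) * 2 + τ * 2506 + τ * 2 + suc (1)
    eq = solve-∀

  -- In units of τ², with τ = q + 1252: x is at most τ - o/4, so D is at most (τo - o²/4)/2, which
  -- is below 0.47 for o ≤ 3τ/2. The residue adds at most 0.09/8, still short of the 1/2 of a star
  -- with q spokes.
  big-residue₁ : ∀ ℓ H ρ D x s o q → 98749 ≤ q → 2 * D ≤ x * s → Bound₂ ρ ℓ H → s ≤ o → 4 * x + o + 9 ≤ 4 * (q + 1252) → 10 * (ℓ + H) ≤ 3 * (q + 1252) → 2 * o ≤ 3 * (q + 1252) → ¬ tri q ≤ D + ρ + 3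
  big-residue₁ ℓ H ρ D x s o q hq hD hb hso hx hw ho hs = refute
    (hs ⊛ 800 ⊕ tri-≥ q ⊛ 400 ⊕ hD ⊛ 400 ⊕ hb ⊛ 100 ⊕ hso ⊛ (x * 400) ⊕ hx ⊛ (o * 100) ⊕ *-mono-≤ hw hw ⊕ hw ⊛ 3600 ⊕ cross ho (≤-trans ho (*-monoˡ-≤ (q + 1252) (m≤m+n 3 2))) ⊛ 25 ⊕ (q * 16) ⊗ hq ⊕ hq ⊛ 40000) (eq ℓ H ρ D x s o q (tri q))
    where
    eq : ∀ ℓ H ρ D x s o q t →
      t * 800 + q * q * 400 + 2 * D * 400 + (8 * ρ + 2 * H) * 100 + s * (x * 400) + (4 * x + o + 9) * (o * 100) + 10 * (ℓ + H) * (10 * (ℓ + H)) + 10 * (ℓ + H) * 3600 + (2 * o * (5 * (q + 1252)) + 3 * (q + 1252) * (2 * o)) * 25 + q * 16 * 98749 + 98749 * 40000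
      ≡ (D + ρ + 3) * 800 + (2 * t + q) * 400 + x * s * 400 + (360 * ℓ + H * H) * 100 + o * (x * 400) + 4 * (q + 1252) * (o * 100) + 3 * (q + 1252) * (3 * (q + 1252)) + 3 * (q + 1252) * 3600 + (2 * o * (2 * o) + 3 * (q + 1252) * (5 * (q + 1252))) * 25 + q * 16 * q + q * 40000 + suc (H * ℓ * 200 + ℓ * ℓ * 100 + H * 36200 + o * 900 + q * 567248 + 3334514463)
    eq = solve-∀

  -- Without an upper bound on o the estimate for D reaches 1/2 at o = 2τ, and one star no longer
  -- wins. A second star with τ/4 spokes adds 1/32, more than the 0.09/8 of the residue.
  big-residue₂ : ∀ ℓ H ρ D x s o q a → 98749 ≤ q → 2 * D ≤ x * s → Bound₂ ρ ℓ H → s ≤ o → 4 * x + o + 9 ≤ 4 * (q + 1252) → 10 * (ℓ + H) ≤ 3 * (q + 1252) → (q + 1252) ≤ 4 * a + 3 → 4 * a ≤ (q + 1252) → ¬ tri q + tri a ≤ D + ρ + 3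
  big-residue₂ ℓ H ρ D x s o q a hq hD hb hso hx hw ha ha' hs = refute
    (hs ⊛ 800 ⊕ tri-≥ q ⊛ 400 ⊕ tri-≥ a ⊛ 400 ⊕ hD ⊛ 400 ⊕ hb ⊛ 100 ⊕ hso ⊛ (x * 400) ⊕ hx ⊛ (o * 100) ⊕ *-mono-≤ hw hw ⊕ hw ⊛ 3600 ⊕ 2xy≤x²+y² o (2 * (q + 1252)) ⊛ 100 ⊕ *-mono-≤ ha ha ⊛ 25 ⊕ ha' ⊛ 250 ⊕ (q * 16) ⊗ hq ⊕ hq ⊛ 40000) (eq ℓ H ρ D x s o q a (tri q) (tri a))
    where
    eq : ∀ ℓ H ρ D x s o q a t u →
      (t + u) * 800 + q * q * 400 + a * a * 400 + 2 * D * 400 + (8 * ρ + 2 * H) * 100 + s * (x * 400) + (4 * x + o + 9) * (o * 100) + 10 * (ℓ + H) * (10 * (ℓ + H)) + 10 * (ℓ + H) * 3600 + 2 * (o * (2 * (q + 1252))) * 100 + (q + 1252) * (q + 1252) * 25 + 4 * a * 250 + q * 16 * 98749 + 98749 * 40000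
      ≡ (D + ρ + 3) * 800 + (2 * t + q) * 400 + (2 * u + a) * 400 + x * s * 400 + (360 * ℓ + H * H) * 100 + o * (x * 400) + 4 * (q + 1252) * (o * 100) + 3 * (q + 1252) * (3 * (q + 1252)) + 3 * (q + 1252) * 3600 + (o * o + 2 * (q + 1252) * (2 * (q + 1252))) * 100 + (4 * a + 3) * (4 * a + 3) * 25 + (q + 1252) * 250 + q * 16 * q + q * 40000 + suc (H * ℓ * 200 + ℓ * ℓ * 100 + H * 36200 + o * 900 + q * 566998 + 3334201238)
    eq = solve-∀

-- Comparing a star decomposition with other unions of stars

Σ-++ : ∀ (f : A → ℕ) xs ys → Σ[ f ] (xs ++ ys) ≡ Σ[ f ] xs + Σ[ f ] ys
Σ-++ f [] ys = refl
Σ-++ f (x ∷ xs) ys = trans (cong (f x +_) (Σ-++ f xs ys)) (sym (+-assoc (f x) _ _))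

Σ-replicate : ∀ (f : A → ℕ) k x → Σ[ f ] (replicate k x) ≡ k * f x
Σ-replicate f zero x = refl
Σ-replicate f (suc k) x = cong (f x +_) (Σ-replicate f k x)

Σ-map : ∀ {B : Set} (f : B → ℕ) (g : A → B) xs → Σ[ f ] (map g xs) ≡ Σ[ (λ x → f (g x)) ] xs
Σ-map f g [] = refl
Σ-map f g (x ∷ xs) = cong (f (g x) +_) (Σ-map f g xs)

Σ-const : ∀ k (xs : List A) → Σ[ (λ _ → k) ] xs ≡ k * length xs
Σ-const k [] = sym (*-zeroʳ k)
Σ-const k (x ∷ xs) = trans (cong (k +_) (Σ-const k xs)) (sym (*-suc k (length xs)))

Σ-squares : ∀ (f : A → ℕ) xs → Σ[ (λ x → f x * f x) ] xs ≤ Σ[ f ] xs * Σ[ f ] xs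
Σ-squares f [] = z≤n
Σ-squares f (x ∷ xs) = conclude (Σ-squares f xs) (eq (f x) _ _)
  where
  eq : ∀ a s q → a * a + q + s * s + 2 * (a * s) ≡ (a + s) * (a + s) + q
  eq = solve-∀

extract-max : ∀ (f : A → ℕ) xs → 1 ≤ length xs → ∃ λ x → ∃ λ r → xs ↭ x ∷ r × (∀ {z} → z ∈ₗ r → f z ≤ f x)
extract-max f (x ∷ []) _ = x , [] , refl , λ ()
extract-max f (x ∷ y ∷ zs) _ with extract-max f (y ∷ zs) (s≤s z≤n)
... | v , r , p , h with ≤-total (f v) (f x)
...   | inj₁ le = x , y ∷ zs , refl , λ m → aux (∈-resp-↭ p m)
  where
  aux : ∀ {z} → z ∈ₗ v ∷ r → f z ≤ f x
  aux (here refl) = le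
  aux (there m) = ≤-trans (h m) le
...   | inj₂ le = v , x ∷ r , ↭.trans (prep x p) (swap x v refl) , λ { (here refl) → le ; (there m) → h m }

tri-∸ : ∀ k → 2 * tri k ≡ (k ∸ 1) * k
tri-∸ zero = refl
tri-∸ (suc j) = +-cancelʳ-≡ (suc j) _ _ (trans (tri-double (suc j)) (eq j))
  where
  eq : ∀ j → suc j * suc j ≡ j * suc j + suc j
  eq = solve-∀

tri-inverse : ∀ c → ∃ λ τ → tri τ ≤ c × suc c ≤ tri (suc τ)
tri-inverse zero = 1 , z≤n , s≤s z≤n
tri-inverse (suc c) with τ , p , q ← tri-inverse c with suc (suc c) ≤? tri (suc τ)
... | yes r = τ , m≤n⇒m≤1+n p , r
... | no ¬r = suc τ , ≤-pred (≰⇒> ¬r) , s≤s (≤-trans q (m≤n+m _ τ))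

opaque
  remainder-≤ : ∀ τ x p z → τ + z ≡ x + p → p ≤ τ → z ≤ x
  remainder-≤ τ x p z eq h = +-cancelˡ-≤ τ z x (≤-trans (≤-reflexive eq) (≤-trans (+-monoʳ-≤ x h) (≤-reflexive (+-comm x τ))))

  spokes-fit : ∀ q p τ → q + 1252 ≡ τ → τ ≤ p + 1252 → q ≤ p
  spokes-fit q p τ eq h = +-cancelʳ-≤ 1252 q p (≤-trans (≤-reflexive eq) h)

  two-stars-fit : ∀ q a τ o → q + 1252 ≡ τ → 4 * a ≤ τ → 3 * τ ≤ 2 * o → q + 2 + (a + 2 + 0) ≤ o
  two-stars-fit q a τ o q-eq ha ho = *-cancelˡ-≤ 4 (conclude (ho ⊛ 2 ⊕ ha ⊕ ≤-reflexive q-eq ⊛ 4) (eq q a τ o))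
    where
    eq : ∀ q a τ o →
      4 * (q + 2 + (a + 2 + 0)) + (2 * o * 2 + τ + τ * 4) + (τ + 4992)
      ≡ 4 * o + (3 * τ * 2 + 4 * a + (q + 1252) * 4)
    eq = solve-∀

  spokes-large : ∀ q τ → q + 1252 ≡ τ → 100002 ≤ τ → 98749 ≤ q
  spokes-large q τ eq h = +-cancelʳ-≤ 1252 98749 q (≤-trans (n≤1+n 100001) (≤-trans h (≤-reflexive (sym eq))))

-- A star with x spokes is a graph on x vertices; with maximum degree c it has at most cap c x edges.
cap : ℕ → ℕ → ℕ
cap c x = tri x ⊓ c

-- Star i has `X i` spokes and `ed i` edges, ρ edges touch no star, w vertices are no spokes, and c
-- + 1 is the maximum degree. Minimality is present as `star`, and `hm2` expresses that m exceeds
-- `half2 n`.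
module Optimise (cs : List A) (X ed : A → ℕ) (n m c w ρ ℓ H : ℕ)
  (hX : ∀ {i} → i ∈ₗ cs → 5 ≤ X i)
  (hE : ∀ {i} → i ∈ₗ cs → 2 * ed i ≤ (X i ∸ 1) * X i)
  (hD : ∀ {i} → i ∈ₗ cs → ed i ≤ suc c)
  (hn : Σ[ X ] cs + w ≡ n) (hm : Σ[ ed ] cs + ρ ≡ m)
  (hw : 2 * length cs ≤ w) (hℓ : ℓ + H ≡ w)
  (b₁ : Bound₁ ρ ℓ H)
  (b₂ : Bound₂ ρ ℓ H)
  (star : ∀ xs → Σ[ (_+ 2) ] xs ≤ n → Σ[ cap c ] xs < m)
  (hm2 : n * n + 11 ≤ 8 * m + 4 * n)
  (hne : 1 ≤ length cs) (hN : 400008 ≤ n)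
  (τ : ℕ) (τ-low : tri τ ≤ c) (τ-high : suc c ≤ tri (suc τ)) where

  y = Σ[ X ] cs
  S = Σ[ ed ] cs

  cap-small : ∀ {x} → x ≤ τ → cap c x ≡ tri x
  cap-small h = m≤n⇒m⊓n≡m (≤-trans (tri-mono h) τ-low)

  ed≤tri : ∀ {i} → i ∈ₗ cs → ed i ≤ tri (X i)
  ed≤tri {i} m = *-cancelˡ-≤ 2 (≤-trans (hE m) (≤-reflexive (sym (tri-∸ (X i)))))

  ed≤cap : ∀ {i} → i ∈ₗ cs → ed i ≤ suc (cap c (X i))
  ed≤cap {i} m with ≤-total (tri (X i)) c
  ... | inj₁ h rewrite m≤n⇒m⊓n≡m h = m≤n⇒m≤1+n (ed≤tri m)
  ... | inj₂ h rewrite m≥n⇒m⊓n≡n h = hD m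

  2c≤ : 2 * suc c ≤ suc τ * τ
  2c≤ = ≤-trans (*-monoʳ-≤ 2 τ-high) (≤-reflexive (trans (tri-∸ (suc τ)) (*-comm τ (suc τ))))

  -- Each spoke accounts for at most τ/2 edges: up to τ + 1 spokes because a star is a graph on its
  -- spokes, beyond that because c + 1 ≤ τ(τ + 1)/2.
  ed≤τX : ∀ {i} → i ∈ₗ cs → 2 * ed i ≤ τ * X i
  ed≤τX {i} m with ≤-total (X i) (suc τ)
  ... | inj₁ h = ≤-trans (hE m) (*-monoˡ-≤ (X i) (∸-monoˡ-≤ 1 h))
  ... | inj₂ h = ≤-trans (*-monoʳ-≤ 2 (hD m)) (≤-trans 2c≤ (≤-trans (≤-reflexive (*-comm (suc τ) τ)) (*-monoʳ-≤ τ h)))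

  hS : 2 * S ≤ τ * y
  hS = ≤-trans (≤-reflexive (sym (Σ-* 2 ed cs))) (≤-trans (Σ-mono cs ed≤τX) (≤-reflexive (Σ-* τ X cs)))

  -- Stars have no more edges in total than a complete graph on the union of their spokes.
  pairs-≤ : ∀ {is} → (∀ {i} → i ∈ₗ is → i ∈ₗ cs) → 2 * Σ[ ed ] is + Σ[ X ] is ≤ Σ[ X ] is * Σ[ X ] is
  pairs-≤ {is} sub = ≤-trans (≤-reflexive (trans (cong (_+ Σ[ X ] is) (sym (Σ-* 2 ed is))) (sym (Σ-+ (λ i → 2 * ed i) X is))))
    (≤-trans (Σ-mono is λ {i} m → one i (sub m)) (Σ-squares X is))
    where
    one : ∀ i → i ∈ₗ cs → 2 * ed i + X i ≤ X i * X i
    one i m = ≤-trans (+-monoˡ-≤ (X i) (*-monoʳ-≤ 2 (ed≤tri m))) (≤-reflexive (tri-double (X i)))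

  loss : ∀ {is} → (∀ {i} → i ∈ₗ is → i ∈ₗ cs) → Σ[ ed ] is ≤ length is + Σ[ cap c ] (map X is)
  loss {is} sub = ≤-trans (Σ-mono is λ {i} m → ed≤cap (sub m))
    (≤-reflexive (trans (Σ-+ (λ _ → 1) (λ i → cap c (X i)) is) (cong₂ _+_ (trans (Σ-const 1 is) (*-identityˡ _)) (sym (Σ-map (cap c) X is)))))

  kept-size : ∀ is → Σ[ (_+ 2) ] (map X is) ≡ Σ[ X ] is + 2 * length is
  kept-size is = trans (Σ-map (_+ 2) X is) (trans (Σ-+ X (λ _ → 2) is) (cong (Σ[ X ] is +_) (Σ-const 2 is)))

  -- Each kept star loses at most one edge when the maximum degree drops from c + 1 to c.
  exchange-≤ : ∀ {ks rs} ex → cs ↭ ks ++ rs → Σ[ (_+ 2) ] ex + 2 * length ks ≤ Σ[ X ] rs + w →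
    All (_≤ τ) ex → suc (Σ[ tri ] ex) ≤ Σ[ ed ] rs + ρ + length ks
  exchange-≤ {ks} {rs} ex p fit small = +-cancelˡ-≤ (Σ[ cap c ] (map X ks)) _ _ (begin
    K + suc (Σ[ tri ] ex)               ≡⟨ +-suc K _ ⟩
    suc (K + Σ[ tri ] ex)               ≡⟨ cong (λ z → suc (K + z)) (Σ-cong ex (λ h → sym (cap-small (All.lookup small h)))) ⟩
    suc (K + Σ[ cap c ] ex)             ≡⟨ cong suc (Σ-++ (cap c) (map X ks) ex) ⟨
    suc (Σ[ cap c ] (map X ks ++ ex))   ≤⟨ star (map X ks ++ ex) size ⟩
    m                                   ≡⟨ hm ⟨
    S + ρ                               ≡⟨ cong (_+ ρ) (trans (Σ-↭ ed p) (Σ-++ ed ks rs)) ⟩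
    Σ[ ed ] ks + Σ[ ed ] rs + ρ         ≤⟨ +-monoˡ-≤ ρ (+-monoˡ-≤ (Σ[ ed ] rs) (loss (λ h → ∈-resp-↭ (↭-sym p) (++ˡ h)))) ⟩
    length ks + K + Σ[ ed ] rs + ρ      ≡⟨ eq (length ks) K _ ρ ⟩
    K + (Σ[ ed ] rs + ρ + length ks)    ∎)
    where
    open ≤-Reasoning
    ++ˡ : ∀ {i} → i ∈ₗ ks → i ∈ₗ ks ++ rs
    ++ˡ = ∈-++⁺ˡ
    K = Σ[ cap c ] (map X ks)
    eq : ∀ a b c d → a + b + c + d ≡ b + (c + d + a)
    eq = solve-∀
    size : Σ[ (_+ 2) ] (map X ks ++ ex) ≤ n
    size = begin
      Σ[ (_+ 2) ] (map X ks ++ ex)                     ≡⟨ Σ-++ (_+ 2) (map X ks) ex ⟩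
      Σ[ (_+ 2) ] (map X ks) + Σ[ (_+ 2) ] ex   ≡⟨ cong (_+ Σ[ (_+ 2) ] ex) (kept-size ks) ⟩
      Σ[ X ] ks + 2 * length ks + Σ[ (_+ 2) ] ex       ≡⟨ eq′ (Σ[ X ] ks) (2 * length ks) _ ⟩
      Σ[ X ] ks + (Σ[ (_+ 2) ] ex + 2 * length ks)     ≤⟨ +-monoʳ-≤ (Σ[ X ] ks) fit ⟩
      Σ[ X ] ks + (Σ[ X ] rs + w)                             ≡⟨ +-assoc (Σ[ X ] ks) _ w ⟨
      Σ[ X ] ks + Σ[ X ] rs + w                               ≡⟨ cong (_+ w) (trans (Σ-↭ X p) (Σ-++ X ks rs)) ⟨
      y + w                                                   ≡⟨ hn ⟩
      n                                                       ∎
      where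
      eq′ : ∀ a b c → a + b + c ≡ a + (c + b)
      eq′ = solve-∀

  hn′ : y + (ℓ + H) ≡ n
  hn′ = trans (cong (y +_) hℓ) hn

  hm2′ : n * n + 11 ≤ 8 * (S + ρ) + 4 * n
  hm2′ = subst (λ z → n * n + 11 ≤ 8 * z + 4 * n) (sym hm) hm2

  hm2″ : (y + (ℓ + H)) * (y + (ℓ + H)) + 11 ≤ 8 * (S + ρ) + 4 * (y + (ℓ + H))
  hm2″ = subst (λ z → z * z + 11 ≤ 8 * (S + ρ) + 4 * z) (sym hn′) hm2′

  first : ∀ is → 1 ≤ length is → ∃ λ i → i ∈ₗ is × X i ≤ Σ[ X ] is
  first (i ∷ is) _ = i , here refl , m≤m+n (X i) _

  y≥5 : 5 ≤ y
  y≥5 with i , m , le ← first cs hne = ≤-trans (hX m) le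

  -- If 4τ ≤ n, then at most four vertices are outside, so there are at most two stars, and their
  -- edges are too few.
  n<4τ : n < 4 * τ
  n<4τ with suc n ≤? 4 * τ
  ... | yes p = p
  ... | no ¬p = ⊥-elim (few-stars n ℓ H τ S ρ c (≤-trans (m≤m+n 200000 200008) hN) w≤4 S≤ 2c≤ h4 b₂ hm2′)
    where
    h4 : 4 * τ ≤ n
    h4 = ≤-pred (≰⇒> ¬p)
    w≤4 : ℓ + H ≤ 4
    w≤4 = outside≤4 y ℓ H y≥5 (≤-trans (≤-trans (m≤m+n 200000 200008) hN) (≤-reflexive (sym hn′)))
      (mixed y ℓ H τ S ρ hS hm2″ b₂ (≤-trans h4 (≤-reflexive (sym hn′))))
    S≤ : S ≤ 2 * suc c
    S≤ = ≤-trans (Σ-mono cs hD) (≤-trans (≤-reflexive (trans (Σ-const (suc c) cs) (*-comm (suc c) _)))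
      (*-monoˡ-≤ (suc c) (*-cancelˡ-≤ {length cs} {2} 2 (≤-trans (≤-trans hw (≤-reflexive (sym hℓ))) w≤4))))

  -- Here 400008 = 4 · 100002. The numerical estimates ask for τ ≥ 50001 and for τ - 1252 ≥ 98749,
  -- and both follow.
  τ≥ : 100002 ≤ τ
  τ≥ = *-cancelˡ-≤ 4 (≤-trans hN (<⇒≤ n<4τ))

  50001≤τ : 50001 ≤ τ
  50001≤τ = ≤-trans (m≤m+n 50001 50001) τ≥

  self : cs ↭ cs ++ []
  self = ↭-sym (++-identityʳ cs)

  -- compare with the packing of all n vertices into stars with τ spokes and a remainder
  packed : Packable τ (ℓ + H)
  packed = go r r<t n-eq
    where
    k r : ℕ
    k = n / suc (suc τ)
    r = n % suc (suc τ)
    r<t : r < suc (suc τ)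
    r<t = m%n<n n (suc (suc τ))
    n-eq : n ≡ k * (τ + 2) + r
    n-eq = trans (m≡m%n+[m/n]*n n (suc (suc τ))) (eq r k τ)
      where
      eq : ∀ r k t → r + k * suc (suc t) ≡ k * (t + 2) + r
      eq = solve-∀
    k≤3 : k ≤ 3
    k≤3 with k ≤? 3
    ... | yes p = p
    ... | no ¬p = contradiction n<4τ (≤⇒≯ (≤-trans (*-mono-≤ (≰⇒> ¬p) (m≤m+n τ 2)) (≤-trans (m≤m+n _ r) (≤-reflexive (sym n-eq)))))
    bound : ∀ ex → Σ[ (_+ 2) ] ex ≤ n → All (_≤ τ) ex → suc (Σ[ tri ] ex) ≤ S + ρ
    bound ex fit small = ≤-trans (≤-reflexive (cong suc (Σ-cong ex λ h → sym (cap-small (All.lookup small h))))) (≤-trans (star ex fit) (≤-reflexive (sym hm)))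
    small-r : ∀ r → r ≤ 1 → n ≡ k * (τ + 2) + r → Packable τ (ℓ + H)
    small-r r r≤1 eq = packing′ k τ r y ℓ H S ρ k≤3 r≤1 (trans hn′ eq)
      (≤-trans (≤-reflexive (cong suc (sym (Σ-replicate tri k τ)))) (bound (replicate k τ)
        (≤-trans (≤-reflexive (Σ-replicate _ k τ)) (≤-trans (m≤m+n _ r) (≤-reflexive (sym eq)))) (replicate⁺ k ≤-refl))) hS b₂
    go : ∀ r → r < suc (suc τ) → n ≡ k * (τ + 2) + r → Packable τ (ℓ + H)
    go (suc (suc r′)) lt eq = packing k τ r′ y ℓ H S ρ k≤3 r′≤τ (trans hn′ (trans eq (cong (k * (τ + 2) +_) (+-comm 2 r′))))
      (≤-trans (≤-reflexive (cong suc (sym (total tri)))) (bound ex (≤-reflexive (trans (total (_+ 2)) (trans (cong (k * (τ + 2) +_) (+-comm r′ 2)) (sym eq)))) (All-++⁺ (replicate⁺ k ≤-refl) (r′≤τ ∷ [])))) hS b₂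
      where
      r′≤τ : r′ ≤ τ
      r′≤τ = <⇒≤ (≤-pred (≤-pred lt))
      ex : List ℕ
      ex = replicate k τ ++ r′ ∷ []
      total : ∀ (f : ℕ → ℕ) → Σ[ f ] ex ≡ k * f τ + f r′
      total f = trans (Σ-++ f (replicate k τ) (r′ ∷ [])) (cong₂ _+_ (Σ-replicate f k τ) (+-identityʳ (f r′)))
    go zero lt eq = small-r 0 z≤n eq
    go (suc zero) lt eq = small-r 1 ≤-refl eq

  outside-small : 10 * (ℓ + H) ≤ 3 * τ
  outside-small = choose (outside-dichotomy τ ℓ H 50001≤τ packed)
    where
    choose : 10 * (ℓ + H) ≤ 3 * τ ⊎ 37 * τ ≤ 10 * (ℓ + H) → 10 * (ℓ + H) ≤ 3 * τ
    choose (inj₁ h) = h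
    choose (inj₂ h) = ⊥-elim (not-nearly-all y ℓ H τ S ρ y≥5 50001≤τ h hS hm2″ b₂)

  w≤τ : w ≤ τ
  w≤τ = *-cancelˡ-≤ 10 (≤-trans (≤-reflexive (cong (10 *_) (sym hℓ))) (≤-trans outside-small (*-monoˡ-≤ τ (m≤m+n 3 7))))

  ¬471⇒≤470 : ∀ {k} → ¬ 471 ≤ k → k ≤ 470
  ¬471⇒≤470 h = ≤-pred (≰⇒> h)

  -- All stars are kept, and the remainder is replaced by one star with k = w - 8 spokes: six
  -- vertices are reserved for up to three old centres, two for the new one.
  few-centers : length cs ≤ 3 → ρ ≤ 470
  few-centers h≤3 with w ≤? 8
  ... | yes p = ¬471⇒≤470 (residue-small ℓ H ρ (≤-trans (≤-reflexive hℓ) p) b₁)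
  ... | no ¬p with k , eq ← m≤n⇒∃[o]m+o≡n (<⇒≤ (≰⇒> ¬p)) =
    ¬471⇒≤470 (residue-large ℓ H ρ k (trans hℓ (trans (sym eq) (+-comm 8 k))) b₁ tri-k)
    where
    tri-k : tri k ≤ ρ + 2
    tri-k = ≤-pred (≤-trans (s≤s (≤-reflexive (sym (+-identityʳ (tri k))))) (≤-trans
      (exchange-≤ {cs} {[]} (k ∷ []) self fit (≤-trans (≤-trans (m≤n+m k 8) (≤-reflexive eq)) w≤τ ∷ []))
      (≤-trans (+-monoʳ-≤ ρ h≤3) (≤-reflexive (eq′ ρ)))))
      where
      eq′ : ∀ a → a + 3 ≡ suc (a + 2)
      eq′ = solve-∀
      fit : k + 2 + 0 + 2 * length cs ≤ w
      fit = ≤-trans (+-monoʳ-≤ (k + 2 + 0) (*-monoʳ-≤ 2 h≤3)) (≤-reflexive (trans (eq″ k) eq))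
        where
        eq″ : ∀ k → k + 2 + 0 + 6 ≡ 8 + k
        eq″ = solve-∀

  -- The four largest stars are singled out, i₄ being the smallest of them. The number o counts the
  -- spokes of all other stars and the outside vertices beyond the four centres.
  module Many {i₁ i₂ i₃ i₄ : A} {rs : List A} (p : cs ↭ i₁ ∷ i₂ ∷ i₃ ∷ i₄ ∷ rs)
    (s₁ : X i₄ ≤ X i₁) (s₂ : X i₄ ≤ X i₂) (s₃ : X i₄ ≤ X i₃) (sr : ∀ {i} → i ∈ₗ rs → X i ≤ X i₄) where

    x = X i₄
    s = Σ[ X ] rs
    D = Σ[ ed ] rs

    back : ∀ {i} → i ∈ₗ i₁ ∷ i₂ ∷ i₃ ∷ i₄ ∷ rs → i ∈ₗ cs
    back = ∈-resp-↭ (↭-sym p)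

    i₄∈ : i₄ ∈ₗ cs
    i₄∈ = back (there (there (there (here refl))))

    hD₂ : 2 * D + s ≤ s * s
    hD₂ = pairs-≤ (λ m → back (there (there (there (there m)))))

    hDx : 2 * D ≤ x * s
    hDx = ≤-trans (≤-reflexive (sym (Σ-* 2 ed rs))) (≤-trans (Σ-mono rs λ {i} m → ≤-trans (hE (back (there (there (there (there m))))))
      (*-monoˡ-≤ (X i) (≤-trans (m∸n≤m (X i) 1) (sr m)))) (≤-reflexive (Σ-* x X rs)))

    len : length cs ≡ 4 + length rs
    len = ↭-length p

    rs-few : 8 + 2 * length rs ≤ w
    rs-few = ≤-trans (≤-reflexive (trans (eq (length rs)) (cong (2 *_) (sym len)))) hw
      where
      eq : ∀ k → 8 + 2 * k ≡ 2 * (4 + k)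
      eq = solve-∀

    g = proj₁ (m≤n⇒∃[o]m+o≡n (m+n≤o⇒m≤o 8 rs-few))
    g-eq : 8 + g ≡ w
    g-eq = proj₂ (m≤n⇒∃[o]m+o≡n (m+n≤o⇒m≤o 8 rs-few))

    o = s + g

    total-X : y ≡ X i₁ + (X i₂ + (X i₃ + (x + s)))
    total-X = Σ-↭ X p

    -- The four largest stars have at least 4x spokes together, and n < 4τ. In effect x ≤ τ - o/4.
    sorted : 4 * x + o + 9 ≤ 4 * τ
    sorted = begin
      4 * x + (s + g) + 9                          ≡⟨ eq x s g ⟩
      suc (x + (x + (x + (x + s))) + (8 + g))      ≤⟨ s≤s (+-mono-≤ (+-mono-≤ s₁ (+-mono-≤ s₂ (+-monoˡ-≤ (x + s) s₃))) (≤-reflexive g-eq)) ⟩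
      suc (X i₁ + (X i₂ + (X i₃ + (x + s))) + w)   ≡⟨ cong (λ z → suc (z + w)) total-X ⟨
      suc (y + w)                                  ≡⟨ cong suc hn ⟩
      suc n                                        ≤⟨ n<4τ ⟩
      4 * τ                                        ∎
      where
      open ≤-Reasoning
      eq : ∀ x s g → 4 * x + (s + g) + 9 ≡ suc (x + (x + (x + (x + s))) + (8 + g))
      eq = solve-∀

    hℓg : ℓ + H ≡ g + 8
    hℓg = trans hℓ (trans (sym g-eq) (+-comm 8 g))

    -- Dissolving i₄ and all smaller stars frees x + o vertices and the two centre vertices of i₄.
    keep₃ : ∀ ex → Σ[ (_+ 2) ] ex ≤ x + o + 2 → All (_≤ τ) ex → Σ[ tri ] ex ≤ tri x + (D + ρ) + 2
    keep₃ ex fit small = ≤-pred (≤-trans (exchange-≤ {i₁ ∷ i₂ ∷ i₃ ∷ []} {i₄ ∷ rs} ex p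
        (≤-trans (+-monoˡ-≤ 6 fit) (≤-reflexive (trans (eq x s g) (cong (x + s +_) g-eq)))) small)
      (≤-trans (+-monoˡ-≤ 3 (+-monoˡ-≤ ρ (+-monoˡ-≤ D (ed≤tri i₄∈)))) (≤-reflexive (eq′ (tri x) D ρ))))
      where
      eq : ∀ x s g → x + (s + g) + 2 + 6 ≡ x + s + (8 + g)
      eq = solve-∀
      eq′ : ∀ a b c → a + b + c + 3 ≡ suc (a + (b + c) + 2)
      eq′ = solve-∀

    keep₄ : ∀ ex → Σ[ (_+ 2) ] ex ≤ o → All (_≤ τ) ex → Σ[ tri ] ex ≤ D + ρ + 3
    keep₄ ex fit small = ≤-pred (≤-trans (exchange-≤ {i₁ ∷ i₂ ∷ i₃ ∷ i₄ ∷ []} {rs} ex p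
        (≤-trans (+-monoˡ-≤ 8 fit) (≤-reflexive (trans (eq s g) (cong (s +_) g-eq)))) small) (≤-reflexive (eq′ (D + ρ))))
      where
      eq : ∀ s g → s + g + 8 ≡ s + (8 + g)
      eq = solve-∀
      eq′ : ∀ a → a + 4 ≡ suc (a + 3)
      eq′ = solve-∀

    tri-+ : ∀ a b → tri a + tri b + a * b ≡ tri (a + b)
    tri-+ zero b = +-identityʳ _
    tri-+ (suc a) b = trans (eq a b (tri a) (tri b)) (cong (a + b +_) (tri-+ a b))
      where
      eq : ∀ a b t u → a + t + u + suc a * b ≡ a + b + (t + u + a * b)
      eq = solve-∀

    -- One star with x + o spokes still has at most c edges; it beats the maximum `tri x` for i₄ by
    -- `tri o` + xo.
    merge : x + o ≤ τ → D + ρ ≤ 470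
    merge h = ¬471⇒≤470 (residue-merged ℓ H ρ s g x D hℓg (hX i₄∈) hD₂ b₁
      (+-cancelˡ-≤ (tri x) _ _ (≤-trans (≤-reflexive (trans (eq (tri x) (tri o) (x * o)) (trans (tri-+ x o) (sym (+-identityʳ _)))))
        (≤-trans (keep₃ (x + o ∷ []) (≤-reflexive (+-identityʳ _)) (h ∷ [])) (≤-reflexive (+-assoc (tri x) _ 2))))))
      where
      eq : ∀ a b c → a + (b + c) ≡ a + b + c
      eq = solve-∀

    module _ (h : ¬ x + o ≤ τ) where

      x<τ : x + 1 ≤ τ
      x<τ = *-cancelˡ-≤ 4 (≤-trans (≤-trans (m≤m+n (4 * (x + 1)) (o + 5)) (≤-reflexive (eq x o))) sorted)
        where
        eq : ∀ x o → 4 * (x + 1) + (o + 5) ≡ 4 * x + o + 9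
        eq = solve-∀

      -- With g ≤ 1 there is no room for a fifth centre. Then s = 0 and x + o ≤ x + 1 ≤ τ, contrary
      -- to the assumption.
      2≤g : 2 ≤ g
      2≤g with 2 ≤? g
      ... | yes q = q
      ... | no ¬q = contradiction (≤-trans (+-monoʳ-≤ x (≤-trans (≤-reflexive (cong (_+ g) s≡0)) g≤1)) x<τ) h
        where
        g≤1 : g ≤ 1
        g≤1 = ≤-pred (≰⇒> ¬q)
        none : ∀ is → 2 * length is ≤ 1 → Σ[ X ] is ≡ 0
        none [] _ = refl
        none (i ∷ is) le with s≤s () ← ≤-trans (≤-reflexive (sym (*-suc 2 (length is)))) le
        s≡0 : s ≡ 0
        s≡0 = none rs (≤-trans (+-cancelˡ-≤ 8 _ _ (≤-trans rs-few (≤-reflexive (sym g-eq)))) g≤1)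

      -- Two of the g vertices are set aside as the centre of a second new star.
      g' p' : ℕ
      g' = proj₁ (m≤n⇒∃[o]m+o≡n 2≤g)
      g'-eq : 2 + g' ≡ g
      g'-eq = proj₂ (m≤n⇒∃[o]m+o≡n 2≤g)
      p' = s + g'
      o≡p'+2 : o ≡ p' + 2
      o≡p'+2 = trans (cong (s +_) (sym g'-eq)) (eq s g')
        where
        eq : ∀ s g → s + (2 + g) ≡ s + g + 2
        eq = solve-∀

      turán : 2 * (D + ρ) + p' ≤ p' * p' + 2500
      turán = residue-turán ℓ H ρ s g' D (trans hℓg (trans (cong (_+ 8) (sym g'-eq)) (eq g'))) hD₂ b₁
        where
        eq : ∀ g → 2 + g + 8 ≡ g + 10
        eq = solve-∀

      -- Otherwise x + p' spokes are redistributed into a full star with τ and a star with z = x +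
      -- p' - τ. Since τ + z = x + p', convexity gains (τ - x)(τ - p') ≥ 1253 edges, above the
      -- tolerance 1252. When x + p' = τ - 1 a single full star serves instead.
      near : τ ≤ p' + 1252
      near with τ ≤? p' + 1252
      ... | yes q = q
      ... | no ¬q = ⊥-elim (cases (τ ≤? x + p'))
        where
        far : p' + 1253 ≤ τ
        far = ≤-trans (≤-reflexive (+-suc p' 1252)) (≰⇒> ¬q)
        x+o : x + o ≡ x + p' + 2
        x+o = trans (cong (x +_) o≡p'+2) (sym (+-assoc x p' 2))
        cases : Dec (τ ≤ x + p') → ⊥
        cases (no ¬r) = exchange-exact x p' (D + ρ) (≤-trans 50001≤τ (≤-reflexive exact)) turán
          (subst (λ z → tri z ≤ tri x + (D + ρ) + 2) exact (≤-trans (≤-reflexive (sym (+-identityʳ (tri τ))))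
            (keep₃ (τ ∷ []) (≤-trans (≤-reflexive (+-identityʳ _)) (+-monoˡ-≤ 2 (<⇒≤ (≰⇒> h)))) (≤-refl ∷ []))))
          where
          exact : τ ≡ x + p' + 1
          exact = ≤-antisym (≤-pred (≤-trans (≰⇒> h) (≤-reflexive (trans x+o (+-suc (x + p') 1)))))
            (≤-trans (≤-reflexive (+-comm (x + p') 1)) (≰⇒> ¬r))
        cases (yes r) = with-remainder _ (proj₂ (m≤n⇒∃[o]m+o≡n r))
          where
          with-remainder : ∀ z → τ + z ≡ x + p' → ⊥
          with-remainder z z-eq = exchange τ x p' z (D + ρ) x<τ z-eq far turán
            (≤-trans (≤-reflexive (cong (tri τ +_) (sym (+-identityʳ (tri z))))) (keep₃ (τ ∷ z ∷ []) fit (≤-refl ∷ ≤-trans (remainder-≤ τ x p' z z-eq (≤-trans (m≤m+n p' 1253) far)) (≤-trans (m≤m+n x 1) x<τ) ∷ [])))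
            where
            fit : τ + 2 + (z + 2 + 0) ≤ x + o + 2
            fit = ≤-reflexive (trans (eq τ z) (trans (cong (_+ 4) z-eq) (trans (eq′ (x + p')) (cong (_+ 2) (sym x+o)))))
              where
              eq : ∀ t z → t + 2 + (z + 2 + 0) ≡ t + z + 4
              eq = solve-∀
              eq′ : ∀ a → a + 4 ≡ a + 2 + 2
              eq′ = solve-∀

      module _ (q : ℕ) (τ-eq : q + 1252 ≡ τ) where
        q≥ : 98749 ≤ q
        q≥ = spokes-large q τ τ-eq τ≥
        q+2≤o : q + 2 ≤ o
        q+2≤o = ≤-trans (+-monoˡ-≤ 2 (spokes-fit q p' τ τ-eq near)) (≤-reflexive (sym o≡p'+2))
        q≤τ : q ≤ τ
        q≤τ = ≤-trans (m≤m+n q 1252) (≤-reflexive τ-eq)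
        sorted′ : 4 * x + o + 9 ≤ 4 * (q + 1252)
        sorted′ = subst (λ z → 4 * x + o + 9 ≤ 4 * z) (sym τ-eq) sorted
        outside′ : 10 * (ℓ + H) ≤ 3 * (q + 1252)
        outside′ = subst (λ z → 10 * (ℓ + H) ≤ 3 * z) (sym τ-eq) outside-small
        -- Now all four large stars are kept and only the o vertices are reorganised: a star with q
        -- = τ - 1252 spokes fits by `near`. Beyond 3τ/2 there is also room for a second one with a
        -- quarter of τ.
        cases : Dec (2 * o ≤ 3 * τ) → ⊥
        cases (yes r) = big-residue₁ ℓ H ρ D x s o q q≥ hDx b₂ (m≤m+n s g) sorted′ outside′
          (subst (λ z → 2 * o ≤ 3 * z) (sym τ-eq) r)
          (≤-trans (≤-reflexive (sym (+-identityʳ (tri q)))) (keep₄ (q ∷ []) (≤-trans (≤-reflexive (+-identityʳ _)) q+2≤o) (q≤τ ∷ [])))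
        cases (no ¬r) = big-residue₂ ℓ H ρ D x s o q a q≥ hDx b₂ (m≤m+n s g) sorted′ outside′
          (subst (λ z → z ≤ 4 * a + 3) (sym τ-eq) τ≤4a+3) (subst (λ z → 4 * a ≤ z) (sym τ-eq) 4a≤τ)
          (≤-trans (≤-reflexive (cong (tri q +_) (sym (+-identityʳ (tri a))))) (keep₄ (q ∷ a ∷ []) fit (q≤τ ∷ ≤-trans (m≤n*m a 4) 4a≤τ ∷ [])))
          where
          a : ℕ
          a = τ / 4
          a-eq : τ ≡ τ % 4 + a * 4
          a-eq = m≡m%n+[m/n]*n τ 4
          4a≤τ : 4 * a ≤ τ
          4a≤τ = ≤-trans (≤-reflexive (*-comm 4 a)) (≤-trans (m≤n+m (a * 4) (τ % 4)) (≤-reflexive (sym a-eq)))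
          τ≤4a+3 : τ ≤ 4 * a + 3
          τ≤4a+3 = ≤-trans (≤-reflexive a-eq) (≤-trans (+-monoˡ-≤ (a * 4) (≤-pred (m%n<n τ 4))) (≤-reflexive (eq a)))
            where
            eq : ∀ a → 3 + a * 4 ≡ 4 * a + 3
            eq = solve-∀
          fit : q + 2 + (a + 2 + 0) ≤ o
          fit = two-stars-fit q a τ o τ-eq 4a≤τ (<⇒≤ (≰⇒> ¬r))

      impossible : ⊥
      impossible = cases (τ ∸ 1252) (m∸n+n≡m (≤-trans (m≤m+n 1252 98750) τ≥)) (2 * o ≤? 3 * τ)

    rest≤470 : D + ρ ≤ 470
    rest≤470 with x + o ≤? τ
    ... | yes h = merge h
    ... | no h = ⊥-elim (impossible h)

  -- From n < 4τ and `tri τ` ≤ c: n² is below 16τ², and this is about 32c.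
  degree-bound : n * n ≤ 32 * suc c + 32 * n
  degree-bound with u , u-eq ← m≤n⇒∃[o]m+o≡n n<4τ = conclude
    (τ-low ⊛ 32 ⊕ tri-≥ τ ⊛ 16 ⊕ ≤-reflexive (cong (λ z → z * z) u-eq) ⊕ ≤-reflexive (sym u-eq) ⊛ 4 ⊕ 2xy≤x²+y² u 1) (eq n c τ u (tri τ))
    where
    eq : ∀ n c τ u t →
      n * n + (c * 32 + (2 * t + τ) * 16 + 4 * τ * (4 * τ) + (suc n + u) * 4 + (u * u + 1 * 1)) + (n * u * 2 + n * 30 + 28)
      ≡ 32 * suc c + 32 * n + (t * 32 + τ * τ * 16 + (suc n + u) * (suc n + u) + 4 * τ * 4 + 2 * (u * 1))
    eq = solve-∀

  kept-stars : ∃ λ ks → ∃ λ rs → cs ↭ ks ++ rs × 1 ≤ length ks × length ks ≤ 4 × Σ[ ed ] rs + ρ ≤ 470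
  kept-stars with length cs ≤? 3
  ... | yes h = cs , [] , self , hne , m≤n⇒m≤1+n h , few-centers h
  ... | no h with extract-max X cs hne
  ...   | i₁ , r₁ , p₁ , m₁ with extract-max X r₁ (len₁ p₁ (≰⇒> h))
    where
    len₁ : cs ↭ i₁ ∷ r₁ → 4 ≤ length cs → 1 ≤ length r₁
    len₁ p h = ≤-trans (s≤s z≤n) (≤-pred (≤-trans h (≤-reflexive (↭-length p))))
  ...     | i₂ , r₂ , p₂ , m₂ with extract-max X r₂ (≤-trans (s≤s z≤n) (≤-pred (≤-pred (≤-trans (≰⇒> h) (≤-reflexive (trans (↭-length p₁) (cong suc (↭-length p₂))))))))
  ...       | i₃ , r₃ , p₃ , m₃ with extract-max X r₃ (≤-pred (≤-pred (≤-pred (≤-trans (≰⇒> h) (≤-reflexive (trans (↭-length p₁) (cong suc (trans (↭-length p₂) (cong suc (↭-length p₃))))))))))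
  ...         | i₄ , rs , p₄ , m₄ = i₁ ∷ i₂ ∷ i₃ ∷ i₄ ∷ [] , rs , p , s≤s z≤n , ≤-refl ,
    Many.rest≤470 p (m₁ (r₁∋ (there (r₂∋ (there (r₃∋ (here refl))))))) (m₂ (r₂∋ (there (r₃∋ (here refl))))) (m₃ (r₃∋ (here refl))) m₄
    where
    p : cs ↭ i₁ ∷ i₂ ∷ i₃ ∷ i₄ ∷ rs
    p = ↭.trans p₁ (prep i₁ (↭.trans p₂ (prep i₂ (↭.trans p₃ (prep i₃ p₄)))))
    r₁∋ : ∀ {i} → i ∈ₗ i₂ ∷ r₂ → i ∈ₗ r₁
    r₁∋ = ∈-resp-↭ (↭-sym p₂)
    r₂∋ : ∀ {i} → i ∈ₗ i₃ ∷ r₃ → i ∈ₗ r₂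
    r₂∋ = ∈-resp-↭ (↭-sym p₃)
    r₃∋ : ∀ {i} → i ∈ₗ i₄ ∷ rs → i ∈ₗ r₃
    r₃∋ = ∈-resp-↭ (↭-sym p₄)

-- Explicit 4-graphs: thick cliques and unions of stars

Quadℕ : Set
Quadℕ = ℕ × ℕ × ℕ × ℕ

infix 4 _∈Q_
_∈Q_ : ℕ → Quadℕ → Set
k ∈Q (p , q , r , s) = k ≡ p ⊎ k ≡ q ⊎ k ≡ r ⊎ k ≡ s

_∈Q?_ : ∀ k Q → Dec (k ∈Q Q)
k ∈Q? (p , q , r , s) = (k ≟ p) ⊎-dec ((k ≟ q) ⊎-dec ((k ≟ r) ⊎-dec (k ≟ s)))

-- A sorted quadruple is recovered from its set of entries, so distinct quadruples give distinct
-- edges.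
Increasing : ℕ → Quadℕ → Set
Increasing n (p , q , r , s) = p < q × q < r × r < s × s < n

Meeting : List Quadℕ → Set
Meeting L = ∀ {Q Q' k} → Q ∈ₗ L → Q' ∈ₗ L → k ∈Q Q → k ∈Q Q' → ∃ λ j → j ≢ k × j ∈Q Q × j ∈Q Q'

module _ {n : ℕ} where

  set : Quadℕ → Subset n
  set Q = tabulateᵛ λ v → does (toℕ v ∈Q? Q)

  opaque
    ∈-set⁺ : ∀ {v} Q → toℕ v ∈Q Q → v ∈ set Q
    ∈-set⁺ {v} Q h = lookup⇒[]= v (set Q) (trans (lookup∘tabulate _ v) (dec-true (toℕ v ∈Q? Q) h))

    ∈-set⁻ : ∀ {v} Q → v ∈ set Q → toℕ v ∈Q Q
    ∈-set⁻ {v} Q m = of-does (toℕ v ∈Q? Q) (trans (sym (lookup∘tabulate _ v)) ([]=⇒lookup m))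
      where
      of-does : ∀ {P : Set} (d : Dec P) → does d ≡ true → P
      of-does (yes p) _ = p
      of-does (no _) ()

    point : ∀ {Q k} → Increasing n Q → k ∈Q Q → ∃ λ (v : Fin n) → toℕ v ≡ k
    point {p , q , r , s} {k} (pq , qr , rs , sn) h = fromℕ< (bound h) , toℕ-fromℕ< (bound h)
      where
      bound : ∀ {k} → k ∈Q (p , q , r , s) → k < n
      bound (inj₁ refl) = <-trans pq (<-trans qr (<-trans rs sn))
      bound (inj₂ (inj₁ refl)) = <-trans qr (<-trans rs sn)
      bound (inj₂ (inj₂ (inj₁ refl))) = <-trans rs sn
      bound (inj₂ (inj₂ (inj₂ refl))) = sn

    set-size : ∀ Q → Increasing n Q → ∣ set Q ∣ ≡ 4
    set-size Q@(p , q , r , s) inc@(pq , qr , rs , _)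
      with a , refl ← point {Q} inc (inj₁ refl)
      with b , refl ← point {Q} inc (inj₂ (inj₁ refl))
      with c , refl ← point {Q} inc (inj₂ (inj₂ (inj₁ refl)))
      with d , refl ← point {Q} inc (inj₂ (inj₂ (inj₂ refl))) =
      trans (card (set Q)) (trans (#-remove _≟F_ (_∈? set Q) V-unique (v∈V {v = a}) (∈-set⁺ Q (inj₁ refl))) (cong suc
      (trans (#-remove _≟F_ _ V-unique (v∈V {v = b}) (∈-set⁺ Q (inj₂ (inj₁ refl)) , ne pq)) (cong suc
      (trans (#-remove _≟F_ _ V-unique (v∈V {v = c}) ((∈-set⁺ Q (inj₂ (inj₂ (inj₁ refl))) , ne (<-trans pq qr)) , ne qr)) (cong suc
      (trans (#-remove _≟F_ _ V-unique (v∈V {v = d}) (((∈-set⁺ Q (inj₂ (inj₂ (inj₂ refl))) , ne (<-trans pq (<-trans qr rs))) , ne (<-trans qr rs)) , ne rs)) (cong suc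
      (#-none _ V λ { {v} _ ((((m , na) , nb) , nc) , nd) → none na nb nc nd (∈-set⁻ Q m) })))))))))
      where
      ne : ∀ {u v : Fin n} → toℕ u < toℕ v → v ≢ u
      ne lt refl = <-irrefl refl lt
      none : ∀ {a b c d v : Fin n} → v ≢ a → v ≢ b → v ≢ c → v ≢ d → ¬ toℕ v ∈Q (toℕ a , toℕ b , toℕ c , toℕ d)
      none na nb nc nd (inj₁ e) = na (toℕ-injective e)
      none na nb nc nd (inj₂ (inj₁ e)) = nb (toℕ-injective e)
      none na nb nc nd (inj₂ (inj₂ (inj₁ e))) = nc (toℕ-injective e)
      none na nb nc nd (inj₂ (inj₂ (inj₂ e))) = nd (toℕ-injective e)

    set-injective : ∀ {Q Q'} → Increasing n Q → Increasing n Q' → set Q ≡ set Q' → Q ≡ Q'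
    set-injective {Q} {Q'} inc inc' eq = same inc inc' (sub inc eq) (sub inc' (sym eq))
      where
      sub : ∀ {Q Q'} → Increasing n Q → set Q ≡ set Q' → ∀ {k} → k ∈Q Q → k ∈Q Q'
      sub {Q} {Q'} inc eq h with v , refl ← point {Q} inc h = ∈-set⁻ Q' (subst (v ∈_) eq (∈-set⁺ Q h))
      ≥₁ : ∀ {Q k} → Increasing n Q → k ∈Q Q → proj₁ Q ≤ k
      ≥₁ _ (inj₁ refl) = ≤-refl
      ≥₁ (a , b , c , _) (inj₂ (inj₁ refl)) = <⇒≤ a
      ≥₁ (a , b , c , _) (inj₂ (inj₂ (inj₁ refl))) = <⇒≤ (<-trans a b)
      ≥₁ (a , b , c , _) (inj₂ (inj₂ (inj₂ refl))) = <⇒≤ (<-trans a (<-trans b c))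
      ≥₂ : ∀ {p q r s k} → Increasing n (p , q , r , s) → k ∈Q (p , q , r , s) → k ≢ p → q ≤ k
      ≥₂ _ (inj₁ e) ne = contradiction e ne
      ≥₂ _ (inj₂ (inj₁ refl)) _ = ≤-refl
      ≥₂ (a , b , c , _) (inj₂ (inj₂ (inj₁ refl))) _ = <⇒≤ b
      ≥₂ (a , b , c , _) (inj₂ (inj₂ (inj₂ refl))) _ = <⇒≤ (<-trans b c)
      ≤₄ : ∀ {p q r s k} → Increasing n (p , q , r , s) → k ∈Q (p , q , r , s) → k ≤ s
      ≤₄ (a , b , c , _) (inj₁ refl) = <⇒≤ (<-trans a (<-trans b c))
      ≤₄ (a , b , c , _) (inj₂ (inj₁ refl)) = <⇒≤ (<-trans b c)
      ≤₄ (a , b , c , _) (inj₂ (inj₂ (inj₁ refl))) = <⇒≤ c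
      ≤₄ _ (inj₂ (inj₂ (inj₂ refl))) = ≤-refl
      ≤₃ : ∀ {p q r s k} → Increasing n (p , q , r , s) → k ∈Q (p , q , r , s) → k ≢ s → k ≤ r
      ≤₃ (a , b , c , _) (inj₁ refl) _ = <⇒≤ (<-trans a b)
      ≤₃ (a , b , c , _) (inj₂ (inj₁ refl)) _ = <⇒≤ b
      ≤₃ (a , b , c , _) (inj₂ (inj₂ (inj₁ refl))) _ = ≤-refl
      ≤₃ _ (inj₂ (inj₂ (inj₂ e))) ne = contradiction e ne
      same : ∀ {Q Q'} → Increasing n Q → Increasing n Q' → (∀ {k} → k ∈Q Q → k ∈Q Q') → (∀ {k} → k ∈Q Q' → k ∈Q Q) → Q ≡ Q'
      same {p , q , r , s} {p' , q' , r' , s'} i@(a , b , c , _) i'@(a' , b' , c' , _) f g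
        with refl ← ≤-antisym (≥₁ {p , q , r , s} i (g (inj₁ refl))) (≥₁ {p' , q' , r' , s'} i' (f (inj₁ refl)))
        with refl ← ≤-antisym (≤₄ i' (f (inj₂ (inj₂ (inj₂ refl))))) (≤₄ i (g (inj₂ (inj₂ (inj₂ refl)))))
        with refl ← ≤-antisym (≥₂ i (g (inj₂ (inj₁ refl))) (λ e → <-irrefl (sym e) a')) (≥₂ i' (f (inj₂ (inj₁ refl))) (λ e → <-irrefl (sym e) a))
        with refl ← ≤-antisym (≤₃ i' (f (inj₂ (inj₂ (inj₁ refl)))) (λ e → <-irrefl e c)) (≤₃ i (g (inj₂ (inj₂ (inj₁ refl)))) (λ e → <-irrefl e c')) = refl

unique-map : ∀ {A B : Set} (f : A → B) {xs : List A} → Unique xs → (∀ {x y} → x ∈ₗ xs → y ∈ₗ xs → f x ≡ f y → x ≡ y) → Unique (map f xs)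
unique-map f [] h = []
unique-map f {x ∷ xs} (x∉ ∷ u) h = All.tabulate (λ m eq → let y , my , e = ∈-map⁻ f m in
    All.lookup x∉ my (h (here refl) (there my) (trans eq e))) ∷ unique-map f u (λ m m' → h (there m) (there m'))

opaque
  unfolding #
  #-map : ∀ {A B : Set} {P : B → Set} (P? : Decidable P) (f : A → B) xs → # P? (map f xs) ≡ # (λ x → P? (f x)) xs
  #-map P? f [] = refl
  #-map P? f (x ∷ xs) with P? (f x)
  ... | yes _ = cong suc (#-map P? f xs)
  ... | no _ = #-map P? f xs

  #-++ : ∀ {A : Set} {P : A → Set} (P? : Decidable P) xs ys → # P? (xs ++ ys) ≡ # P? xs + # P? ys
  #-++ P? [] ys = refl
  #-++ P? (x ∷ xs) ys with P? x
  ... | yes _ = cong suc (#-++ P? xs ys)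
  ... | no _ = #-++ P? xs ys

  #-take : ∀ {A : Set} {P : A → Set} (P? : Decidable P) k xs → # P? (take k xs) ≤ # P? xs
  #-take P? zero xs = z≤n
  #-take P? (suc k) [] = z≤n
  #-take P? (suc k) (x ∷ xs) with P? x
  ... | yes _ = s≤s (#-take P? k xs)
  ... | no _ = #-take P? k xs

∈-take : ∀ {A : Set} k (xs : List A) {x} → x ∈ₗ take k xs → x ∈ₗ xs
∈-take (suc k) (y ∷ xs) (here e) = here e
∈-take (suc k) (y ∷ xs) (there m) = there (∈-take k xs m)

max-≤ : ∀ {A : Set} (f : A → ℕ) k xs → (∀ x → f x ≤ k) → foldr _⊔_ 0 (map f xs) ≤ k
max-≤ f k [] h = z≤n
max-≤ f k (x ∷ xs) h = ⊔-lub (h x) (max-≤ f k xs h)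

≤-max : ∀ {A : Set} (f : A → ℕ) {xs x} → x ∈ₗ xs → f x ≤ foldr _⊔_ 0 (map f xs)
≤-max f {x ∷ xs} (here refl) = m≤m⊔n (f x) _
≤-max f {y ∷ xs} (there m) = ≤-trans (≤-max f m) (m≤n⊔m (f y) _)

record Realised (n m c : ℕ) : Set where
  field
    graph : Graph4 n
    free  : P42-free graph
    size  : #E graph ≡ m
    maxdeg : Δ graph ≤ c

opaque
  -- The graph consists of the first m quadruples. Passing to a prefix preserves distinctness,
  -- freeness and the degree bound, so any sufficiently long list serves.
  realise : ∀ {n m c} (L : List Quadℕ) → Unique L → (∀ {Q} → Q ∈ₗ L → Increasing n Q) → Meeting L → m ≤ length L →
    (∀ k → # (k ∈Q?_) L ≤ c) → Realised n m c
  realise {n} {m} {c} L u inc meets le dg = record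
    { graph = G
    ; free = free
    ; size = trans (length-map set L') (trans (length-take m L) (m≤n⇒m⊓n≡m le))
    ; maxdeg = max-≤ (deg G) c (allFin n) deg≤ }
    where
    L' : List Quadℕ
    L' = take m L
    in-L : ∀ {Q} → Q ∈ₗ L' → Q ∈ₗ L
    in-L = ∈-take m L
    size4' : ∀ {e : Subset n} → e ∈ₗ map set L' → ∣ e ∣ ≡ 4
    size4' me with Q , mQ , refl ← ∈-map⁻ set me = set-size Q (inc (in-L mQ))
    G : Graph4 n
    G = mkGraph4 (map set L') size4' (unique-map set (Uniq.take⁺ m u) λ mx my → set-injective (inc (in-L mx)) (inc (in-L my)))
    free : P42-free G
    free {e} {f} me mf eq with Q , mQ , refl ← ∈-map⁻ set me with Q' , mQ' , refl ← ∈-map⁻ set mf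
      with v , _ , v∈ ← #-∃ (_∈? (set Q ∩ set Q')) V (≤-reflexive (sym (trans (sym (card (set Q ∩ set Q'))) eq)))
      with ve , vf ← x∈p∩q⁻ (set Q) (set Q') v∈
      with j , j≢k , jQ , jQ' ← meets (in-L mQ) (in-L mQ') (∈-set⁻ Q ve) (∈-set⁻ Q' vf)
      with u , refl ← point {n} {Q} (inc (in-L mQ)) jQ =
      contradiction (trans (sym (#-remove _≟F_ (_∈? (set Q ∩ set Q')) V-unique v∈V v∈)) (trans (sym (card (set Q ∩ set Q'))) eq))
        (λ e → #-∄ (λ x → (x ∈? (set Q ∩ set Q')) ×-dec ¬? (x ≟F v)) V (suc-injective e) v∈V (x∈p∩q⁺ (∈-set⁺ Q jQ , ∈-set⁺ Q' jQ') , λ { refl → j≢k refl }))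
    deg≤ : ∀ v → deg G v ≤ c
    deg≤ v = ≤-trans (≤-reflexive (trans (sym (#-length (v ∈?_) (map set L'))) (#-map (v ∈?_) set L')))
      (≤-trans (#-mono _ (toℕ v ∈Q?_) L' λ {Q} _ → ∈-set⁻ Q) (≤-trans (#-take (toℕ v ∈Q?_) m L) (dg (toℕ v))))

pairs : ℕ → List (ℕ × ℕ)
pairs zero = []
pairs (suc k) = map (_, k) (upTo k) ++ pairs k

opaque
  length-pairs : ∀ k → length (pairs k) ≡ tri k
  length-pairs zero = refl
  length-pairs (suc k) = trans (length-++ (map (_, k) (upTo k))) (cong₂ _+_ (trans (length-map (_, k) (upTo k)) (length-upTo k)) (length-pairs k))

  ∈-pairs : ∀ k {i j} → (i , j) ∈ₗ pairs k → i < j × j < k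
  ∈-pairs (suc k) m with ∈-++⁻ (map (_, k) (upTo k)) m
  ... | inj₁ m' with i , mi , refl ← ∈-map⁻ (_, k) m' = ∈-upTo⁻ mi , ≤-refl
  ... | inj₂ m' = let a , b = ∈-pairs k m' in a , m≤n⇒m≤1+n b

  pairs-unique : ∀ k → Unique (pairs k)
  pairs-unique zero = []
  pairs-unique (suc k) = Uniq.++⁺ (Uniq.map⁺ (cong proj₁) (Uniq.upTo⁺ k)) (pairs-unique k) disj
    where
    disj : Disjoint (map (_, k) (upTo k)) (pairs k)
    disj (m , m') with i , mi , refl ← ∈-map⁻ (_, k) m = <-irrefl refl (proj₂ (∈-pairs k m'))

  pairs-at : ∀ t k → # (λ ij → (t ≟ proj₁ ij) ⊎-dec (t ≟ proj₂ ij)) (pairs k) ≤ k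
  pairs-at t zero = ≤-reflexive (#-[] _)
  pairs-at t (suc k) = ≤-trans (≤-reflexive (#-++ T? (map (_, k) (upTo k)) (pairs k))) (cases (t ≟ k))
    where
    T? : ∀ ij → Dec (t ≡ proj₁ ij ⊎ t ≡ proj₂ ij)
    T? ij = (t ≟ proj₁ ij) ⊎-dec (t ≟ proj₂ ij)
    cases : Dec (t ≡ k) → # T? (map (_, k) (upTo k)) + # T? (pairs k) ≤ suc k
    cases (yes e) = ≤-trans (+-mono-≤ (≤-trans (#-≤-length T? (map (_, k) (upTo k))) (≤-reflexive (trans (length-map (_, k) (upTo k)) (length-upTo k))))
      (≤-reflexive (#-none T? (pairs k) (λ {ij} m → none m)))) (≤-trans (≤-reflexive (+-identityʳ k)) (n≤1+n k))
      where
      none : ∀ {ij} → ij ∈ₗ pairs k → ¬ (t ≡ proj₁ ij ⊎ t ≡ proj₂ ij)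
      none m (inj₁ q) = <-irrefl (trans (sym q) e) (<-trans (proj₁ (∈-pairs k m)) (proj₂ (∈-pairs k m)))
      none m (inj₂ q) = <-irrefl (trans (sym q) e) (proj₂ (∈-pairs k m))
    cases (no ne) = +-mono-≤ (≤-trans (≤-reflexive (#-map T? (_, k) (upTo k)))
      (#-only _ (Uniq.upTo⁺ k) λ _ _ p q → trans (sym (first p)) (first q))) (pairs-at t k)
      where
      first : ∀ {i} → t ≡ i ⊎ t ≡ k → t ≡ i
      first (inj₁ e) = e
      first (inj₂ e) = contradiction e ne

  tri≡C : ∀ k → tri k ≡ k choose 2
  tri≡C zero = refl
  tri≡C (suc k) = trans (cong₂ _+_ (sym (nC1≡n k)) (tri≡C k)) (nCk+nC[k+1]≡[n+1]C[k+1] k 1)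

-- the thick clique on the pairs {2h, 2h+1}
thickQ : ℕ × ℕ → Quadℕ
thickQ (i , j) = i + i , suc (i + i) , j + j , suc (j + j)

-- Halving a vertex gives the index of its pair. A common vertex of two edges brings its partner
-- along, and a pair lies in at most n/2 edges; the cruder degree bound n suffices.
thick : ∀ n m → m ≤ half2 n → Realised n m n
thick n m le = realise L (Uniq.map⁺ inj (pairs-unique N)) inc meets
  (≤-trans le (≤-reflexive (sym (trans (length-map thickQ (pairs N)) (trans (length-pairs N) (tri≡C N))))))
  (λ k → ≤-trans (≤-reflexive (#-map (k ∈Q?_) thickQ (pairs N))) (≤-trans (#-mono _ (λ ij → (⌊ k /2⌋ ≟ proj₁ ij) ⊎-dec (⌊ k /2⌋ ≟ proj₂ ij)) (pairs N) (λ _ → halves))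
    (≤-trans (pairs-at ⌊ k /2⌋ N) N≤n)))
  where
  N : ℕ
  N = n / 2
  N+N≤n : N + N ≤ n
  N+N≤n = ≤-trans (≤-reflexive (eq N)) (m/n*n≤m n 2)
    where eq : ∀ a → a + a ≡ a * 2
          eq = solve-∀
  N≤n : N ≤ n
  N≤n = ≤-trans (m≤m+n N N) N+N≤n
  L : List Quadℕ
  L = map thickQ (pairs N)
  half-even : ∀ i → ⌊ i + i /2⌋ ≡ i
  half-even i = sym (n≡⌊n+n/2⌋ i)
  half-odd : ∀ i → ⌊ suc (i + i) /2⌋ ≡ i
  half-odd i = sym (n≡⌈n+n/2⌉ i)
  inj : ∀ {ij kl} → thickQ ij ≡ thickQ kl → ij ≡ kl
  inj {i , j} {k , l} e = cong₂ _,_ (trans (sym (half-even i)) (trans (cong (⌊_/2⌋ ∘ proj₁) e) (half-even k)))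
    (trans (sym (half-even j)) (trans (cong (λ q → ⌊ proj₁ (proj₂ (proj₂ q)) /2⌋) e) (half-even l)))
  halves : ∀ {ij k} → k ∈Q thickQ ij → ⌊ k /2⌋ ≡ proj₁ ij ⊎ ⌊ k /2⌋ ≡ proj₂ ij
  halves {i , j} (inj₁ refl) = inj₁ (half-even i)
  halves {i , j} (inj₂ (inj₁ refl)) = inj₁ (half-odd i)
  halves {i , j} (inj₂ (inj₂ (inj₁ refl))) = inj₂ (half-even j)
  halves {i , j} (inj₂ (inj₂ (inj₂ refl))) = inj₂ (half-odd j)
  even : ∀ {ij h} → h ≡ proj₁ ij ⊎ h ≡ proj₂ ij → h + h ∈Q thickQ ij
  even (inj₁ refl) = inj₁ refl
  even (inj₂ refl) = inj₂ (inj₂ (inj₁ refl))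
  odd : ∀ {ij h} → h ≡ proj₁ ij ⊎ h ≡ proj₂ ij → suc (h + h) ∈Q thickQ ij
  odd (inj₁ refl) = inj₂ (inj₁ refl)
  odd (inj₂ refl) = inj₂ (inj₂ (inj₂ refl))
  inc : ∀ {Q} → Q ∈ₗ L → Increasing n Q
  inc m with (i , j) , mij , refl ← ∈-map⁻ thickQ m with i<j , j<N ← ∈-pairs N mij =
    ≤-refl , ≤-trans (≤-reflexive (cong suc (sym (+-suc i i)))) (+-mono-≤ i<j i<j) , ≤-refl ,
    ≤-trans (≤-reflexive (cong suc (sym (+-suc j j)))) (≤-trans (+-mono-≤ j<N j<N) N+N≤n)
  meets : Meeting L
  meets {k = k} m m' h h' with ij , _ , refl ← ∈-map⁻ thickQ m with kl , _ , refl ← ∈-map⁻ thickQ m' =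
    other (halves {ij} h) (halves {kl} h')
    where
    other : ∀ {ij kl} → ⌊ k /2⌋ ≡ proj₁ ij ⊎ ⌊ k /2⌋ ≡ proj₂ ij → ⌊ k /2⌋ ≡ proj₁ kl ⊎ ⌊ k /2⌋ ≡ proj₂ kl →
      ∃ λ j → j ≢ k × j ∈Q thickQ ij × j ∈Q thickQ kl
    other {ij} {kl} p q with ⌊ k /2⌋ + ⌊ k /2⌋ ≟ k
    ... | no ne = _ , ne , even {ij} p , even {kl} q
    ... | yes e = suc (⌊ k /2⌋ + ⌊ k /2⌋) , (λ e' → m≢1+m+n k (trans (sym e') (cong suc (trans e (sym (+-identityʳ k)))))) , odd {ij} p , odd {kl} q

-- Disjoint stars on consecutive intervals: the one starting at o has centre {o, o + 1}, then its spokes.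
starQ : ℕ → ℕ × ℕ → Quadℕ
starQ o (i , j) = o , suc o , suc (suc (o + i)) , suc (suc (o + j))

-- All edges of a star pass through its centre, so truncation to c edges bounds every degree by c.
oneStar : ℕ → ℕ → ℕ → List Quadℕ
oneStar c o x = map (starQ o) (take c (pairs x))

starsQ : ℕ → ℕ → List ℕ → List Quadℕ
starsQ c o [] = []
starsQ c o (x ∷ xs) = oneStar c o x ++ starsQ c (o + (x + 2)) xs

opaque
  star-mem : ∀ c o x {Q} → Q ∈ₗ oneStar c o x → ∃ λ i → ∃ λ j → (i < j × j < x) × Q ≡ starQ o (i , j)
  star-mem c o x m with (i , j) , mij , e ← ∈-map⁻ (starQ o) m = i , j , ∈-pairs x (∈-take c (pairs x) mij) , e

  star-range : ∀ c o x {Q k} → Q ∈ₗ oneStar c o x → k ∈Q Q → o ≤ k × k < o + (x + 2)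
  star-range c o x m h with i , j , (i<j , j<x) , refl ← star-mem c o x m = range h
    where
    j+2 : ∀ {j} → j < x → suc (suc (o + j)) < o + (x + 2)
    j+2 {j} lt = ≤-trans (≤-reflexive (eq o j)) (+-monoʳ-≤ o (+-monoˡ-≤ 2 lt))
      where
      eq : ∀ o j → suc (suc (suc (o + j))) ≡ o + (suc j + 2)
      eq = solve-∀
    range : ∀ {k} → k ∈Q starQ o (i , j) → o ≤ k × k < o + (x + 2)
    range (inj₁ refl) = ≤-refl , ≤-trans (s≤s (m≤n⇒m≤1+n (m≤n⇒m≤1+n (m≤m+n o j)))) (j+2 j<x)
    range (inj₂ (inj₁ refl)) = n≤1+n o , ≤-trans (s≤s (s≤s (m≤n⇒m≤1+n (m≤m+n o j)))) (j+2 j<x)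
    range (inj₂ (inj₂ (inj₁ refl))) = m≤n⇒m≤1+n (m≤n⇒m≤1+n (m≤m+n o i)) , j+2 (<-trans i<j j<x)
    range (inj₂ (inj₂ (inj₂ refl))) = m≤n⇒m≤1+n (m≤n⇒m≤1+n (m≤m+n o j)) , j+2 j<x

  stars-range : ∀ c o xs {Q k} → Q ∈ₗ starsQ c o xs → k ∈Q Q → o ≤ k × k < o + Σ[ (_+ 2) ] xs
  stars-range c o (x ∷ xs) m h with ∈-++⁻ (oneStar c o x) m
  ... | inj₁ m' = let a , b = star-range c o x m' h in a , ≤-trans b (+-monoʳ-≤ o (m≤m+n (x + 2) _))
  ... | inj₂ m' = let a , b = stars-range c (o + (x + 2)) xs m' h in m+n≤o⇒m≤o o a , ≤-trans b (≤-reflexive (+-assoc o (x + 2) _))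

  stars-increasing : ∀ c o xs {n Q} → o + Σ[ (_+ 2) ] xs ≤ n → Q ∈ₗ starsQ c o xs → Increasing n Q
  stars-increasing c o (x ∷ xs) le m with ∈-++⁻ (oneStar c o x) m
  ... | inj₂ m' = stars-increasing c (o + (x + 2)) xs (≤-trans (≤-reflexive (+-assoc o (x + 2) _)) le) m'
  ... | inj₁ m' with i , j , (i<j , j<x) , refl ← star-mem c o x m' =
    ≤-refl , s≤s (s≤s (m≤m+n o i)) , s≤s (s≤s (+-monoʳ-< o i<j)) ,
    ≤-trans (proj₂ (star-range c o x m' (inj₂ (inj₂ (inj₂ refl))))) (≤-trans (+-monoʳ-≤ o (m≤m+n (x + 2) _)) le)

  stars-meeting : ∀ c o xs → Meeting (starsQ c o xs)
  stars-meeting c o (x ∷ xs) {k = k} m m' h h' with ∈-++⁻ (oneStar c o x) m | ∈-++⁻ (oneStar c o x) m'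
  ... | inj₂ p | inj₂ q = stars-meeting c (o + (x + 2)) xs p q h h'
  ... | inj₁ p | inj₂ q = contradiction (≤-trans (proj₂ (star-range c o x p h)) (proj₁ (stars-range c (o + (x + 2)) xs q h'))) (<-irrefl refl)
  ... | inj₂ p | inj₁ q = contradiction (≤-trans (proj₂ (star-range c o x q h')) (proj₁ (stars-range c (o + (x + 2)) xs p h))) (<-irrefl refl)
  ... | inj₁ p | inj₁ q with i , j , _ , refl ← star-mem c o x p | i' , j' , _ , refl ← star-mem c o x q with o ≟ k
  ...   | no ne = o , ne , inj₁ refl , inj₁ refl
  ...   | yes refl = suc o , (λ ()) ∘ 1+n≢n , inj₂ (inj₁ refl) , inj₂ (inj₁ refl)

  stars-unique : ∀ c o xs → Unique (starsQ c o xs)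
  stars-unique c o [] = []
  stars-unique c o (x ∷ xs) = Uniq.++⁺ (Uniq.map⁺ inj (Uniq.take⁺ c (pairs-unique x))) (stars-unique c (o + (x + 2)) xs)
    λ { {Q} (p , q) → <-irrefl refl (≤-trans (proj₂ (star-range c o x p (inj₁ refl))) (proj₁ (stars-range c (o + (x + 2)) xs q (inj₁ refl)))) }
    where
    inj : ∀ {ij kl} → starQ o ij ≡ starQ o kl → ij ≡ kl
    inj e = cong₂ _,_ (+-cancelˡ-≡ o _ _ (suc-injective (suc-injective (cong (proj₁ ∘ proj₂ ∘ proj₂) e))))
      (+-cancelˡ-≡ o _ _ (suc-injective (suc-injective (cong (proj₂ ∘ proj₂ ∘ proj₂) e))))

  stars-degree : ∀ c o xs k → # (k ∈Q?_) (starsQ c o xs) ≤ c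
  stars-degree c o [] k = ≤-trans (≤-reflexive (#-[] _)) z≤n
  stars-degree c o (x ∷ xs) k = ≤-trans (≤-reflexive (#-++ (k ∈Q?_) first later)) (cases (k <? o + (x + 2)))
    where
    first later : List Quadℕ
    first = oneStar c o x
    later = starsQ c (o + (x + 2)) xs
    cases : Dec (k < o + (x + 2)) → # (k ∈Q?_) first + # (k ∈Q?_) later ≤ c
    cases (yes lt) = ≤-trans (+-mono-≤ (≤-trans (#-≤-length (k ∈Q?_) first) (≤-trans (≤-reflexive (trans (length-map (starQ o) (take c (pairs x))) (length-take c (pairs x)))) (m⊓n≤m c _)))
        (≤-reflexive (#-none (k ∈Q?_) later λ m h → <-irrefl refl (≤-trans lt (proj₁ (stars-range c (o + (x + 2)) xs m h))))))
      (≤-reflexive (+-identityʳ c))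
    cases (no ¬lt) = ≤-trans (+-monoˡ-≤ _ (≤-reflexive (#-none (k ∈Q?_) first λ m h → ¬lt (proj₂ (star-range c o x m h)))))
      (stars-degree c (o + (x + 2)) xs k)

  stars-length : ∀ c o xs → length (starsQ c o xs) ≡ Σ[ cap c ] xs
  stars-length c o [] = refl
  stars-length c o (x ∷ xs) = trans (length-++ (oneStar c o x)) (cong₂ _+_
    (trans (length-map (starQ o) (take c (pairs x))) (trans (length-take c (pairs x)) (trans (cong (c ⊓_) (length-pairs x)) (⊓-comm c (tri x)))))
    (stars-length c (o + (x + 2)) xs))

stars : ∀ n m c xs → Σ[ (_+ 2) ] xs ≤ n → m ≤ Σ[ cap c ] xs → Realised n m c
stars n m c xs fit le = realise (starsQ c 0 xs) (stars-unique c 0 xs) (stars-increasing c 0 xs fit) (stars-meeting c 0 xs)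
  (≤-trans le (≤-reflexive (sym (stars-length c 0 xs)))) (stars-degree c 0 xs)

-- Comparison with the size of the thick clique

opaque
  half-bound : ∀ r k → r ≤ 1 → 1 ≤ k → (r + k * 2) * (r + k * 2) + 3 ≤ 8 * tri k + 4 * (r + k * 2)
  half-bound r k hr hk = conclude (tri-≥ k ⊛ 4 ⊕ cross hr hk ⊛ 4 ⊕ (r ⊗ hr) ⊕ hr) (eq r k (tri k))
    where
    eq : ∀ r k t →
      (r + k * 2) * (r + k * 2) + 3 + ((2 * t + k) * 4 + (r * 1 + 1 * k) * 4 + r * 1 + 1) + (0)
      ≡ 8 * t + 4 * (r + k * 2) + (k * k * 4 + (r * k + 1 * 1) * 4 + r * r + r)
    eq = solve-∀

  -- Measures the loss caused by the y + ℓ vertices that are not high, using that a spoke accounts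
  -- for at most n/20 edges. The requirement 900 ≤ n absorbs the coarse term: 900 · 2 = 5 · 360.
  deficit : ∀ y ℓ H S ρ t → 900 ≤ (y + ℓ + H) → 20 * S ≤ (y + ℓ + H) * y → Bound₂ ρ ℓ H → 5 * t ≤ 5 * (S + ρ) + (y + ℓ + H) → (y + ℓ + H) * (y + ℓ + H) + 3 ≤ 8 * t + 4 * (y + ℓ + H) →
      3 * ((y + ℓ) * (y + ℓ)) + 8 * ((y + ℓ) * H) + 15 ≤ (y + ℓ) * 28 + H * 18
  deficit y ℓ H S ρ t hn hS hb hm h = conclude (h ⊛ 5 ⊕ hm ⊛ 8 ⊕ hS ⊛ 2 ⊕ hb ⊛ 5 ⊕ (ℓ ⊗ hn) ⊛ 2) (eq y ℓ H S ρ t)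
    where
    eq : ∀ y ℓ H S ρ t →
      3 * ((y + ℓ) * (y + ℓ)) + 8 * ((y + ℓ) * H) + 15 + ((8 * t + 4 * (y + ℓ + H)) * 5 + (5 * (S + ρ) + (y + ℓ + H)) * 8 + (y + ℓ + H) * y * 2 + (360 * ℓ + H * H) * 5 + ℓ * (y + ℓ + H) * 2) + (0)
      ≡ (y + ℓ) * 28 + H * 18 + (((y + ℓ + H) * (y + ℓ + H) + 3) * 5 + 5 * t * 8 + 20 * S * 2 + (8 * ρ + 2 * H) * 5 + ℓ * 900 * 2)
    eq = solve-∀

  -- For large H the inequality reads 8p ≤ 18. The tolerance n/5 in the number of edges is part of
  -- the 18 and still excludes p = 3.
  deficit≤2 : ∀ p H → 1000 ≤ p + H → 3 * (p * p) + 8 * (p * H) + 15 ≤ p * 28 + H * 18 → p ≤ 2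
  deficit≤2 p H hn h with p ≤? 2
  ... | yes q = q
  ... | no ¬q with 10 ≤? p
  ...   | yes q = ⊥-elim (refute (h ⊕ (p ⊗ q) ⊛ 3 ⊕ (H ⊗ q) ⊛ 8) (eq p H))
      where
      eq : ∀ p H →
        (3 * (p * p) + 8 * (p * H) + 15) + p * 10 * 3 + H * 10 * 8
        ≡ (p * 28 + H * 18) + p * p * 3 + H * p * 8 + suc (H * 62 + p * 2 + 14)
      eq = solve-∀

  ...   | no ¬q′ = ⊥-elim (refute (h ⊕ (H ⊗ ≰⇒> ¬q) ⊛ 8 ⊕ ≤-pred (≰⇒> ¬q′) ⊛ 34 ⊕ hn ⊛ 6) (eq p H))
      where
      eq : ∀ p H →
        (3 * (p * p) + 8 * (p * H) + 15) + H * 3 * 8 + p * 34 + 1000 * 6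
        ≡ (p * 28 + H * 18) + H * p * 8 + 9 * 34 + (p + H) * 6 + suc (p * p * 3 + 5708)
      eq = solve-∀

  -- H² falls short of n² by ℓn + ℓH. Once ℓ ≥ 2, neither 364ℓ nor 2H can make up for it.
  two-low : ∀ ℓ H ρ → 400008 ≤ (ℓ + H) → 2 ≤ ℓ → Bound₂ ρ ℓ H → ¬ (ℓ + H) * (ℓ + H) + 11 ≤ 8 * ρ + 4 * (ℓ + H)
  two-low ℓ H ρ hn hl hb h = refute (h ⊕ hb ⊕ (H ⊗ hl) ⊕ (ℓ ⊗ hn)) (eq ℓ H ρ)
    where
    eq : ∀ ℓ H ρ →
      ((ℓ + H) * (ℓ + H) + 11) + (8 * ρ + 2 * H) + H * 2 + ℓ * 400008
      ≡ (8 * ρ + 4 * (ℓ + H)) + (360 * ℓ + H * H) + H * ℓ + ℓ * (ℓ + H) + suc (ℓ * 399644 + 10)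
    eq = solve-∀

  even-all : ∀ k m → 1 + tri k ≤ m → ¬ 8 * m + 2 * (k * 2) ≤ k * 2 * (k * 2)
  even-all k m hm h = refute (h ⊕ hm ⊛ 8 ⊕ tri-≥ k ⊛ 4) (eq k m (tri k))
    where
    eq : ∀ k m t → (8 * m + 2 * (k * 2)) + (1 + t) * 8 + k * k * 4 ≡ k * 2 * (k * 2) + m * 8 + (2 * t + k) * 4 + suc (7)
    eq = solve-∀

  even-but-one : ∀ k m H → H + 1 ≡ k * 2 → 1 + tri k ≤ m → ¬ 8 * m + 2 * H ≤ H * H
  even-but-one k m H hH hm h = refute (h ⊕ hm ⊛ 8 ⊕ tri-≥ k ⊛ 4 ⊕ ≤-reflexive (sym hH) ⊛ 4 ⊕ ≤-reflexive (cong (λ z → z * z) hH)) (eq k m H (tri k))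
    where
    eq : ∀ k m H t →
      (8 * m + 2 * H) + (1 + t) * 8 + k * k * 4 + k * 2 * 4 + (H + 1) * (H + 1)
      ≡ H * H + m * 8 + (2 * t + k) * 4 + (H + 1) * 4 + k * 2 * (k * 2) + suc (k * 4 + 4)
    eq = solve-∀

  private
    half-positive : ∀ n r → 2 ≤ n → r ≤ 1 → n ≡ r + n / 2 * 2 → 1 ≤ n / 2
    half-positive n r n≥2 r≤1 eq with n / 2
    ... | suc _ = s≤s z≤n
    ... | zero = contradiction (≤-trans n≥2 (≤-reflexive (trans eq (+-identityʳ r)))) (<⇒≱ (s≤s r≤1))

  parity : ∀ n → n ≡ n / 2 * 2 ⊎ n ≡ 1 + n / 2 * 2
  parity n = go (n % 2) (m%n<n n 2) (m≡m%n+[m/n]*n n 2)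
    where
    go : ∀ r → r < 2 → n ≡ r + n / 2 * 2 → n ≡ n / 2 * 2 ⊎ n ≡ 1 + n / 2 * 2
    go zero _ eq = inj₁ eq
    go (suc zero) _ eq = inj₂ eq
    go (suc (suc _)) (s≤s (s≤s ())) _

  -- For odd n this is an equality, as `half2 n` is (n - 1)(n - 3)/8; for even n there is a linear
  -- surplus.
  half-below : ∀ n → 2 ≤ n → n * n + 3 ≤ 8 * half2 n + 4 * n
  half-below n n≥2 = subst (λ z → z * z + 3 ≤ 8 * half2 n + 4 * z) (sym eq)
    (subst (λ t → (n % 2 + n / 2 * 2) * (n % 2 + n / 2 * 2) + 3 ≤ 8 * t + 4 * (n % 2 + n / 2 * 2)) (tri≡C (n / 2))
      (half-bound (n % 2) (n / 2) r≤1 (half-positive n (n % 2) n≥2 r≤1 eq)))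
    where
    eq : n ≡ n % 2 + n / 2 * 2
    eq = m≡m%n+[m/n]*n n 2
    r≤1 : n % 2 ≤ 1
    r≤1 = ≤-pred (m%n<n n 2)

  half-above : ∀ n m → 2 ≤ n → suc (half2 n) ≤ m → n * n + 11 ≤ 8 * m + 4 * n
  half-above n m n≥2 le = conclude (half-below n n≥2 ⊕ le ⊛ 8) (eq n m (half2 n))
    where
    eq : ∀ n m t → n * n + 11 + ((8 * t + 4 * n) + m * 8) + (0) ≡ 8 * m + 4 * n + ((n * n + 3) + (1 + t) * 8)
    eq = solve-∀

length-V : ∀ {n} → length (V {n}) ≡ n
length-V = length-tabulate (λ i → i)

opaque
  #-three : ∀ {n} {P : Fin n → Set} (P? : Decidable P) → # P? V ≤ 2 → ∀ {x y z} → P x → P y → P z → x ≢ y → x ≢ z → y ≡ z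
  #-three P? le {x} {y} {z} px py pz xy xz with y ≟F z
  ... | yes p = p
  ... | no yz = contradiction (≤-trans (≤-reflexive (sym (trans (#-remove _≟F_ P? V-unique v∈V px)
    (cong suc (#-remove _≟F_ (λ v → P? v ×-dec ¬? (v ≟F x)) V-unique v∈V (py , xy ∘ sym))))))  le)
    (<⇒≱ (s≤s (s≤s (#-pos (λ v → (P? v ×-dec ¬? (v ≟F x)) ×-dec ¬? (v ≟F y)) V v∈V ((pz , xz ∘ sym) , yz ∘ sym)))))

-- The pairing given by twins

module Twin {n : ℕ} {E : List (Subset n)} (F : Family E) (T : Deg₃≤ 3 E) where
  open Triples≤3 F T

  low? : ∀ v → Dec (¬ High E v)
  low? v = ¬? (high? E v)

  partner? : ∀ v → Dec (∃ λ u → u ≢ v × ¬ High E u)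
  partner? v = any? λ u → ¬? (u ≟F v) ×-dec low? u

  pick : ∀ v → Dec (High E v) → Dec (∃ λ u → u ≢ v × ¬ High E u) → Fin n
  pick v (yes h) _ = proj₁ (high⇒sun h)
  pick v (no _) (yes (u , _)) = u
  pick v (no _) (no _) = v

  -- Twins are paired; if there are two low vertices, they form a pair.
  mate : Fin n → Fin n
  mate v = pick v (high? E v) (partner? v)

  data Mate (v : Fin n) : Fin n → Set where
    twin  : ∀ {u} → High E v → v ≢ u → Sun E v u → Mate v u
    lows  : ∀ {u} → ¬ High E v → u ≢ v → ¬ High E u → Mate v u
    alone : ¬ High E v → ¬ (∃ λ u → u ≢ v × ¬ High E u) → Mate v v

  opaque
    mate-spec : ∀ v → Mate v (mate v)
    mate-spec v = spec (high? E v) (partner? v)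
      where
      spec : (d : Dec (High E v)) (d' : Dec (∃ λ u → u ≢ v × ¬ High E u)) → Mate v (pick v d d')
      spec (yes h) _ = twin h (proj₁ (proj₂ (high⇒sun h))) (proj₂ (proj₂ (high⇒sun h)))
      spec (no ¬h) (yes (u , ne , ¬h')) = lows ¬h ne ¬h'
      spec (no ¬h) (no ¬p) = alone ¬h ¬p

    twin-back : ∀ {v u w} → High E v → v ≢ u → Sun E v u → Mate u w → w ≡ v
    twin-back h ne s (twin h' ne' s') = sym (twin-unique s' (ne ∘ sym) (twins-sym (sun⇒twins F ne s)))
    twin-back h ne s (lows ¬h' _ _) = contradiction (twin-high (sun⇒twins F ne s) h) ¬h'
    twin-back h ne s (alone ¬h' _) = contradiction (twin-high (sun⇒twins F ne s) h) ¬h'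

    mate-involutive : # low? V ≤ 2 → ∀ v → mate (mate v) ≡ v
    mate-involutive le v = go (mate-spec v) (mate-spec (mate v))
      where
      go : ∀ {u w} → Mate v u → Mate u w → w ≡ v
      go (twin h ne s) q = twin-back h ne s q
      go (lows ¬h ne ¬h') (twin h' _ _) = contradiction h' ¬h'
      go (lows ¬h ne ¬h') (lows _ ne' ¬h'') = #-three low? le ¬h' ¬h'' ¬h (ne' ∘ sym) ne
      go (lows ¬h ne ¬h') (alone _ ¬p) = contradiction (v , ne ∘ sym , ¬h) ¬p
      go (alone ¬h ¬p) (twin h _ _) = contradiction h ¬h
      go (alone ¬h ¬p) (lows _ ne ¬h') = contradiction (_ , ne , ¬h') ¬p
      go (alone ¬h ¬p) (alone _ _) = refl

    mate-fixed : ∀ u v → mate u ≡ u → mate v ≡ v → u ≡ v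
    mate-fixed u v eu ev = go (subst (Mate u) eu (mate-spec u)) (subst (Mate v) ev (mate-spec v))
      where
      same : ¬ (∃ λ w → w ≢ u × ¬ High E w) → ¬ High E v → u ≡ v
      same ¬p ¬h with u ≟F v
      ... | yes e = e
      ... | no ne = contradiction (v , ne ∘ sym , ¬h) ¬p
      go : Mate u u → Mate v v → u ≡ v
      go (twin _ ne _) _ = contradiction refl ne
      go (lows _ ne _) _ = contradiction refl ne
      go (alone ¬h ¬p) (twin _ ne _) = contradiction refl ne
      go (alone ¬h ¬p) (lows _ ne _) = contradiction refl ne
      go (alone ¬h ¬p) (alone ¬h' _) = same ¬p ¬h'

    -- By `low-not-alone` a low vertex of an edge is accompanied by another one in this edge; with
    -- at most two low vertices this must be its mate.
    mate-edge : # low? V ≤ 2 → ∀ {e v} → e ∈ₗ E → v ∈ e → mate v ∈ e × mate v ≢ v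
    mate-edge le {e} {v} m ve = go (mate-spec v)
      where
      go : ∀ {u} → Mate v u → u ∈ e × u ≢ v
      go (twin h ne s) = proj₁ (All.lookup (sun⇒twins F ne s) m) ve , ne ∘ sym
      go (lows ¬h ne ¬h') = let w , w≢v , we , ¬h'' = low-not-alone m ve ¬h in
        subst (_∈ e) (#-three low? le ¬h ¬h'' ¬h' (w≢v ∘ sym) (ne ∘ sym)) we , ne
      go (alone ¬h ¬p) = let w , w≢v , we , ¬h'' = low-not-alone m ve ¬h in contradiction (w , w≢v , ¬h'') ¬p

  pairing : # low? V ≤ 2 → Pairing n
  pairing le = record { σ = mate ; invol = mate-involutive le ; fixed≤1 = mate-fixed }

  opaque
    -- an involution without fixed points moves as many points up as down
    all-high⇒even : # low? V ≡ 0 → ∃ λ a → n ≡ a + a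
    all-high⇒even none = # up? V , trans (sym length-V) (trans (sym (#-compl up? V)) (cong (# up? V +_)
      (trans (#-≐ (λ v → ¬? (up? v)) down? V (λ {v} _ ¬up → not-up v ¬up) (λ _ d u → <-asym d u)) (sym up≡down))))
      where
      le : # low? V ≤ 2
      le = ≤-trans (≤-reflexive none) z≤n
      up? : ∀ v → Dec (toℕ v < toℕ (mate v))
      up? v = toℕ v <? toℕ (mate v)
      down? : ∀ v → Dec (toℕ (mate v) < toℕ v)
      down? v = toℕ (mate v) <? toℕ v
      moved : ∀ v → mate v ≢ v
      moved v eq = go (subst (Mate v) eq (mate-spec v))
        where
        go : Mate v v → ⊥
        go (twin _ ne _) = ne refl
        go (lows _ ne _) = ne refl
        go (alone ¬h _) = #-∄ low? V none v∈V ¬h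
      not-up : ∀ v → ¬ toℕ v < toℕ (mate v) → toℕ (mate v) < toℕ v
      not-up v ¬up with <-cmp (toℕ v) (toℕ (mate v))
      ... | tri< lt _ _ = contradiction lt ¬up
      ... | tri≈ _ eq _ = contradiction (sym (toℕ-injective eq)) (moved v)
      ... | tri> _ _ gt = gt
      R? : ∀ v u → Dec (u ≡ mate v × toℕ v < toℕ u)
      R? v u = (u ≟F mate v) ×-dec (toℕ v <? toℕ u)
      back : ∀ {v u} → u ≡ mate v × toℕ v < toℕ u → v ≡ mate u
      back {v} (refl , _) = sym (mate-involutive le v)
      up≡down : # up? V ≡ # down? V
      up≡down = trans (sym (*-identityˡ _)) (trans (sym (Σ-# up? (λ v → # (R? v) V) 1 V
          (λ {v} _ u → ≤-antisym (#-only (R? v) V-unique λ _ _ p q → trans (proj₁ p) (sym (proj₁ q))) (#-pos (R? v) V v∈V (refl , u)))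
          (λ {v} _ ¬u → #-none (R? v) V λ { _ (refl , lt) → ¬u lt })))
        (trans (double-count R? V V) (trans (Σ-# down? (λ u → # (λ v → R? v u) V) 1 V
          (λ {u} _ d → ≤-antisym (#-only (λ v → R? v u) V-unique λ _ _ p q → trans (back p) (sym (back q)))
            (#-pos (λ v → R? v u) V v∈V (sym (mate-involutive le u) , d)))
          (λ {u} _ ¬d → #-none (λ v → R? v u) V λ { {v} _ (e , lt) → ¬d (subst (λ z → toℕ z < toℕ u) (back (e , lt)) lt) }))
        (*-identityˡ _))))

    -- An edge with a low vertex would contain two, so every edge is counted by `highs-bound`.
    one-low-bound : # low? V ≤ 1 → 8 * length E + 2 * # (high? E) V ≤ # (high? E) V * # (high? E) V
    one-low-bound le = ≤-trans (+-monoˡ-≤ (2 * # (high? E) V) (*-monoʳ-≤ 8 all-edges)) (highs-bound F T {W = λ _ → ⊤} (λ _ → yes tt) (λ _ _ → tt))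
      where
      ah? : ∀ e → Dec (AllHigh F T {W = λ _ → ⊤} (λ _ → yes tt) (λ _ _ → tt) e)
      ah? = allHigh? F T {W = λ _ → ⊤} (λ _ → yes tt) (λ _ _ → tt)
      all-edges : length E ≤ # ah? E
      all-edges = ≤-trans (≤-reflexive (trans (sym (#-compl ah? E)) (trans (cong (# ah? E +_) (#-none (λ e → ¬? (ah? e)) E λ m ¬a → ¬a (bad m))) (+-identityʳ _)))) ≤-refl
        where
        bad : ∀ {e} → e ∈ₗ E → ¬ (∃ λ v → v ∈ e × ¬ High E v)
        bad m (v , ve , ¬h) with u , u≢v , ue , ¬h' ← low-not-alone m ve ¬h =
          contradiction (≤-trans (≤-reflexive (sym (#-remove _≟F_ low? V-unique v∈V ¬h))) le)
            (<⇒≱ (s≤s (#-pos (λ w → low? w ×-dec ¬? (w ≟F v)) V v∈V (¬h' , u≢v))))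

-- With at most one low vertex every edge consists of high vertices; for odd n the twin involution forces a low vertex.
opaque
  no-centers : ∀ {n m} {E : List (Subset n)} → 400008 ≤ n → (F : Family E) → Rest E {W = λ _ → ⊤} (λ _ → yes tt) → length E ≡ m → ¬ suc (half2 n) ≤ m
  no-centers {n} {m} {E} hN F R refl hm = cases (2 ≤? ℓ)
    where
    open Rest R
    n≥2 : 2 ≤ n
    n≥2 = ≤-trans (m≤m+n 2 400006) hN
    ℓ+H : ℓ + H ≡ n
    ℓ+H = trans total everything
      where
      T? : (v : Fin n) → Dec ⊤
      T? _ = yes tt
      everything : # T? (V {n}) ≡ n
      everything = trans (sym (+-identityʳ (# T? V))) (trans (cong (# T? V +_) (sym (#-none (λ v → ¬? (T? v)) (V {n}) λ _ ¬t → ¬t tt)))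
        (trans (#-compl T? (V {n})) length-V))
    cases : Dec (2 ≤ ℓ) → ⊥
    cases (yes h) = two-low ℓ H (length E) (≤-trans hN (≤-reflexive (sym ℓ+H))) h bound₂
      (subst (λ z → z * z + 11 ≤ 8 * length E + 4 * z) (sym ℓ+H) (half-above n (length E) n≥2 hm))
    cases (no ¬h) = odd-even (parity n)
      where
      ℓ≤1 : ℓ ≤ 1
      ℓ≤1 = ≤-pred (≰⇒> ¬h)
      fl : Deg₃≤ 3 E × H ≡ # (high? E) V
      fl = few-low (≤-trans ℓ≤1 (m≤m+n 1 2))
      open Twin F (λ {a} {b} {c} → proj₁ fl {a} {b} {c})
      low≡ℓ : # low? V ≡ ℓ
      low≡ℓ = +-cancelʳ-≡ H _ _ (trans (cong (# low? V +_) (proj₂ fl)) (trans (+-comm (# low? V) _) (trans (#-compl (high? E) V) (trans length-V (sym ℓ+H)))))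
      bound : 8 * length E + 2 * H ≤ H * H
      bound = subst (λ z → 8 * length E + 2 * z ≤ z * z) (sym (proj₂ fl)) (one-low-bound (≤-trans (≤-reflexive low≡ℓ) ℓ≤1))
      hm' : 1 + tri (n / 2) ≤ length E
      hm' = ≤-trans (≤-reflexive (cong suc (tri≡C (n / 2)))) hm
      split : ℓ ≡ 0 ⊎ ℓ ≡ 1
      split with ℓ | ℓ≤1
      ... | zero | _ = inj₁ refl
      ... | suc zero | _ = inj₂ refl
      ... | suc (suc _) | s≤s ()
      H≡ : ∀ {k} → ℓ ≡ k → k + H ≡ n
      H≡ e = trans (cong (_+ H) (sym e)) ℓ+H
      even : ∀ {z} → z ≡ n / 2 * 2 → ¬ 8 * length E + 2 * z ≤ z * z
      even refl = even-all (n / 2) (length E) hm'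
      odd-even : n ≡ n / 2 * 2 ⊎ n ≡ 1 + n / 2 * 2 → ⊥
      odd-even (inj₁ e) with split
      ... | inj₁ z = even (trans (H≡ z) e) bound
      ... | inj₂ z = even-but-one (n / 2) (length E) H (trans (+-comm H 1) (trans (H≡ z) e)) hm' bound
      odd-even (inj₂ e) with split
      ... | inj₂ z = even (suc-injective (trans (H≡ z) e)) bound
      ... | inj₁ z with a , ea ← all-high⇒even (trans low≡ℓ z) = not-both a (n / 2) (trans (sym ea) e)
        where
        not-both : ∀ a k → a + a ≢ 1 + k * 2
        not-both a k h = contradiction (trans (n≡⌊n+n/2⌋ a) (trans (cong ⌊_/2⌋ h) (half-odd k))) (λ { refl → 1+n≢n (sym (trans (sym (double a)) h)) })
          where
          double : ∀ k → k + k ≡ k * 2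
          double = solve-∀
          half-odd : ∀ k → ⌊ 1 + k * 2 /2⌋ ≡ k
          half-odd k = trans (cong (λ z → ⌊ suc z /2⌋) (sym (double k))) (sym (n≡⌈n+n/2⌉ k))

-- From families back to graphs: the two statements

unique-↭ : ∀ {A : Set} {xs ys : List A} → xs ↭ ys → Unique xs → Unique ys
unique-↭ refl u = u
unique-↭ (prep x p) (x∉ ∷ u) = All-resp-↭ p x∉ ∷ unique-↭ p u
unique-↭ (swap x y p) ((xy ∷ x∉) ∷ (y∉ ∷ u)) = (xy ∘ sym ∷ All-resp-↭ p y∉) ∷ (All-resp-↭ p x∉ ∷ unique-↭ p u)
unique-↭ (↭.trans p q) u = unique-↭ q (unique-↭ p u)

opaque
  graph-family : ∀ {n} (G : Graph4 n) → P42-free G → Family (edges G)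
  graph-family G free = record
    { four = λ m → trans (sym (card _)) (size4 G m)
    ; uniq = distinct G
    ; meet = λ {e} {f} {v} me mf ve vf → other me mf ve vf }
    where
    other : ∀ {e f v} → e ∈ₗ edges G → f ∈ₗ edges G → v ∈ e → v ∈ f → ∃ λ u → u ≢ v × u ∈ e × u ∈ f
    other {e} {f} {v} me mf ve vf = found (# (λ u → (u ∈? (e ∩ f)) ×-dec ¬? (u ≟F v)) V) refl
      where
      count : ∣ e ∩ f ∣ ≡ suc (# (λ u → (u ∈? (e ∩ f)) ×-dec ¬? (u ≟F v)) V)
      count = trans (card (e ∩ f)) (#-remove _≟F_ (_∈? (e ∩ f)) V-unique v∈V (x∈p∩q⁺ (ve , vf)))
      found : ∀ k → # (λ u → (u ∈? (e ∩ f)) ×-dec ¬? (u ≟F v)) V ≡ k → ∃ λ u → u ≢ v × u ∈ e × u ∈ f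
      found zero eq = contradiction (trans count (cong suc eq)) (free me mf)
      found (suc k) eq = let u , _ , u∈ , ne = #-∃ (λ u → (u ∈? (e ∩ f)) ×-dec ¬? (u ≟F v)) V (subst (1 ≤_) (sym eq) (s≤s z≤n))
                             ue , uf = x∈p∩q⁻ e f u∈ in u , ne , ue , uf

  deg₁≤Δ : ∀ {n} (G : Graph4 n) v → deg₁ v (edges G) ≤ Δ G
  deg₁≤Δ G v = ≤-trans (≤-reflexive (#-length (v ∈?_) (edges G))) (≤-max (deg G) (∈-allFin v))

module _ {n : ℕ} {E : List (Subset n)} (F : Family E) where
  open Stars F

  opaque
    no-centers⇒rest : centers ≡ [] → RestE ≡ E
    no-centers⇒rest none = filter-all (λ e → ¬? (anyTouch? e)) (All.tabulate λ {e} _ t → absurd (subst (Any (λ i → Touch i e)) none t))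
      where
      absurd : ∀ {e} → ¬ Any (λ i → Touch i e) []
      absurd ()

    -- A single star already has five spokes.
    no-spokes⇒no-centers : Σ[ X ] centers ≤ 4 → centers ≡ []
    no-spokes⇒no-centers le = go centers (λ m → m) le
      where
      go : ∀ is → (∀ {i} → i ∈ₗ is → i ∈ₗ centers) → Σ[ X ] is ≤ 4 → is ≡ []
      go [] _ _ = refl
      go ((a , b) ∷ is) sub le = contradiction (≤-trans (5≤X (proj₂ (∈-centers⁻ (sub (here refl))))) (m+n≤o⇒m≤o (X (a , b)) le)) (<⇒≱ ≤-refl)

  InStar : Fin n × Fin n → Fin n → Set
  InStar i v = (v ≡ proj₁ i ⊎ v ≡ proj₂ i) ⊎ Spoke i v

  inStar? : ∀ i v → Dec (InStar i v)
  inStar? i v = ((v ≟F proj₁ i) ⊎-dec (v ≟F proj₂ i)) ⊎-dec spoke? i v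

  opaque
    stars-disjoint : ∀ {i j v} → i ∈ₗ centers → j ∈ₗ centers → InStar i v → InStar j v → i ≡ j
    stars-disjoint m m' (inj₂ s) (inj₂ s') = spokes-disjoint m m' s s'
    stars-disjoint m m' (inj₁ (inj₁ refl)) (inj₂ s) = contradiction s (center-not-spoke (proj₂ (∈-centers⁻ m')) (proj₂ (∈-centers⁻ m)))
    stars-disjoint m m' (inj₁ (inj₂ refl)) (inj₂ s) = contradiction s (center-not-spoke (proj₂ (∈-centers⁻ m')) (center-sym (proj₂ (∈-centers⁻ m))))
    stars-disjoint m m' (inj₂ s) (inj₁ (inj₁ refl)) = contradiction s (center-not-spoke (proj₂ (∈-centers⁻ m)) (proj₂ (∈-centers⁻ m')))
    stars-disjoint m m' (inj₂ s) (inj₁ (inj₂ refl)) = contradiction s (center-not-spoke (proj₂ (∈-centers⁻ m)) (center-sym (proj₂ (∈-centers⁻ m'))))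
    stars-disjoint m m' (inj₁ p) (inj₁ q) = same-hub m m' p q

  module _ (ks rs : List (Fin n × Fin n)) (p : centers ↭ ks ++ rs) where

    kept? : ∀ e → Dec (Any (λ i → Touch i e) ks)
    kept? e = Any.any? (λ i → touch? i e) ks

    Kept : List (Subset n)
    Kept = filter kept? E

    opaque
      kept⊆ : ∀ {i} → i ∈ₗ ks → i ∈ₗ centers
      kept⊆ m = ∈-resp-↭ (↭-sym p) (∈-++⁺ˡ m)

      kept-unique : Unique ks
      kept-unique = left ks (unique-↭ p centers-unique)
        where
        left : ∀ xs {ys : List (Fin n × Fin n)} → Unique (xs ++ ys) → Unique xs
        left [] u = []
        left (x ∷ xs) (x∉ ∷ u) = All.tabulate (λ m → All.lookup x∉ (∈-++⁺ˡ m)) ∷ left xs u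

      kept-count : length E ∸ length Kept ≤ Σ[ ed ] rs + length RestE
      kept-count = m≤n+o⇒m∸n≤o (length E) (length Kept) (≤-reflexive (begin
        length E                                           ≡⟨ edge-count ⟨
        Σ[ ed ] centers + length RestE                     ≡⟨ cong (_+ length RestE) (trans (Σ-↭ ed p) (Σ-++ ed ks rs)) ⟩
        Σ[ ed ] ks + Σ[ ed ] rs + length RestE             ≡⟨ +-assoc (Σ[ ed ] ks) _ _ ⟩
        Σ[ ed ] ks + (Σ[ ed ] rs + length RestE)           ≡⟨ cong (_+ (Σ[ ed ] rs + length RestE)) (trans (Σ-#-any touch? kept-unique E λ m m' me → touch-disjoint (kept⊆ m) (kept⊆ m') me) (#-length kept? E)) ⟩
        length Kept + (Σ[ ed ] rs + length RestE)          ∎))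
        where open ≡.≡-Reasoning

    -- A vertex outside all kept stars receives the default colour; no kept edge contains it,
    -- because an edge touching a star lies inside that star.
    colour-of : Fin (length ks) → ∀ v → Dec (∃ λ i → InStar (lookup ks i) v) → Fin (length ks)
    colour-of _ v (yes (i , _)) = i
    colour-of d v (no _) = d

    opaque
      kept-stars-union : 1 ≤ length ks → UnionOf2Stars (length ks) Kept
      kept-stars-union pos = (λ i → proj₁ (lookup ks i)) , (λ i → proj₂ (lookup ks i)) , c , ne , covered
        where
        c : Fin n → Fin (length ks)
        c v = colour-of (fromℕ< pos) v (any? λ i → inStar? (lookup ks i) v)
        ne : ∀ i → proj₁ (lookup ks i) ≢ proj₂ (lookup ks i)
        ne i = proj₁ (proj₂ (∈-centers⁻ (kept⊆ (∈-lookup i))))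
        lookup-inj : ∀ (xs : List (Fin n × Fin n)) → Unique xs → ∀ i j → lookup xs i ≡ lookup xs j → i ≡ j
        lookup-inj (x ∷ xs) (x∉ ∷ u) zero zero e = refl
        lookup-inj (x ∷ xs) (x∉ ∷ u) zero (suc j) e = contradiction e (All.lookup x∉ (∈-lookup j))
        lookup-inj (x ∷ xs) (x∉ ∷ u) (suc i) zero e = contradiction (sym e) (All.lookup x∉ (∈-lookup i))
        lookup-inj (x ∷ xs) (x∉ ∷ u) (suc i) (suc j) e = cong suc (lookup-inj xs u i j e)
        colour : ∀ i v (d : Dec (∃ λ i → InStar (lookup ks i) v)) → InStar (lookup ks i) v → colour-of (fromℕ< pos) v d ≡ i
        colour i v (yes (j , s')) s = lookup-inj ks kept-unique j i (stars-disjoint (kept⊆ (∈-lookup j)) (kept⊆ (∈-lookup i)) s' s)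
        colour i v (no ¬s) s = contradiction (i , s) ¬s
        covered : ∀ {e} → e ∈ₗ Kept → ∃ λ i → proj₁ (lookup ks i) ∈ e × proj₂ (lookup ks i) ∈ e × (∀ v → v ∈ e → c v ≡ i)
        covered {e} m = i , proj₁ ab , proj₂ ab , λ v ve → colour i v (any? λ i → inStar? (lookup ks i) v) (inside-star (touch⇒inside C me t ve))
          where
          me : e ∈ₗ E
          me = proj₁ (filtered kept? E m)
          any-t : Any (λ i → Touch i e) ks
          any-t = proj₂ (filtered kept? E m)
          i : Fin (length ks)
          i = Any.index any-t
          t : Touch (lookup ks i) e
          t = lookup-index any-t
          C : Center (proj₁ (lookup ks i)) (proj₂ (lookup ks i))
          C = proj₂ (∈-centers⁻ (kept⊆ (∈-lookup i)))
          ab : proj₁ (lookup ks i) ∈ e × proj₂ (lookup ks i) ∈ e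
          ab = touch⇒center C me t
          inside-star : ∀ {v} → v ≡ proj₁ (lookup ks i) ⊎ v ≡ proj₂ (lookup ks i) ⊎ Spoke (lookup ks i) v → InStar (lookup ks i) v
          inside-star (inj₁ q) = inj₁ (inj₁ q)
          inside-star (inj₂ (inj₁ q)) = inj₁ (inj₂ q)
          inside-star (inj₂ (inj₂ q)) = inj₂ q

opaque
  few-edges : ∀ n → 1000 ≤ n → ∀ m → 5 * half2 n ≤ 5 * m + n → m ≤ half2 n → (G : Graph4 n) → InF n m G → SubThick G
  few-edges n hn m hm m≤ G (free , refl , minimal) = pairing low≤2 , λ me → size4 G me , λ v ve → mate-edge low≤2 me ve
    where
    F : Family (edges G)
    F = graph-family G free
    open Stars F
    open Rest rest
    open Realised (thick n m m≤) renaming (free to free′; size to size′)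
    y : ℕ
    y = Σ[ X ] centers
    Δ≤n : Δ G ≤ n
    Δ≤n = ≤-trans (minimal graph free′ size′) maxdeg
    y+ℓ+H : y + ℓ + H ≡ n
    y+ℓ+H = trans (+-assoc y ℓ H) (trans (cong (y +_) total) vertex-count)
    -- With at least 20 spokes the degree bound n is enough. With fewer, a star has at most 9 edges
    -- per spoke, and 20 · 9 = 180 ≤ n.
    per-star : ∀ {i} → i ∈ₗ centers → 20 * ed i ≤ n * X i
    per-star {a , b} mi with C ← proj₂ (∈-centers⁻ mi) with 20 ≤? X (a , b)
    ... | yes h = ≤-trans (*-mono-≤ h (≤-trans (ed≤deg C) (≤-trans (deg₁≤Δ G a) Δ≤n))) (≤-reflexive (*-comm (X (a , b)) n))
    ... | no ¬h = begin
      20 * ed (a , b)                         ≡⟨ *-assoc 10 2 (ed (a , b)) ⟩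
      10 * (2 * ed (a , b))                   ≤⟨ *-monoʳ-≤ 10 (≤-trans (ed≤pairs C) (*-monoˡ-≤ (X (a , b)) (∸-monoˡ-≤ 1 (≤-pred (≰⇒> ¬h))))) ⟩
      10 * (18 * X (a , b))                   ≡⟨ *-assoc 10 18 (X (a , b)) ⟨
      180 * X (a , b)                         ≤⟨ *-monoˡ-≤ (X (a , b)) (≤-trans (m≤m+n 180 820) hn) ⟩
      n * X (a , b)                           ∎
      where open ≤-Reasoning
    hS : 20 * Σ[ ed ] centers ≤ n * y
    hS = ≤-trans (≤-reflexive (sym (Σ-* 20 ed centers))) (≤-trans (Σ-mono centers per-star) (≤-reflexive (Σ-* n X centers)))
    small : y + ℓ ≤ 2
    small = deficit≤2 (y + ℓ) H (≤-trans hn (≤-reflexive (sym y+ℓ+H)))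
      (deficit y ℓ H (Σ[ ed ] centers) (length RestE) (half2 n) (≤-trans (m≤m+n 900 100) (≤-trans hn (≤-reflexive (sym y+ℓ+H))))
        (subst (λ z → 20 * Σ[ ed ] centers ≤ z * y) (sym y+ℓ+H) hS) bound₂
        (subst (λ z → 5 * half2 n ≤ 5 * (Σ[ ed ] centers + length RestE) + z) (sym y+ℓ+H) (subst (λ z → 5 * half2 n ≤ 5 * z + n) (sym edge-count) hm))
        (subst (λ z → z * z + 3 ≤ 8 * half2 n + 4 * z) (sym y+ℓ+H) (half-below n (≤-trans (m≤m+n 2 998) hn))))
    rest≡ : RestE ≡ edges G
    rest≡ = no-centers⇒rest F (no-spokes⇒no-centers F (≤-trans (m+n≤o⇒m≤o y small) (m≤m+n 2 2)))
    ℓ≤2 : ℓ ≤ 2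
    ℓ≤2 = ≤-trans (m≤n+m ℓ y) small
    fl : Deg₃≤ 3 (edges G) × H ≡ # (high? (edges G)) V
    fl = subst (λ z → Deg₃≤ 3 z × H ≡ # (high? z) V) rest≡ (few-low (≤-trans ℓ≤2 (m≤m+n 2 1)))
    open Twin F (λ {a} {b} {c} → proj₁ fl {a} {b} {c})
    low≤2 : # low? V ≤ 2
    low≤2 = ≤-trans (≤-reflexive (+-cancelʳ-≡ H _ _ (trans (cong (# low? V +_) (proj₂ fl)) (trans (+-comm (# low? V) _)
      (trans (#-compl (high? (edges G)) V) (trans length-V (sym y+ℓ+H))))))) small

opaque
  many-edges : ∀ n → 400008 ≤ n → ∀ m → suc (half2 n) ≤ m → (G : Graph4 n) → InF n m G →
    (n * n ≤ 32 * Δ G + 32 * n) × DeleteToStars 470 G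
  many-edges n hn m hm G (free , refl , minimal) = subst (λ z → n * n ≤ 32 * z + 32 * n) (proj₂ d) degree-bound , delete kept-stars
    where
    F : Family (edges G)
    F = graph-family G free
    open Stars F
    open Rest rest
    n≥2 : 2 ≤ n
    n≥2 = ≤-trans (m≤m+n 2 400006) hn
    -- There are edges, so the degree sum is positive and the maximum degree has a predecessor c,
    -- the degree allowed to competitors.
    d : ∃ λ c → suc c ≡ Δ G
    d = positive (Δ G) refl
      where
      positive : ∀ k → Δ G ≡ k → ∃ λ c → suc c ≡ Δ G
      positive (suc c) eq = c , sym eq
      positive zero eq = contradiction (≤-trans (s≤s z≤n) (≤-trans hm (≤-trans (m≤n*m (length (edges G)) 4) (≤-reflexive (sym (deg-sum F))))))
        (<⇒≱ (s≤s (≤-trans (Σ-mono V (λ {v} _ → ≤-trans (deg₁≤Δ G v) (≤-reflexive eq))) (≤-reflexive (Σ-0 (V {n}))))))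
    c : ℕ
    c = proj₁ d
    -- Otherwise the explicit union of stars would yield a free 4-graph with m edges and maximum
    -- degree at most c, against minimality.
    star : ∀ xs → Σ[ (_+ 2) ] xs ≤ n → Σ[ cap c ] xs < m
    star xs fit with m ≤? Σ[ cap c ] xs
    ... | no h = ≰⇒> h
    ... | yes h = contradiction (≤-trans (≤-reflexive (proj₂ d)) (≤-trans (minimal R.graph R.free R.size) R.maxdeg)) (<⇒≱ ≤-refl)
      where module R = Realised (stars n m c xs fit h)
    has-center : 1 ≤ length centers
    has-center = nonempty centers refl
      where
      nonempty : ∀ is → centers ≡ is → 1 ≤ length is
      nonempty (i ∷ is) _ = s≤s z≤n
      nonempty [] eq = ⊥-elim (no-centers hn F (rest-bounds F (subst Light (no-centers⇒rest F eq) rest-light) {W = λ _ → ⊤} (λ _ → yes tt) (λ _ _ → tt)) refl hm)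
    open Optimise centers X ed n m c (# W? V) (length RestE) ℓ H
      (λ {i} mi → 5≤X (proj₂ (∈-centers⁻ mi))) (λ {i} mi → ed≤pairs (proj₂ (∈-centers⁻ mi)))
      (λ {i} mi → ≤-trans (ed≤deg (proj₂ (∈-centers⁻ mi))) (≤-trans (deg₁≤Δ G (proj₁ i)) (≤-reflexive (sym (proj₂ d)))))
      vertex-count edge-count centers-outside total bound₁ bound₂ star (half-above n m n≥2 hm) has-center hn
      (proj₁ (tri-inverse c)) (proj₁ (proj₂ (tri-inverse c))) (proj₂ (proj₂ (tri-inverse c)))
    delete : (∃ λ ks → ∃ λ rs → centers ↭ ks ++ rs × 1 ≤ length ks × length ks ≤ 4 × Σ[ ed ] rs + length RestE ≤ 470) → DeleteToStars 470 G
    delete (ks , rs , p , pos , ≤4 , few) = Kept F ks rs p , filter-⊆ (kept? F ks rs p) (edges G) ,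
      ≤-trans (kept-count F ks rs p) few , length ks , ≤4 , kept-stars-union F ks rs p pos

theorem4 : (Σ ℕ λ n₁ → ∀ n → n₁ ≤ n → ∀ m → 5 * half2 n ≤ 5 * m + n → m ≤ half2 n →
    ∀ (H : Graph4 n) → InF n m H → SubThick H)
    × (Σ ℕ λ n₁ → ∀ n → n₁ ≤ n → ∀ m → suc (half2 n) ≤ m →
    ∀ (H : Graph4 n) → InF n m H →
    (n * n ≤ 32 * Δ H + 32 * n) × DeleteToStars 470 H)
theorem4 = (1000 , few-edges) , (400008 , many-edges)
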